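{- (1) Let $P$ be a ProP and $\phi:\mathbf{PGr}_{\mathrm{ind}}\to P$ a morphism of $\mathfrak S\times\mathfrak S^{op}$-modules. There exists a unique ProP morphism $\Phi:\mathbf{PGr}\to P$ such that $\Phi|_{\mathbf{PGr}_{\mathrm{ind}}}=\phi$; that is, $\mathbf{PGr}$ is the free ProP generated by $\mathbf{PGr}_{\mathrm{ind}}$. (2) The planar graphs $PG_{k,l}$, $k,l\ge0$, generate a free $\mathfrak S\times\mathfrak S^{op}$-module $\mathbf{PGr}^{\uparrow}_{\mathrm{ind}}$, and $\mathbf{PGr}^{\uparrow}$ is the free ProP generated by $\mathbf{PGr}^{\uparrow}_{\mathrm{ind}}$.
   Context: $[n]=\{1,\dots,n\}$. Graphs. A graph is a tuple $G=(V(G),E(G),I(G),O(G),IO(G),L(G),s,t,\alpha,\beta)$ where $V(G)$ (vertices), $E(G)$ (internal edges), $I(G)$ (input edges), $O(G)$ (output edges), $IO(G)$ (input-output edges), $L(G)$ (loops) are finite sets, $s:E(G)\sqcup O(G)\to V(G)$, $t:E(G)\sqcup I(G)\to V(G)$, $\alpha:I(G)\sqcup IO(G)\to[i(G)]$ a bijection with $i(G)=|I(G)|+|IO(G)|$, $\beta:O(G)\sqcup IO(G)\to[o(G)]$ a bijection with $o(G)=|O(G)|+|IO(G)|$. Operations on graphs: $\sigma\cdot G$ replaces $\beta$ by $\sigma\circ\beta$, $G\cdot\tau$ replaces $\alpha$ by $\tau^{ -1}\circ\alpha$; $G*G'$ is the disjoint union with input/output indices of $G'$ shifted by $i(G)$,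 resp. $o(G)$; for $o(G)=i(G')$, $G'\circ G$ is obtained by gluing, for each $r\in[o(G)]$, the output (or input-output) edge of $G$ with index $r$ to the input (or input-output) edge of $G'$ with index $r$ (an output edge glued to an input edge becomes an internal edge from $s(f)$ to $t'(e)$; gluings involving input-output edges give input, output or input-output edges), vertices and loops being disjoint unions, input indices coming from $G$ and output indices from $G'$. Units: the empty graph and the graph with a single input-output edge. Planar graphs. For $v\in V(G)$, $I(v)=\{e\in I(G)\sqcup E(G):t(e)=v\}$, $O(v)=\{e\in O(G)\sqcup E(G):s(e)=v\}$. A planar graph is a graph with a total order on $I(v)$ and on $O(v)$ for every vertex $v$; isomorphisms of planar graphs are graph isomorphisms preserving these orders. $\mathbf{PGr}(k,l)$ is the vector space spanned by isoclasses of planar graphs with $i(G)=k$, $o(G)=l$; with the operations of the underlying graphs (the orders at the vertices being preserved) it is a ProP. $\mathbf{PGr}^{\uparrow}$ is its sub-ProP spanned by planar graphs with no cycle (sequence $(e_1,\dots,e_k)$, $k\ge1$, of internal edges with $t(e_i)=s(e_{i+1})$ and $t(e_k)=s(e_1)$) and no loop. A (planar) graph is indecomposable if (1) $V(G)\ne\emptyset$; (2) $IO(G)=\emptyset$; (3) $L(G)=\emptyset$ or $G$ is reduced to a single loop; (4) $G=G'\circ G''$ implies $V(G')=\emptyset$ or $V(G'')=\emptyset$; (5) $G=\sigma\cdot(G'*G'')\cdot\tau$ implies $V(G')=\emptyset$ or $V(G'')=\emptyset$. A planar graph is indecomposable if its underlying graph is; $\mathbf{PGr}_{\mathrm{ind}}$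 is the span of indecomposable planar graphs. $PG_{k,l}$ is the planar graph with one vertex $\star$, no internal, input-output edges or loops, input edges $[k]$ and output edges $[l]$ indexed by the identity, with $I(\star)$, $O(\star)$ ordered by the usual order of $[k]$, $[l]$; $\mathbf{PGr}^{\uparrow}_{\mathrm{ind}}$ is the $\mathfrak S\times\mathfrak S^{op}$-submodule spanned by the $\sigma\cdot PG_{k,l}\cdot\tau$. ProP. A ProP is a family $P=(P(k,l))$ of vector spaces with: commuting left $\mathfrak S_l$- and right $\mathfrak S_k$-actions; an associative horizontal concatenation $*$ with unit $I_0\in P(0,0)$; an associative vertical concatenation $\circ:P(l,m)\otimes P(k,l)\to P(k,m)$ with unit $I_1$ ($p\circ I_k=I_l\circ p=p$, $I_n=I_1^{*n}$); $(p*p')\circ(q*q')=(p\circ q)*(p'\circ q')$; $\sigma\cdot(p\circ q)=(\sigma\cdot p)\circ q$, $(p\circ q)\cdot\nu=p\circ(q\cdot\nu)$, $(p\cdot\tau)\circ q=p\circ(\tau\cdot q)$; $(\sigma\cdot p)*(\sigma'\cdot p')=(\sigma\otimes\sigma')\cdot(p*p')$, $(p\cdot\tau)*(p'\cdot\tau')=(p*p')\cdot(\tau\otimes\tau')$, $c_{l,l'}\cdot(p*p')=(p'*p)\cdot c_{k,k'}$, with $\alpha\otimes\beta$ acting as $\alpha$ on $[m]$ and $i\mapsto\beta(i-m)+m$ for $i>m$, and $c_{m,n}(i)=i+n$ ($i\le m$), $i-m$ ($i>m$). "Free ProP $Q$ generated by a submodule $M$" means: every module morphism $M\to P$ into a ProP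 extends uniquely to a ProP morphism $Q\to P$.
   Formalization: Condition (1) of indecomposability is read as "V(G) is nonempty or G is reduced to a single loop"; with V(G) nonempty alone the loop is not generated by the indecomposable graphs and uniqueness in (1) fails. -}

module Defs where

open import Level using (Level; _⊔_; 0ℓ) renaming (suc to lsuc)
open import Data.Nat as ℕ using (ℕ; zero; suc)
open import Data.Nat.Properties using (+-assoc; +-comm; +-identityʳ)
open import Data.Fin using (Fin; toℕ; splitAt; _↑ˡ_; _↑ʳ_) renaming (zero to fzero; suc to fsuc)
open import Data.Fin.Properties using (+↔⊎; splitAt-↑ˡ; splitAt-↑ʳ; splitAt⁻¹-↑ˡ; splitAt⁻¹-↑ʳ)
open import Data.Fin.Permutation using (Permutation′; _⟨$⟩ʳ_; _⟨$⟩ˡ_; _∘ₚ_; cast-id; inverseˡ; inverseʳ)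
  renaming (id to idₚ; _≈_ to _≈ₚ_)
open import Data.Sum using (_⊎_; inj₁; inj₂; [_,_]′)
  renaming (map to ⊎map; map₁ to ⊎map₁; map₂ to ⊎map₂)
open import Data.Sum.Algebra using (⊎-comm)
open import Data.Sum.Function.Propositional using (_⊎-↔_)
open import Data.Product using (Σ; _×_; _,_; proj₁; proj₂)
open import Data.Bool using (Bool; true; false; T; _∧_)
open import Data.Empty using (⊥)
open import Data.Unit using (⊤; tt)
open import Relation.Nullary using (¬_)
open import Relation.Binary.PropositionalEquality
  using (_≡_; refl; subst₂; sym; trans; cong)
open import Function using (_↔_; Inverse; _⇔_)
open import Function.Properties.Inverse using (↔-sym; ↔-trans)
open import Algebra.Bundles using (CommutativeRing)
open import Algebra.Module.Bundles using (Module)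

record Field (c ℓ : Level) : Set (lsuc (c ⊔ ℓ)) where
  field
    commutativeRing : CommutativeRing c ℓ
  open CommutativeRing commutativeRing using (Carrier; _≈_; 0#; 1#)
    renaming (_*_ to _·_)
  field
    0≉1     : ¬ (0# ≈ 1#)
    inverse : ∀ x → ¬ (x ≈ 0#) → Σ Carrier (λ y → (x · y) ≈ 1#)

-- A universe of finite sets.  Every code denotes a finite set, and every
-- finite set is (in bijection with) some  El (fin n).

data FinTy : Set where
  fin : ℕ → FinTy
  _⊕_ : FinTy → FinTy → FinTy
  sub : (n : ℕ) → (Fin n → Bool) → FinTy

El : FinTy → Set
El (fin n)   = Fin n
El (A ⊕ B)   = El A ⊎ El B
El (sub n p) = Σ (Fin n) (λ i → T (p i))

-- cardinality bound and a canonical injective numbering (used only as a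
-- tie-breaker, see PGraph below)
size : FinTy → ℕ
size (fin n)   = n
size (A ⊕ B)   = size A ℕ.+ size B
size (sub n p) = n

idx : (A : FinTy) → El A → ℕ
idx (fin n)   i        = toℕ i
idx (A ⊕ B)   (inj₁ a) = idx A a
idx (A ⊕ B)   (inj₂ b) = size A ℕ.+ idx B b
idx (sub n p) (i , _)  = toℕ i

Empty : Set → Set
Empty A = A → ⊥

isInj₁ : {A B : Set} → A ⊎ B → Bool
isInj₁ (inj₁ _) = true
isInj₁ (inj₂ _) = false

getInj₁ : {A B : Set} (x : A ⊎ B) → T (isInj₁ x) → A
getInj₁ (inj₁ a) _ = a

∧-fst : ∀ a b → T (a ∧ b) → T a
∧-fst true  b _ = tt

∧-snd : ∀ a b → T (a ∧ b) → T b
∧-snd true  b p = p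

-- Graphs.
--
-- A graph G with i(G) = k, o(G) = l.  The input (resp. output, io) edges
-- are identified with their indices via α (resp. β):  input index r is
--   * an input edge with target v             if  inT r  ≡ inj₁ v,
--   * an input-output edge with output index j if  inT r  ≡ inj₂ j;
-- output index j is an output edge with source v iff outS j ≡ inj₁ v,
-- and an io edge with input index r iff outS j ≡ inj₂ r (io→ / io←).
-- V, E (internal edges, with s,t) and L (loops) are finite sets.

record Graph (k l : ℕ) : Set where
  field
    V E L : FinTy
    s t   : El E → El V
    inT   : Fin k → El V ⊎ Fin l
    outS  : Fin l → El V ⊎ Fin k
    io→   : ∀ r j → inT r ≡ inj₂ j → outS j ≡ inj₂ r
    io←   : ∀ r j → outS j ≡ inj₂ r → inT r ≡ inj₂ j

record GIso {k l : ℕ} (G H : Graph k l) : Set where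
  private
    module G = Graph G
    module H = Graph H
  field
    fV : El G.V ↔ El H.V
    fE : El G.E ↔ El H.E
    fL : El G.L ↔ El H.L
    s-comm    : ∀ e → Inverse.to fV (G.s e) ≡ H.s (Inverse.to fE e)
    t-comm    : ∀ e → Inverse.to fV (G.t e) ≡ H.t (Inverse.to fE e)
    inT-comm  : ∀ r → H.inT r  ≡ ⊎map₁ (Inverse.to fV) (G.inT r)
    outS-comm : ∀ j → H.outS j ≡ ⊎map₁ (Inverse.to fV) (G.outS j)

-- σ · G  : β replaced by σ ∘ β
module _ {k l : ℕ} (σ : Permutation′ l) (G : Graph k l) where
  open Graph G
  private
    inT′ : Fin k → El V ⊎ Fin l
    inT′ r = ⊎map₂ (σ ⟨$⟩ʳ_) (inT r)
    outS′ : Fin l → El V ⊎ Fin k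
    outS′ j = outS (σ ⟨$⟩ˡ j)
    io→′ : ∀ r j → inT′ r ≡ inj₂ j → outS′ j ≡ inj₂ r
    io→′ r j p with inT r in eq
    io→′ r j () | inj₁ v
    io→′ r .(σ ⟨$⟩ʳ j₀) refl | inj₂ j₀ = trans (cong outS (inverseˡ σ)) (io→ r j₀ eq)
    io←′ : ∀ r j → outS′ j ≡ inj₂ r → inT′ r ≡ inj₂ j
    io←′ r j p = trans (cong (⊎map₂ (σ ⟨$⟩ʳ_)) (io← r (σ ⟨$⟩ˡ j) p)) (cong inj₂ (inverseʳ σ))

  infixr 20 _▷G_
  _▷G_ : Graph k l
  _▷G_ = record { V = V ; E = E ; L = L ; s = s ; t = t ; inT = inT′ ; outS = outS′
                ; io→ = io→′ ; io← = io←′ }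

-- G · τ  : α replaced by τ⁻¹ ∘ α
module _ {k l : ℕ} (G : Graph k l) (τ : Permutation′ k) where
  open Graph G
  private
    inT′ : Fin k → El V ⊎ Fin l
    inT′ r = inT (τ ⟨$⟩ʳ r)
    outS′ : Fin l → El V ⊎ Fin k
    outS′ j = ⊎map₂ (τ ⟨$⟩ˡ_) (outS j)
    io→′ : ∀ r j → inT′ r ≡ inj₂ j → outS′ j ≡ inj₂ r
    io→′ r j p = trans (cong (⊎map₂ (τ ⟨$⟩ˡ_)) (io→ (τ ⟨$⟩ʳ r) j p)) (cong inj₂ (inverseˡ τ))
    io←′ : ∀ r j → outS′ j ≡ inj₂ r → inT′ r ≡ inj₂ j
    io←′ r j p with outS j in eq
    io←′ r j () | inj₁ v
    io←′ .(τ ⟨$⟩ˡ r₀) j refl | inj₂ r₀ = trans (cong inT (inverseʳ τ)) (io← r₀ j eq)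

  infixl 20 _◁G_
  _◁G_ : Graph k l
  _◁G_ = record { V = V ; E = E ; L = L ; s = s ; t = t ; inT = inT′ ; outS = outS′
                ; io→ = io→′ ; io← = io←′ }

module _ {k l k′ l′ : ℕ} (G : Graph k l) (H : Graph k′ l′) where
  private
    module G = Graph G
    module H = Graph H
    inT′ : Fin (k ℕ.+ k′) → El (G.V ⊕ H.V) ⊎ Fin (l ℕ.+ l′)
    inT′ r = [ (λ r₁ → ⊎map inj₁ (_↑ˡ l′) (G.inT r₁)) , (λ r₂ → ⊎map inj₂ (l ↑ʳ_) (H.inT r₂)) ]′ (splitAt k r)
    outS′ : Fin (l ℕ.+ l′) → El (G.V ⊕ H.V) ⊎ Fin (k ℕ.+ k′)
    outS′ j = [ (λ j₁ → ⊎map inj₁ (_↑ˡ k′) (G.outS j₁)) , (λ j₂ → ⊎map inj₂ (k ↑ʳ_) (H.outS j₂)) ]′ (splitAt l j)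
    io→′ : ∀ r j → inT′ r ≡ inj₂ j → outS′ j ≡ inj₂ r
    io→′ r j p with splitAt k r in e₀
    io→′ r j p | inj₁ r₁ with G.inT r₁ in e₁
    io→′ r j () | inj₁ r₁ | inj₁ v
    io→′ r .(j₁ ↑ˡ l′) refl | inj₁ r₁ | inj₂ j₁
      rewrite splitAt-↑ˡ l j₁ l′ | G.io→ r₁ j₁ e₁ = cong inj₂ (splitAt⁻¹-↑ˡ e₀)
    io→′ r j p | inj₂ r₂ with H.inT r₂ in e₁
    io→′ r j () | inj₂ r₂ | inj₁ v
    io→′ r .(l ↑ʳ j₂) refl | inj₂ r₂ | inj₂ j₂
      rewrite splitAt-↑ʳ l l′ j₂ | H.io→ r₂ j₂ e₁ = cong inj₂ (splitAt⁻¹-↑ʳ e₀)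
    io←′ : ∀ r j → outS′ j ≡ inj₂ r → inT′ r ≡ inj₂ j
    io←′ r j p with splitAt l j in e₀
    io←′ r j p | inj₁ j₁ with G.outS j₁ in e₁
    io←′ r j () | inj₁ j₁ | inj₁ v
    io←′ .(r₁ ↑ˡ k′) j refl | inj₁ j₁ | inj₂ r₁
      rewrite splitAt-↑ˡ k r₁ k′ | G.io← r₁ j₁ e₁ = cong inj₂ (splitAt⁻¹-↑ˡ e₀)
    io←′ r j p | inj₂ j₂ with H.outS j₂ in e₁
    io←′ r j () | inj₂ j₂ | inj₁ v
    io←′ .(k ↑ʳ r₂) j refl | inj₂ j₂ | inj₂ r₂
      rewrite splitAt-↑ʳ k k′ r₂ | H.io← r₂ j₂ e₁ = cong inj₂ (splitAt⁻¹-↑ʳ e₀)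

  infixl 15 _*G_
  _*G_ : Graph (k ℕ.+ k′) (l ℕ.+ l′)
  _*G_ = record
    { V = G.V ⊕ H.V ; E = G.E ⊕ H.E ; L = G.L ⊕ H.L
    ; s = ⊎map G.s H.s ; t = ⊎map G.t H.t
    ; inT = inT′ ; outS = outS′ ; io→ = io→′ ; io← = io←′ }

module _ {k l m : ℕ} (G′ : Graph l m) (G : Graph k l) where
  private
    module G = Graph G
    module G′ = Graph G′
    -- output index j of G glued to input index j of G' gives an internal edge
    glue : Fin l → Bool
    glue j = isInj₁ (G.outS j) ∧ isInj₁ (G′.inT j)
    E″ : FinTy
    E″ = (G.E ⊕ G′.E) ⊕ sub l glue
    s″ : El E″ → El (G.V ⊕ G′.V)
    s″ (inj₁ (inj₁ e)) = inj₁ (G.s e)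
    s″ (inj₁ (inj₂ e)) = inj₂ (G′.s e)
    s″ (inj₂ (j , p))  = inj₁ (getInj₁ (G.outS j) (∧-fst _ _ p))
    t″ : El E″ → El (G.V ⊕ G′.V)
    t″ (inj₁ (inj₁ e)) = inj₁ (G.t e)
    t″ (inj₁ (inj₂ e)) = inj₂ (G′.t e)
    t″ (inj₂ (j , p))  = inj₂ (getInj₁ (G′.inT j) (∧-snd _ _ p))
    inT″ : Fin k → El (G.V ⊕ G′.V) ⊎ Fin m
    inT″ r = [ (λ v → inj₁ (inj₁ v)) , (λ j → ⊎map₁ inj₂ (G′.inT j)) ]′ (G.inT r)
    outS″ : Fin m → El (G.V ⊕ G′.V) ⊎ Fin k
    outS″ j′ = [ (λ v → inj₁ (inj₂ v)) , (λ j → ⊎map₁ inj₁ (G.outS j)) ]′ (G′.outS j′)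
    io→″ : ∀ r j′ → inT″ r ≡ inj₂ j′ → outS″ j′ ≡ inj₂ r
    io→″ r j′ p with G.inT r in e₁
    io→″ r j′ () | inj₁ v
    io→″ r j′ p | inj₂ j with G′.inT j in e₂
    io→″ r j′ () | inj₂ j | inj₁ v
    io→″ r j′ refl | inj₂ j | inj₂ .j′
      rewrite G′.io→ j j′ e₂ | G.io→ r j e₁ = refl
    io←″ : ∀ r j′ → outS″ j′ ≡ inj₂ r → inT″ r ≡ inj₂ j′
    io←″ r j′ p with G′.outS j′ in e₁
    io←″ r j′ () | inj₁ v
    io←″ r j′ p | inj₂ j with G.outS j in e₂
    io←″ r j′ () | inj₂ j | inj₁ v
    io←″ r j′ refl | inj₂ j | inj₂ .r
      rewrite G.io← r j e₂ | G′.io← j j′ e₁ = refl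

  infixr 10 _⊚G_
  _⊚G_ : Graph k m
  _⊚G_ = record
    { V = G.V ⊕ G′.V ; E = E″ ; L = G.L ⊕ G′.L ; s = s″ ; t = t″
    ; inT = inT″ ; outS = outS″ ; io→ = io→″ ; io← = io←″ }

-- Planar graphs.
--
-- For a vertex v, I(v) = {e ∈ I(G) ⊔ E(G) : t(e) = v}; in our encoding the
-- incoming half-edges are  El E ⊎ Fin k  (internal edges, input indices)
-- with target  inTgt.  A total order on each I(v) is given by a rank
-- function to ℕ, ties being broken by the canonical injective numbering
-- idxIn (so every rank function gives a total order on each I(v), and
-- every family of total orders arises).  Same for O(v).

record PGraph (k l : ℕ) : Set where
  field
    graph : Graph k l
  open Graph graph public
  field
    inRank  : El E ⊎ Fin k → ℕ
    outRank : El E ⊎ Fin l → ℕ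

module _ {k l : ℕ} (G : PGraph k l) where
  open PGraph G

  inTgt : El E ⊎ Fin k → El V ⊎ Fin l
  inTgt (inj₁ e) = inj₁ (t e)
  inTgt (inj₂ r) = inT r

  outSrc : El E ⊎ Fin l → El V ⊎ Fin k
  outSrc (inj₁ e) = inj₁ (s e)
  outSrc (inj₂ j) = outS j

  idxIn : El E ⊎ Fin k → ℕ
  idxIn (inj₁ e) = idx E e
  idxIn (inj₂ r) = size E ℕ.+ toℕ r

  idxOut : El E ⊎ Fin l → ℕ
  idxOut (inj₁ e) = idx E e
  idxOut (inj₂ j) = size E ℕ.+ toℕ j

  _<in_ : El E ⊎ Fin k → El E ⊎ Fin k → Set
  x <in y = inRank x ℕ.< inRank y ⊎ (inRank x ≡ inRank y × idxIn x ℕ.< idxIn y)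

  _<out_ : El E ⊎ Fin l → El E ⊎ Fin l → Set
  x <out y = outRank x ℕ.< outRank y ⊎ (outRank x ≡ outRank y × idxOut x ℕ.< idxOut y)

  -- a single number encoding the pair (rank, idx) lexicographically; used to
  -- transport the orders to graphs built from G
  encIn : El E ⊎ Fin k → ℕ
  encIn x = inRank x ℕ.* (size E ℕ.+ k) ℕ.+ idxIn x

  encOut : El E ⊎ Fin l → ℕ
  encOut x = outRank x ℕ.* (size E ℕ.+ l) ℕ.+ idxOut x

record PIso {k l : ℕ} (G H : PGraph k l) : Set where
  field
    giso : GIso (PGraph.graph G) (PGraph.graph H)
  open GIso giso
  mapE : El (PGraph.E G) ⊎ Fin k → El (PGraph.E H) ⊎ Fin k
  mapE = ⊎map₁ (Inverse.to fE)
  mapE′ : El (PGraph.E G) ⊎ Fin l → El (PGraph.E H) ⊎ Fin l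
  mapE′ = ⊎map₁ (Inverse.to fE)
  field
    in-order  : ∀ v x y → inTgt G x ≡ inj₁ v → inTgt G y ≡ inj₁ v →
                (_<in_ G x y ⇔ _<in_ H (mapE x) (mapE y))
    out-order : ∀ v x y → outSrc G x ≡ inj₁ v → outSrc G y ≡ inj₁ v →
                (_<out_ G x y ⇔ _<out_ H (mapE′ x) (mapE′ y))

infixr 20 _▷P_
_▷P_ : {k l : ℕ} → Permutation′ l → PGraph k l → PGraph k l
σ ▷P G = record
  { graph   = σ ▷G PGraph.graph G
  ; inRank  = PGraph.inRank G
  ; outRank = λ { (inj₁ e) → encOut G (inj₁ e) ; (inj₂ j) → encOut G (inj₂ (σ ⟨$⟩ˡ j)) } }

infixl 20 _◁P_
_◁P_ : {k l : ℕ} → PGraph k l → Permutation′ k → PGraph k l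
G ◁P τ = record
  { graph   = PGraph.graph G ◁G τ
  ; inRank  = λ { (inj₁ e) → encIn G (inj₁ e) ; (inj₂ r) → encIn G (inj₂ (τ ⟨$⟩ʳ r)) }
  ; outRank = PGraph.outRank G }

infixl 15 _*P_
_*P_ : {k l k′ l′ : ℕ} → PGraph k l → PGraph k′ l′ → PGraph (k ℕ.+ k′) (l ℕ.+ l′)
_*P_ {k} {l} G H = record
  { graph   = PGraph.graph G *G PGraph.graph H
  ; inRank  = λ { (inj₁ (inj₁ e)) → encIn G (inj₁ e)
                ; (inj₁ (inj₂ e)) → encIn H (inj₁ e)
                ; (inj₂ r) → [ (λ r₁ → encIn G (inj₂ r₁)) , (λ r₂ → encIn H (inj₂ r₂)) ]′ (splitAt k r) }
  ; outRank = λ { (inj₁ (inj₁ e)) → encOut G (inj₁ e)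
                ; (inj₁ (inj₂ e)) → encOut H (inj₁ e)
                ; (inj₂ j) → [ (λ j₁ → encOut G (inj₂ j₁)) , (λ j₂ → encOut H (inj₂ j₂)) ]′ (splitAt l j) } }

infixr 10 _⊚P_
_⊚P_ : {k l m : ℕ} → PGraph l m → PGraph k l → PGraph k m
G′ ⊚P G = record
  { graph   = PGraph.graph G′ ⊚G PGraph.graph G
  ; inRank  = λ { (inj₁ (inj₁ (inj₁ e))) → encIn G (inj₁ e)
                ; (inj₁ (inj₁ (inj₂ e))) → encIn G′ (inj₁ e)
                ; (inj₁ (inj₂ (j , _)))  → encIn G′ (inj₂ j)
                ; (inj₂ r) → [ (λ _ → encIn G (inj₂ r)) , (λ j → encIn G′ (inj₂ j)) ]′ (PGraph.inT G r) }
  ; outRank = λ { (inj₁ (inj₁ (inj₁ e))) → encOut G (inj₁ e)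
                ; (inj₁ (inj₁ (inj₂ e))) → encOut G′ (inj₁ e)
                ; (inj₁ (inj₂ (j , _)))  → encOut G (inj₂ j)
                ; (inj₂ j′) → [ (λ _ → encOut G′ (inj₂ j′)) , (λ j → encOut G (inj₂ j)) ]′ (PGraph.outS G′ j′) } }

I₀P : PGraph 0 0
I₀P = record
  { graph = record { V = fin 0 ; E = fin 0 ; L = fin 0 ; s = λ () ; t = λ ()
                   ; inT = λ () ; outS = λ () ; io→ = λ () ; io← = λ () }
  ; inRank = λ _ → 0 ; outRank = λ _ → 0 }

private
  io1 : (r j : Fin 1) → inj₂ {A = Fin 0} fzero ≡ inj₂ j → inj₂ {A = Fin 0} fzero ≡ inj₂ r
  io1 fzero fzero _ = refl
  io1′ : (r j : Fin 1) → inj₂ {A = Fin 0} fzero ≡ inj₂ r → inj₂ {A = Fin 0} fzero ≡ inj₂ j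
  io1′ fzero fzero _ = refl

I₁P : PGraph 1 1
I₁P = record
  { graph = record { V = fin 0 ; E = fin 0 ; L = fin 0 ; s = λ () ; t = λ ()
                   ; inT = λ _ → inj₂ fzero ; outS = λ _ → inj₂ fzero ; io→ = io1 ; io← = io1′ }
  ; inRank = λ _ → 0 ; outRank = λ _ → 0 }

PG : (k l : ℕ) → PGraph k l
PG k l = record
  { graph = record { V = fin 1 ; E = fin 0 ; L = fin 0 ; s = λ () ; t = λ ()
                   ; inT = λ _ → inj₁ fzero ; outS = λ _ → inj₁ fzero
                   ; io→ = λ _ _ () ; io← = λ _ _ () }
  ; inRank  = λ { (inj₂ r) → toℕ r }
  ; outRank = λ { (inj₂ j) → toℕ j } }

module _ {k l : ℕ} (G : Graph k l) where
  open Graph G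

  data Walk : El V → El V → Set where
    one  : ∀ e {u w} → s e ≡ u → t e ≡ w → Walk u w
    cons : ∀ e {u w} → s e ≡ u → Walk (t e) w → Walk u w

  HasCycle : Set
  HasCycle = Σ (El V) (λ v → Walk v v)

  SingleLoop : Set
  SingleLoop = Empty (El V) × Empty (El E) × k ≡ 0 × l ≡ 0
             × Σ (El L) (λ x → ∀ y → y ≡ x)

  NoIO : Set
  NoIO = ∀ r j → ¬ (inT r ≡ inj₂ j)

  Indecomposable : Set
  Indecomposable =
      (¬ Empty (El V) ⊎ SingleLoop)
    × NoIO
    × (Empty (El L) ⊎ SingleLoop)
    × (∀ {n} (G₁ : Graph n l) (G₂ : Graph k n) → GIso G (G₁ ⊚G G₂) →
         Empty (El (Graph.V G₁)) ⊎ Empty (El (Graph.V G₂)))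
    × (∀ {k₁ k₂ l₁ l₂} (G₁ : Graph k₁ l₁) (G₂ : Graph k₂ l₂)
         (σ : Permutation′ (l₁ ℕ.+ l₂)) (τ : Permutation′ (k₁ ℕ.+ k₂))
         (ek : k₁ ℕ.+ k₂ ≡ k) (el : l₁ ℕ.+ l₂ ≡ l) →
         GIso G (subst₂ Graph ek el ((σ ▷G (G₁ *G G₂)) ◁G τ)) →
         Empty (El (Graph.V G₁)) ⊎ Empty (El (Graph.V G₂)))

PGPred : Set₁
PGPred = (k l : ℕ) → PGraph k l → Set

AllPG : PGPred
AllPG _ _ _ = ⊤

IndPG : PGPred
IndPG _ _ G = Indecomposable (PGraph.graph G)

AcyclicPG : PGPred
AcyclicPG _ _ G = ¬ HasCycle (PGraph.graph G) × Empty (El (PGraph.L G))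

CorollaPG : PGPred
CorollaPG k l G = Σ (Permutation′ l) (λ σ → Σ (Permutation′ k) (λ τ → PIso G ((σ ▷P PG k l) ◁P τ)))

infixr 15 _⊗ₚ_
_⊗ₚ_ : {m n : ℕ} → Permutation′ m → Permutation′ n → Permutation′ (m ℕ.+ n)
σ ⊗ₚ σ′ = ↔-trans +↔⊎ (↔-trans (σ ⊎-↔ σ′) (↔-sym +↔⊎))

-- c_{m,n}(i) = i + n (i ≤ m), i - m (i > m)
cₚ : (m n : ℕ) → Permutation′ (m ℕ.+ n)
cₚ m n = ↔-trans (+↔⊎ {m} {n}) (↔-trans (⊎-comm (Fin m) (Fin n))
           (↔-trans (↔-sym (+↔⊎ {n} {m})) (cast-id (+-comm n m))))

module _ {c ℓ : Level} (R : CommutativeRing c ℓ) where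
  open CommutativeRing R using ()
    renaming (Carrier to K; _≈_ to _≈K_; _+_ to _+K_; _*_ to _*K_; 0# to 0K; 1# to 1K)

  -- The free R-module on a setoid of generators (G , ~): formal linear
  -- combinations modulo the module axioms and  g ~ h ⇒ g = h.
  -- With ~ = isomorphism, this is the span of the isoclasses.

  infixl 6 _⊞_
  infixr 7 _⊡_
  data Term (G : Set) : Set c where
    gen   : G → Term G
    zeroT : Term G
    _⊞_   : Term G → Term G → Term G
    _⊡_   : K → Term G → Term G

  data TEq {G : Set} (_~_ : G → G → Set) : Term G → Term G → Set (c ⊔ ℓ) where
    t-refl   : ∀ {x} → TEq _~_ x x
    t-sym    : ∀ {x y} → TEq _~_ x y → TEq _~_ y x
    t-trans  : ∀ {x y z} → TEq _~_ x y → TEq _~_ y z → TEq _~_ x z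
    t-gen    : ∀ {g h} → g ~ h → TEq _~_ (gen g) (gen h)
    t-⊞-cong : ∀ {x x′ y y′} → TEq _~_ x x′ → TEq _~_ y y′ → TEq _~_ (x ⊞ y) (x′ ⊞ y′)
    t-⊡-cong : ∀ {a b x y} → a ≈K b → TEq _~_ x y → TEq _~_ (a ⊡ x) (b ⊡ y)
    t-assoc  : ∀ {x y z} → TEq _~_ ((x ⊞ y) ⊞ z) (x ⊞ (y ⊞ z))
    t-comm   : ∀ {x y} → TEq _~_ (x ⊞ y) (y ⊞ x)
    t-idˡ    : ∀ {x} → TEq _~_ (zeroT ⊞ x) x
    t-distˡ  : ∀ {a x y} → TEq _~_ (a ⊡ (x ⊞ y)) (a ⊡ x ⊞ a ⊡ y)
    t-distʳ  : ∀ {a b x} → TEq _~_ ((a +K b) ⊡ x) (a ⊡ x ⊞ b ⊡ x)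
    t-⊡-assoc : ∀ {a b x} → TEq _~_ ((a *K b) ⊡ x) (a ⊡ (b ⊡ x))
    t-⊡-one  : ∀ {x} → TEq _~_ (1K ⊡ x) x
    t-⊡-zero : ∀ {x} → TEq _~_ (0K ⊡ x) zeroT

  mapT : {G H : Set} → (G → Term H) → Term G → Term H
  mapT f (gen g)  = f g
  mapT f zeroT    = zeroT
  mapT f (x ⊞ y)  = mapT f x ⊞ mapT f y
  mapT f (a ⊡ x)  = a ⊡ mapT f x

  PGr : ℕ → ℕ → Set c
  PGr k l = Term (PGraph k l)

  infix 4 _≈PGr_
  _≈PGr_ : {k l : ℕ} → PGr k l → PGr k l → Set (c ⊔ ℓ)
  _≈PGr_ = TEq PIso

  infixr 20 _▷T_
  _▷T_ : {k l : ℕ} → Permutation′ l → PGr k l → PGr k l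
  σ ▷T x = mapT (λ G → gen (σ ▷P G)) x

  infixl 20 _◁T_
  _◁T_ : {k l : ℕ} → PGr k l → Permutation′ k → PGr k l
  x ◁T τ = mapT (λ G → gen (G ◁P τ)) x

  infixl 15 _*T_
  _*T_ : {k l k′ l′ : ℕ} → PGr k l → PGr k′ l′ → PGr (k ℕ.+ k′) (l ℕ.+ l′)
  x *T y = mapT (λ G → mapT (λ H → gen (G *P H)) y) x

  infixr 10 _∘T_
  _∘T_ : {k l m : ℕ} → PGr l m → PGr k l → PGr k m
  x ∘T y = mapT (λ G′ → mapT (λ G → gen (G′ ⊚P G)) y) x

  I₀T : PGr 0 0
  I₀T = gen I₀P

  I₁T : PGr 1 1
  I₁T = gen I₁P

  -- the subspace of PGr spanned by the graphs in a family 𝒫: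
  -- formal combinations of such graphs, compared through their image in PGr
  Span : PGPred → ℕ → ℕ → Set c
  Span 𝒫 k l = Term (Σ (PGraph k l) (𝒫 k l))

  incl : (𝒫 : PGPred) {k l : ℕ} → Span 𝒫 k l → PGr k l
  incl 𝒫 = mapT (λ x → gen (proj₁ x))

  record SSModule (m ℓm : Level) : Set (c ⊔ ℓ ⊔ lsuc (m ⊔ ℓm)) where
    field
      M : ℕ → ℕ → Module R m ℓm
    Car : ℕ → ℕ → Set m
    Car k l = Module.Carrierᴹ (M k l)
    infix 4 _≋_
    _≋_ : {k l : ℕ} → Car k l → Car k l → Set ℓm
    _≋_ {k} {l} = Module._≈ᴹ_ (M k l)
    infixl 6 _+ᴹ_
    _+ᴹ_ : {k l : ℕ} → Car k l → Car k l → Car k l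
    _+ᴹ_ {k} {l} = Module._+ᴹ_ (M k l)
    infixr 7 _·ᴹ_
    _·ᴹ_ : {k l : ℕ} → K → Car k l → Car k l
    _·ᴹ_ {k} {l} = Module._*ₗ_ (M k l)
    infixr 20 _▷_
    infixl 20 _◁_
    field
      _▷_   : {k l : ℕ} → Permutation′ l → Car k l → Car k l
      _◁_   : {k l : ℕ} → Car k l → Permutation′ k → Car k l
      ▷-cong : ∀ {k l} {σ σ′ : Permutation′ l} {p q : Car k l} → σ ≈ₚ σ′ → p ≋ q → σ ▷ p ≋ σ′ ▷ q
      ◁-cong : ∀ {k l} {τ τ′ : Permutation′ k} {p q : Car k l} → τ ≈ₚ τ′ → p ≋ q → p ◁ τ ≋ q ◁ τ′
      ▷-+    : ∀ {k l} (σ : Permutation′ l) (p q : Car k l) → σ ▷ (p +ᴹ q) ≋ σ ▷ p +ᴹ σ ▷ q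
      ▷-·    : ∀ {k l} (σ : Permutation′ l) (a : K) (p : Car k l) → σ ▷ (a ·ᴹ p) ≋ a ·ᴹ (σ ▷ p)
      ◁-+    : ∀ {k l} (τ : Permutation′ k) (p q : Car k l) → (p +ᴹ q) ◁ τ ≋ p ◁ τ +ᴹ q ◁ τ
      ◁-·    : ∀ {k l} (τ : Permutation′ k) (a : K) (p : Car k l) → (a ·ᴹ p) ◁ τ ≋ a ·ᴹ (p ◁ τ)
      -- left action of 𝔖_l:  σ·(σ'·p) = (σ∘σ')·p   (σ' ∘ₚ σ is "σ' then σ")
      ▷-id   : ∀ {k l} (p : Car k l) → idₚ ▷ p ≋ p
      ▷-∘    : ∀ {k l} (σ σ′ : Permutation′ l) (p : Car k l) → σ ▷ (σ′ ▷ p) ≋ (σ′ ∘ₚ σ) ▷ p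
      -- right action of 𝔖_k:  (p·τ)·τ' = p·(τ∘τ')
      ◁-id   : ∀ {k l} (p : Car k l) → p ◁ idₚ ≋ p
      ◁-∘    : ∀ {k l} (τ τ′ : Permutation′ k) (p : Car k l) → (p ◁ τ) ◁ τ′ ≋ p ◁ (τ′ ∘ₚ τ)
      ▷◁     : ∀ {k l} (σ : Permutation′ l) (τ : Permutation′ k) (p : Car k l) → (σ ▷ p) ◁ τ ≋ σ ▷ (p ◁ τ)

  powerI : {m : Level} (C : ℕ → ℕ → Set m)
           (_⋆_ : {k l k′ l′ : ℕ} → C k l → C k′ l′ → C (k ℕ.+ k′) (l ℕ.+ l′))
           (I₀ : C 0 0) (I₁ : C 1 1) (n : ℕ) → C n n
  powerI C _⋆_ I₀ I₁ zero    = I₀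
  powerI C _⋆_ I₀ I₁ (suc n) = I₁ ⋆ powerI C _⋆_ I₀ I₁ n

  record ProP (m ℓm : Level) : Set (c ⊔ ℓ ⊔ lsuc (m ⊔ ℓm)) where
    field
      ssModule : SSModule m ℓm
    open SSModule ssModule public
    infixl 15 _*_
    infixr 10 _∘_
    field
      _*_ : {k l k′ l′ : ℕ} → Car k l → Car k′ l′ → Car (k ℕ.+ k′) (l ℕ.+ l′)
      _∘_ : {k l n : ℕ} → Car l n → Car k l → Car k n
      I₀  : Car 0 0
      I₁  : Car 1 1
    Iₙ : (n : ℕ) → Car n n
    Iₙ = powerI Car _*_ I₀ I₁
    field
      *-cong : ∀ {k l k′ l′} {p q : Car k l} {p′ q′ : Car k′ l′} → p ≋ q → p′ ≋ q′ → p * p′ ≋ q * q′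
      *-+ˡ   : ∀ {k l k′ l′} (p q : Car k l) (r : Car k′ l′) → (p +ᴹ q) * r ≋ p * r +ᴹ q * r
      *-+ʳ   : ∀ {k l k′ l′} (p : Car k l) (q r : Car k′ l′) → p * (q +ᴹ r) ≋ p * q +ᴹ p * r
      *-·ˡ   : ∀ {k l k′ l′} (a : K) (p : Car k l) (r : Car k′ l′) → (a ·ᴹ p) * r ≋ a ·ᴹ (p * r)
      *-·ʳ   : ∀ {k l k′ l′} (a : K) (p : Car k l) (r : Car k′ l′) → p * (a ·ᴹ r) ≋ a ·ᴹ (p * r)
      ∘-cong : ∀ {k l n} {p q : Car l n} {p′ q′ : Car k l} → p ≋ q → p′ ≋ q′ → p ∘ p′ ≋ q ∘ q′
      ∘-+ˡ   : ∀ {k l n} (p q : Car l n) (r : Car k l) → (p +ᴹ q) ∘ r ≋ p ∘ r +ᴹ q ∘ r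
      ∘-+ʳ   : ∀ {k l n} (p : Car l n) (q r : Car k l) → p ∘ (q +ᴹ r) ≋ p ∘ q +ᴹ p ∘ r
      ∘-·ˡ   : ∀ {k l n} (a : K) (p : Car l n) (r : Car k l) → (a ·ᴹ p) ∘ r ≋ a ·ᴹ (p ∘ r)
      ∘-·ʳ   : ∀ {k l n} (a : K) (p : Car l n) (r : Car k l) → p ∘ (a ·ᴹ r) ≋ a ·ᴹ (p ∘ r)
      *-assoc : ∀ {k l k′ l′ k″ l″} (p : Car k l) (p′ : Car k′ l′) (p″ : Car k″ l″) →
                subst₂ Car (+-assoc k k′ k″) (+-assoc l l′ l″) ((p * p′) * p″) ≋ p * (p′ * p″)
      *-identityˡ : ∀ {k l} (p : Car k l) → I₀ * p ≋ p
      *-identityʳ : ∀ {k l} (p : Car k l) → subst₂ Car (+-identityʳ k) (+-identityʳ l) (p * I₀) ≋ p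
      ∘-assoc : ∀ {k l n o} (p : Car n o) (q : Car l n) (r : Car k l) → (p ∘ q) ∘ r ≋ p ∘ (q ∘ r)
      ∘-identityʳ : ∀ {k l} (p : Car k l) → p ∘ Iₙ k ≋ p
      ∘-identityˡ : ∀ {k l} (p : Car k l) → Iₙ l ∘ p ≋ p
      interchange : ∀ {k l n k′ l′ n′} (p : Car l n) (p′ : Car l′ n′) (q : Car k l) (q′ : Car k′ l′) →
                    (p * p′) ∘ (q * q′) ≋ (p ∘ q) * (p′ ∘ q′)
      ▷-∘ᴾ : ∀ {k l n} (σ : Permutation′ n) (p : Car l n) (q : Car k l) → σ ▷ (p ∘ q) ≋ (σ ▷ p) ∘ q
      ◁-∘ᴾ : ∀ {k l n} (ν : Permutation′ k) (p : Car l n) (q : Car k l) → (p ∘ q) ◁ ν ≋ p ∘ (q ◁ ν)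
      ◁▷-∘ᴾ : ∀ {k l n} (τ : Permutation′ l) (p : Car l n) (q : Car k l) → (p ◁ τ) ∘ q ≋ p ∘ (τ ▷ q)
      ▷-*ᴾ : ∀ {k l k′ l′} (σ : Permutation′ l) (σ′ : Permutation′ l′) (p : Car k l) (p′ : Car k′ l′) →
             (σ ▷ p) * (σ′ ▷ p′) ≋ (σ ⊗ₚ σ′) ▷ (p * p′)
      ◁-*ᴾ : ∀ {k l k′ l′} (τ : Permutation′ k) (τ′ : Permutation′ k′) (p : Car k l) (p′ : Car k′ l′) →
             (p ◁ τ) * (p′ ◁ τ′) ≋ (p * p′) ◁ (τ ⊗ₚ τ′)
      c-*ᴾ : ∀ {k l k′ l′} (p : Car k l) (p′ : Car k′ l′) →
             cₚ l l′ ▷ (p * p′) ≋ subst₂ Car (+-comm k′ k) (+-comm l′ l) (p′ * p) ◁ cₚ k k′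

  -- Morphisms out of the span of a family 𝒫 of planar graphs.
  -- φ is given on formal combinations of 𝒫-graphs; it must only depend on
  -- their image in PGr, be linear, and commute with the structure maps
  -- (whenever the result of an operation is again represented in the span).

  record IsSSMorphism {m ℓm : Level} (𝒫 : PGPred) (N : SSModule m ℓm)
                      (φ : {k l : ℕ} → Span 𝒫 k l → SSModule.Car N k l) : Set (c ⊔ ℓ ⊔ ℓm) where
    open SSModule N
    field
      wd    : ∀ {k l} (u v : Span 𝒫 k l) → incl 𝒫 u ≈PGr incl 𝒫 v → φ u ≋ φ v
      +-hom : ∀ {k l} (u v : Span 𝒫 k l) → φ (u ⊞ v) ≋ φ u +ᴹ φ v
      ·-hom : ∀ {k l} (a : K) (u : Span 𝒫 k l) → φ (a ⊡ u) ≋ a ·ᴹ φ u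
      ▷-hom : ∀ {k l} (σ : Permutation′ l) (u v : Span 𝒫 k l) → incl 𝒫 v ≈PGr σ ▷T incl 𝒫 u → φ v ≋ σ ▷ φ u
      ◁-hom : ∀ {k l} (τ : Permutation′ k) (u v : Span 𝒫 k l) → incl 𝒫 v ≈PGr incl 𝒫 u ◁T τ → φ v ≋ φ u ◁ τ

  record IsProPMorphism {m ℓm : Level} (𝒫 : PGPred) (P : ProP m ℓm)
                        (Φ : {k l : ℕ} → Span 𝒫 k l → ProP.Car P k l) : Set (c ⊔ ℓ ⊔ ℓm) where
    open ProP P
    field
      isSSMorphism : IsSSMorphism 𝒫 ssModule Φ
      *-hom  : ∀ {k l k′ l′} (u : Span 𝒫 k l) (v : Span 𝒫 k′ l′) (w : Span 𝒫 (k ℕ.+ k′) (l ℕ.+ l′)) →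
               incl 𝒫 w ≈PGr incl 𝒫 u *T incl 𝒫 v → Φ w ≋ Φ u * Φ v
      ∘-hom  : ∀ {k l n} (u : Span 𝒫 l n) (v : Span 𝒫 k l) (w : Span 𝒫 k n) →
               incl 𝒫 w ≈PGr incl 𝒫 u ∘T incl 𝒫 v → Φ w ≋ Φ u ∘ Φ v
      I₀-hom : (w : Span 𝒫 0 0) → incl 𝒫 w ≈PGr I₀T → Φ w ≋ I₀
      I₁-hom : (w : Span 𝒫 1 1) → incl 𝒫 w ≈PGr I₁T → Φ w ≋ I₁

  Restricts : {m ℓm : Level} {𝒫 𝒬 : PGPred} (N : SSModule m ℓm)
              (Φ : {k l : ℕ} → Span 𝒫 k l → SSModule.Car N k l)
              (φ : {k l : ℕ} → Span 𝒬 k l → SSModule.Car N k l) → Set (c ⊔ ℓ ⊔ ℓm)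
  Restricts {𝒫 = 𝒫} {𝒬} N Φ φ = ∀ {k l} (t : Span 𝒫 k l) (u : Span 𝒬 k l) → incl 𝒫 t ≈PGr incl 𝒬 u → SSModule._≋_ N (Φ t) (φ u)

  FreeProPOn : (𝒫 𝒬 : PGPred) (m ℓm : Level) → Set (c ⊔ ℓ ⊔ lsuc (m ⊔ ℓm))
  FreeProPOn 𝒫 𝒬 m ℓm =
    (P : ProP m ℓm) (φ : {k l : ℕ} → Span 𝒬 k l → ProP.Car P k l) →
    IsSSMorphism 𝒬 (ProP.ssModule P) φ →
    Σ ({k l : ℕ} → Span 𝒫 k l → ProP.Car P k l) (λ Φ →
        IsProPMorphism 𝒫 P Φ
      × Restricts (ProP.ssModule P) Φ φ
      × (∀ (Ψ : {k l : ℕ} → Span 𝒫 k l → ProP.Car P k l) →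
           IsProPMorphism 𝒫 P Ψ → Restricts (ProP.ssModule P) Ψ φ →
           ∀ {k l} (t : Span 𝒫 k l) → ProP._≋_ P (Ψ t) (Φ t)))

  FreeSSModuleOn : (𝒬 : PGPred) (g : (k l : ℕ) → PGr k l) (m ℓm : Level) → Set (c ⊔ ℓ ⊔ lsuc (m ⊔ ℓm))
  FreeSSModuleOn 𝒬 g m ℓm =
    (N : SSModule m ℓm) (n : (k l : ℕ) → SSModule.Car N k l) →
    Σ ({k l : ℕ} → Span 𝒬 k l → SSModule.Car N k l) (λ ψ →
        IsSSMorphism 𝒬 N ψ
      × (∀ {k l} (u : Span 𝒬 k l) → incl 𝒬 u ≈PGr g k l → SSModule._≋_ N (ψ u) (n k l))
      × (∀ (χ : {k l : ℕ} → Span 𝒬 k l → SSModule.Car N k l) → IsSSMorphism 𝒬 N χ →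
           (∀ {k l} (u : Span 𝒬 k l) → incl 𝒬 u ≈PGr g k l → SSModule._≋_ N (χ u) (n k l)) →
           ∀ {k l} (u : Span 𝒬 k l) → SSModule._≋_ N (χ u) (ψ u)))

{-# OPTIONS --safe #-}
-- A planar graph is encoded by its vertices with ordered half-edges and by one bijection, from the sources of the
-- wires to their targets; vertical composition is then composition of bijections, and graphs over finite sets of
-- inputs and outputs form a symmetric monoidal structure, as does any ProP.  The vertices of an indecomposable
-- graph have no proper nonempty subset closed under predecessors.  Splitting along such subsets writes every graph
-- as a sequence of layers, each containing one indecomposable block, and Φ is the product of the values of the
-- layers.  It does not depend on the sequence: if a block X can come first in G, it can be moved to the front of
-- any sequence for G, because X either is the first block of the sequence or misses it; in the latter case the two
-- blocks are not linked by any wire, so that their layers can be exchanged, and the vertices of the first factor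
-- of a composite determine both factors.  For acyclic graphs, an indecomposable graph is a corolla, since in a
-- larger block every vertex has a predecessor and walking backwards closes a cycle.
module Submission where

open import Defs using (FinTy; El; isInj₁; ∧-fst; ∧-snd; ProP; _⊗ₚ_; cₚ; PGraph; PIso; GIso; inTgt; outSrc; idxIn; idxOut; encIn; encOut; size; idx; getInj₁; _▷P_; _◁P_; _*P_; _⊚P_; I₀P; I₁P; Graph; Indecomposable; SingleLoop; Empty; _▷G_; _◁G_; _*G_; _⊚G_; PGPred; PG; CorollaPG; AcyclicPG; IndPG; Walk; one; cons; HasCycle; NoIO; Field; AllPG; SSModule; Term; gen; zeroT; _⊞_; _⊡_; TEq; t-refl; t-sym; t-trans; t-gen; t-⊞-cong; t-⊡-cong; t-assoc; t-comm; t-idˡ; t-distˡ; t-distʳ; t-⊡-assoc; t-⊡-one; t-⊡-zero; mapT; PGr; Span; incl; IsSSMorphism; IsProPMorphism; Restricts; FreeProPOn; FreeSSModuleOn)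
open import Level using (Level; _⊔_; 0ℓ) renaming (suc to lsuc)
open import Data.Nat using (ℕ; zero; suc; _+_; _*_; _<_; _≤_; s≤s; z≤n; _∸_)
open import Data.Nat.Properties using (<-cmp; <-irrefl; <-asym; <-trans; ≡-irrelevant; +-comm; +-assoc; +-identityʳ; <-≤-trans; ≤-<-trans; ≤-refl; ≤-reflexive; m≤m+n; +-monoʳ-<; +-monoˡ-≤; +-mono-≤; *-monoˡ-≤; +-cancelˡ-≡; +-cancelˡ-<; ≤-trans; _<?_; ≤-antisym; m+[n∸m]≡n)
open import Data.Fin using (Fin; toℕ; splitAt; join; _↑ˡ_; _↑ʳ_; fromℕ<; punchOut) renaming (zero to fzero; suc to fsuc)
open import Data.Fin.Properties using (+↔⊎; toℕ-injective; toℕ-↑ˡ; toℕ-↑ʳ; toℕ<n; splitAt-↑ˡ; splitAt-↑ʳ; toℕ-cast; toℕ-fromℕ<; punchOut-injective; injective⇒≤; pigeonhole) renaming (_≟_ to _≟ᶠⁱⁿ_; all? to allᶠⁱⁿ?; any? to anyᶠⁱⁿ?)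
open import Data.Sum using (_⊎_; inj₁; inj₂; [_,_]′) renaming (map to ⊎map; map₁ to ⊎map₁; map₂ to ⊎map₂)
open import Data.Sum.Properties using (inj₁-injective; inj₂-injective; ≡-dec)
open import Data.Sum.Function.Propositional using (_⊎-↔_)
open import Data.Product using (Σ; _×_; _,_; proj₁; proj₂)
open import Data.Bool using (Bool; true; false; T; not; _∧_)
open import Data.Bool.Properties using (T-irrelevant; T?) renaming (_≟_ to _≟ᵇ_)
open import Data.Empty using (⊥; ⊥-elim)
open import Data.Unit using (tt)
open import Relation.Nullary using (¬_; Dec; yes; no)
open import Relation.Binary using (tri<; tri≈; tri>)
open import Relation.Binary.PropositionalEquality using (_≡_; refl; sym; trans; cong; subst; subst₂)
open import Function using (_↔_; Inverse; id; mk↔ₛ′; mk⇔; Equivalence)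
open import Function.Properties.Inverse using (↔-sym; ↔-trans; ↔-refl)
open import Data.Fin.Permutation using (↔⇒≡; Permutation′; _∘ₚ_; inverseˡ; inverseʳ) renaming (id to idₚ; _≈_ to _≈ₚ_)
open import Data.Fin.Subset using (Subset)
open import Data.Fin.Subset.Properties using (anySubset?)
open import Data.Vec using (lookup; tabulate)
open import Data.Vec.Properties using (lookup∘tabulate)
open import Relation.Nullary.Decidable using (map′; _×-dec_; _→-dec_)
open import Algebra.Bundles using (CommutativeRing)
open import Algebra.Module.Bundles using (Module)

open Inverse public using (to; from)

-- The condition on predecessor-closed sets says that a block is strongly connected (a vertex
-- without edges and a single loop included). A sequence of layers is thus a linear extension of the
-- order on strong components, and its independence is the bubble-sort argument: two linear
-- extensions differ by exchanges of adjacent incomparable elements. The obstacle is that arities in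
-- a ProP are numbers, whose sums are associative and commutative only up to transport. Indexing by
-- enumerated sets on which every bijection acts turns each transport into a naturality square.
-- Sequences are formed in the product of the category of graphs and that of the ProP, so that a
-- graph and its value are built by the same steps. Since composites and tensor products of
-- sequences are sequences, multiplicativity of `Φ` is a consequence of uniqueness. A loop is
-- encoded as a vertex without ports and so becomes a block like any other. Uniqueness of the
-- extension is an induction on the sequence that defines `Φ`.

to-from : {A B : Set} (f : A ↔ B) (y : B) → to f (from f y) ≡ y
to-from = Inverse.strictlyInverseˡ

from-to : {A B : Set} (f : A ↔ B) (x : A) → from f (to f x) ≡ x
from-to = Inverse.strictlyInverseʳ

infixr 9 _⨟_
_⨟_ : {A B C : Set} → A ↔ B → B ↔ C → A ↔ C
_⨟_ = ↔-trans

to-injective : {A B : Set} (f : A ↔ B) {x y : A} → to f x ≡ to f y → x ≡ y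
to-injective f {x} {y} p = trans (sym (from-to f x)) (trans (cong (from f) p) (from-to f y))

to⇒from : {A B : Set} (f : A ↔ B) {x : A} {y : B} → to f x ≡ y → x ≡ from f y
to⇒from f {x} refl = sym (from-to f x)

from⇒to : {A B : Set} (f : A ↔ B) {x : A} {y : B} → from f y ≡ x → to f x ≡ y
from⇒to f {y = y} refl = to-from f y

inj₁≢inj₂ : ∀ {a b} {A : Set a} {B : Set b} {x : A} {y : B} → ¬ (inj₁ x ≡ inj₂ y)
inj₁≢inj₂ ()

-- Used wherever two sets embed in a common set with the same image. Both inverse laws are checked
-- in that set, where the case distinctions made by `g` and `h` are invisible.
match : {X Y Z : Set} (e₁ : Y → X) (e₂ : Z → X) →
        (∀ {a b} → e₁ a ≡ e₁ b → a ≡ b) → (∀ {a b} → e₂ a ≡ e₂ b → a ≡ b) →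
        (g : ∀ y → Σ Z λ z → e₂ z ≡ e₁ y) (h : ∀ z → Σ Y λ y → e₁ y ≡ e₂ z) → Y ↔ Z
match e₁ e₂ i₁ i₂ g h = mk↔ₛ′ (λ y → proj₁ (g y)) (λ z → proj₁ (h z))
  (λ z → i₂ (trans (proj₂ (g (proj₁ (h z)))) (proj₂ (h z))))
  (λ y → i₁ (trans (proj₂ (h (proj₁ (g y)))) (proj₂ (g y))))

module _ {A C A′ C′ : Set} (F : (A ⊎ C) ↔ (A′ ⊎ C′))
         (l : ∀ a → Σ A′ λ a′ → to F (inj₁ a) ≡ inj₁ a′)
         (r : ∀ c → Σ C′ λ c′ → to F (inj₂ c) ≡ inj₂ c′) where

  -- The hypothesis on `C` gives surjectivity: a preimage of `inj₁ a′` in `C` would have its image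
  -- in `C′`.
  restrictˡ : A ↔ A′
  restrictˡ = match (λ a → to F (inj₁ a)) inj₁ (λ p → inj₁-injective (to-injective F p)) inj₁-injective
                    (λ a → proj₁ (l a) , sym (proj₂ (l a))) back
    where
    back : ∀ a′ → Σ A λ a → to F (inj₁ a) ≡ inj₁ a′
    back a′ with from F (inj₁ a′) in eq
    ... | inj₁ a = a , from⇒to F eq
    ... | inj₂ c = ⊥-elim (inj₁≢inj₂ (trans (sym (from⇒to F eq)) (proj₂ (r c))))

  restrictʳ : C ↔ C′
  restrictʳ = match (λ c → to F (inj₂ c)) inj₂ (λ p → inj₂-injective (to-injective F p)) inj₂-injective
                    (λ c → proj₁ (r c) , sym (proj₂ (r c))) back
    where
    back : ∀ c′ → Σ C λ c → to F (inj₂ c) ≡ inj₂ c′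
    back c′ with from F (inj₂ c′) in eq
    ... | inj₁ a = ⊥-elim (inj₁≢inj₂ (trans (sym (proj₂ (l a))) (from⇒to F eq)))
    ... | inj₂ c = c , from⇒to F eq

  restrictˡ-spec : ∀ a → to F (inj₁ a) ≡ inj₁ (to restrictˡ a)
  restrictˡ-spec a = proj₂ (l a)

-- Enumerated finite sets

infixr 5 _⊎ᶠ_
-- The sum is a constructor, so that unification recovers the summands of an interface and `card` of
-- a sum reduces to a sum of numbers, as the horizontal product of a ProP requires.
data FSet : Set₁ where
  finite : (A : Set) (n : ℕ) → A ↔ Fin n → FSet
  _⊎ᶠ_   : FSet → FSet → FSet

⟦_⟧ : FSet → Set
⟦ finite A n e ⟧ = A
⟦ A ⊎ᶠ B ⟧ = ⟦ A ⟧ ⊎ ⟦ B ⟧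

card : FSet → ℕ
card (finite A n e) = n
card (A ⊎ᶠ B) = card A + card B

enum : (A : FSet) → ⟦ A ⟧ ↔ Fin (card A)
enum (finite A n e) = e
enum (A ⊎ᶠ B) = (enum A ⊎-↔ enum B) ⨟ ↔-sym +↔⊎

Finᶠ : ℕ → FSet
Finᶠ n = finite (Fin n) n ↔-refl

∅ : FSet
∅ = Finᶠ 0

Sub : {A : Set} → (A → Bool) → Set
Sub p = Σ _ (λ a → T (p a))

Sub-≡ : {A : Set} (p : A → Bool) {x y : Sub p} → proj₁ x ≡ proj₁ y → x ≡ y
Sub-≡ p {a , s} {.a , t} refl = cong (a ,_) (T-irrelevant s t)

boolℕ : Bool → ℕ
boolℕ true = 1
boolℕ false = 0

private
  T↔Fin : ∀ b → T b ↔ Fin (boolℕ b)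
  T↔Fin true  = mk↔ₛ′ (λ _ → fzero) (λ _ → tt) (λ { fzero → refl ; (fsuc ()) }) (λ _ → refl)
  T↔Fin false = mk↔ₛ′ (λ ()) (λ ()) (λ ()) (λ ())

  Sub-suc : ∀ {n} (p : Fin (suc n) → Bool) → Sub p ↔ (T (p fzero) ⊎ Sub (λ i → p (fsuc i)))
  Sub-suc p = mk↔ₛ′ (λ { (fzero , t) → inj₁ t ; (fsuc i , t) → inj₂ (i , t) })
                    (λ { (inj₁ t) → fzero , t ; (inj₂ (i , t)) → fsuc i , t })
                    (λ { (inj₁ t) → refl ; (inj₂ (i , t)) → refl })
                    (λ { (fzero , t) → refl ; (fsuc i , t) → refl })

  subCard : ∀ n → (Fin n → Bool) → ℕ
  subCard zero p = 0
  subCard (suc n) p = boolℕ (p fzero) + subCard n (λ i → p (fsuc i))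

  subEnum : ∀ n (p : Fin n → Bool) → Sub p ↔ Fin (subCard n p)
  subEnum zero p = mk↔ₛ′ (λ { (() , _) }) (λ ()) (λ ()) (λ { (() , _) })
  subEnum (suc n) p = Sub-suc p ⨟ (T↔Fin _ ⊎-↔ subEnum n _) ⨟ ↔-sym +↔⊎

Sub-cong : {A B : Set} (f : A ↔ B) (p : B → Bool) → Sub (λ a → p (to f a)) ↔ Sub p
Sub-cong f p = mk↔ₛ′ (λ { (a , t) → to f a , t })
  (λ { (b , t) → from f b , subst (λ x → T (p x)) (sym (to-from f b)) t })
  (λ { (b , t) → Sub-≡ p (to-from f b) }) (λ { (a , t) → Sub-≡ _ (from-to f a) })

Subᶠ : (A : FSet) → (⟦ A ⟧ → Bool) → FSet
Subᶠ A p = finite (Sub p) (subCard (card A) (λ i → p (from (enum A) i)))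
                  (↔-sym (Sub-cong (↔-sym (enum A)) p) ⨟ subEnum (card A) _)

T-true : ∀ {b} → T b → b ≡ true
T-true {true} _ = refl

T-false : ∀ {b} → T (not b) → b ≡ false
T-false {false} _ = refl

true-T : ∀ {b} → b ≡ true → T b
true-T refl = tt

false-T : ∀ {b} → b ≡ false → T (not b)
false-T refl = tt

true≢false : ¬ (true ≡ false)
true≢false ()

dec-Bool : (b : Bool) → (b ≡ true) ⊎ (b ≡ false)
dec-Bool true  = inj₁ refl
dec-Bool false = inj₂ refl

private
  El-enum : ∀ A → Σ ℕ λ n → El A ↔ Fin n
  El-enum (FinTy.fin n)   = n , ↔-refl
  El-enum (A FinTy.⊕ B)   = _ , (proj₂ (El-enum A) ⊎-↔ proj₂ (El-enum B)) ⨟ ↔-sym +↔⊎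
  El-enum (FinTy.sub n p) = _ , subEnum n p

Elᶠ : FinTy → FSet
Elᶠ A = finite (El A) (proj₁ (El-enum A)) (proj₂ (El-enum A))

-- Structural bijections of sums

⊎-α : {A B C : Set} → ((A ⊎ B) ⊎ C) ↔ (A ⊎ (B ⊎ C))
⊎-α = mk↔ₛ′ (λ { (inj₁ (inj₁ a)) → inj₁ a ; (inj₁ (inj₂ b)) → inj₂ (inj₁ b) ; (inj₂ c) → inj₂ (inj₂ c) })
            (λ { (inj₁ a) → inj₁ (inj₁ a) ; (inj₂ (inj₁ b)) → inj₁ (inj₂ b) ; (inj₂ (inj₂ c)) → inj₂ c })
            (λ { (inj₁ a) → refl ; (inj₂ (inj₁ b)) → refl ; (inj₂ (inj₂ c)) → refl })
            (λ { (inj₁ (inj₁ a)) → refl ; (inj₁ (inj₂ b)) → refl ; (inj₂ c) → refl })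

⊎-γ : {A B : Set} → (A ⊎ B) ↔ (B ⊎ A)
⊎-γ = mk↔ₛ′ (λ { (inj₁ a) → inj₂ a ; (inj₂ b) → inj₁ b }) (λ { (inj₁ a) → inj₂ a ; (inj₂ b) → inj₁ b })
            (λ { (inj₁ a) → refl ; (inj₂ b) → refl }) (λ { (inj₁ a) → refl ; (inj₂ b) → refl })

⊎-ρ : {A : Set} → (A ⊎ Fin 0) ↔ A
⊎-ρ = mk↔ₛ′ (λ { (inj₁ a) → a ; (inj₂ ()) }) inj₁ (λ _ → refl) (λ { (inj₁ a) → refl ; (inj₂ ()) })

⊎-λ : {A : Set} → (Fin 0 ⊎ A) ↔ A
⊎-λ = mk↔ₛ′ (λ { (inj₁ ()) ; (inj₂ a) → a }) inj₂ (λ _ → refl) (λ { (inj₁ ()) ; (inj₂ a) → refl })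

⊎-mid4 : {A B C D : Set} → ((A ⊎ B) ⊎ (C ⊎ D)) ↔ ((A ⊎ C) ⊎ (B ⊎ D))
⊎-mid4 = mk↔ₛ′ f f s s
  where
  f : {A B C D : Set} → (A ⊎ B) ⊎ (C ⊎ D) → (A ⊎ C) ⊎ (B ⊎ D)
  f (inj₁ (inj₁ a)) = inj₁ (inj₁ a)
  f (inj₁ (inj₂ b)) = inj₂ (inj₁ b)
  f (inj₂ (inj₁ c)) = inj₁ (inj₂ c)
  f (inj₂ (inj₂ d)) = inj₂ (inj₂ d)
  s : {A B C D : Set} (x : (A ⊎ B) ⊎ (C ⊎ D)) → f (f x) ≡ x
  s (inj₁ (inj₁ a)) = refl
  s (inj₁ (inj₂ b)) = refl
  s (inj₂ (inj₁ c)) = refl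
  s (inj₂ (inj₂ d)) = refl

-- Bijections are kept as syntax, so that unification never has to look inside a composite of bijections.

infixr 9 _⨾_
infixr 12 _⊎ᵇ_
data Bij : FSet → FSet → Set₁ where
  prim : ∀ {A B} → ⟦ A ⟧ ↔ ⟦ B ⟧ → Bij A B
  idᵇ  : ∀ {A} → Bij A A
  symᵇ : ∀ {A B} → Bij A B → Bij B A
  _⨾_  : ∀ {A B C} → Bij A B → Bij B C → Bij A C
  _⊎ᵇ_ : ∀ {A B A′ B′} → Bij A B → Bij A′ B′ → Bij (A ⊎ᶠ A′) (B ⊎ᶠ B′)
  αᵇ   : ∀ {A B C} → Bij ((A ⊎ᶠ B) ⊎ᶠ C) (A ⊎ᶠ (B ⊎ᶠ C))
  γᵇ   : ∀ {A B} → Bij (A ⊎ᶠ B) (B ⊎ᶠ A)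
  ρᵇ   : ∀ {A} → Bij (A ⊎ᶠ ∅) A

⟪_⟫ : ∀ {A B} → Bij A B → ⟦ A ⟧ ↔ ⟦ B ⟧
⟪ prim f ⟫ = f
⟪ idᵇ ⟫ = ↔-refl
⟪ symᵇ f ⟫ = ↔-sym ⟪ f ⟫
⟪ f ⨾ g ⟫ = ⟪ f ⟫ ⨟ ⟪ g ⟫
⟪ f ⊎ᵇ g ⟫ = ⟪ f ⟫ ⊎-↔ ⟪ g ⟫
⟪ αᵇ ⟫ = ⊎-α
⟪ γᵇ ⟫ = ⊎-γ
⟪ ρᵇ ⟫ = ⊎-ρ

shᵇ : ∀ {A B C} → Bij (A ⊎ᶠ (B ⊎ᶠ C)) (B ⊎ᶠ (A ⊎ᶠ C))
shᵇ = symᵇ αᵇ ⨾ (γᵇ ⊎ᵇ idᵇ) ⨾ αᵇ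

app : ∀ {A B} → Bij A B → ⟦ A ⟧ → ⟦ B ⟧
app f = to ⟪ f ⟫

infix 4 _≐_
_≐_ : ∀ {A B} → Bij A B → Bij A B → Set
f ≐ g = ∀ x → app f x ≡ app g x

-- In place of structure isomorphisms, every bijection of enumerated sets acts through J; the associator, the
-- symmetry and the unit are the images of the corresponding bijections of sums.

record SMC (o e : Level) : Set (lsuc (0ℓ ⊔ o ⊔ e)) where
  infix 4 _≋_
  infixr 10 _∘_
  infixr 15 _⊗_
  field
    Hom : FSet → FSet → Set o
    _≋_ : ∀ {A B} → Hom A B → Hom A B → Set e
    ≋-refl  : ∀ {A B} {p : Hom A B} → p ≋ p
    ≋-sym   : ∀ {A B} {p q : Hom A B} → p ≋ q → q ≋ p
    ≋-trans : ∀ {A B} {p q r : Hom A B} → p ≋ q → q ≋ r → p ≋ r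
    _∘_ : ∀ {A B C} → Hom B C → Hom A B → Hom A C
    _⊗_ : ∀ {A B A′ B′} → Hom A B → Hom A′ B′ → Hom (A ⊎ᶠ A′) (B ⊎ᶠ B′)
    J   : ∀ {A B} → Bij A B → Hom A B
    ∘-cong : ∀ {A B C} {p p′ : Hom B C} {q q′ : Hom A B} → p ≋ p′ → q ≋ q′ → p ∘ q ≋ p′ ∘ q′
    ⊗-cong : ∀ {A B A′ B′} {p p′ : Hom A B} {q q′ : Hom A′ B′} → p ≋ p′ → q ≋ q′ → p ⊗ q ≋ p′ ⊗ q′
    J-cong : ∀ {A B} {f g : Bij A B} → f ≐ g → J f ≋ J g
    ∘-assoc : ∀ {A B C D} (p : Hom C D) (q : Hom B C) (r : Hom A B) → (p ∘ q) ∘ r ≋ p ∘ (q ∘ r)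
    idˡ : ∀ {A B} (p : Hom A B) → J idᵇ ∘ p ≋ p
    idʳ : ∀ {A B} (p : Hom A B) → p ∘ J idᵇ ≋ p
    interchange : ∀ {A B C A′ B′ C′} (p : Hom B C) (p′ : Hom B′ C′) (q : Hom A B) (q′ : Hom A′ B′) →
                  (p ⊗ p′) ∘ (q ⊗ q′) ≋ (p ∘ q) ⊗ (p′ ∘ q′)
    J-∘ : ∀ {A B C} (g : Bij B C) (f : Bij A B) → J g ∘ J f ≋ J (f ⨾ g)
    J-⊗ : ∀ {A B A′ B′} (f : Bij A B) (g : Bij A′ B′) → J f ⊗ J g ≋ J (f ⊎ᵇ g)
    α-nat : ∀ {A B C A′ B′ C′} (p : Hom A A′) (q : Hom B B′) (r : Hom C C′) →
            J αᵇ ∘ ((p ⊗ q) ⊗ r) ≋ (p ⊗ (q ⊗ r)) ∘ J αᵇ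
    γ-nat : ∀ {A B A′ B′} (p : Hom A A′) (q : Hom B B′) → J γᵇ ∘ (p ⊗ q) ≋ (q ⊗ p) ∘ J γᵇ
    ρ-nat : ∀ {A A′} (p : Hom A A′) → J ρᵇ ∘ (p ⊗ J {∅} idᵇ) ≋ p ∘ J ρᵇ

-- Calculus of layers in a symmetric monoidal category

module SMC-Properties {o e} (𝒞 : SMC o e) where
  open SMC 𝒞

  idᴴ : ∀ A → Hom A A
  idᴴ A = J idᵇ

  ∘ˡ : ∀ {A B C} {p p′ : Hom B C} {q : Hom A B} → p ≋ p′ → p ∘ q ≋ p′ ∘ q
  ∘ˡ s = ∘-cong s ≋-refl
  ∘ʳ : ∀ {A B C} {p : Hom B C} {q q′ : Hom A B} → q ≋ q′ → p ∘ q ≋ p ∘ q′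
  ∘ʳ s = ∘-cong ≋-refl s
  ⊗ˡ : ∀ {A B A′ B′} {p p′ : Hom A B} {q : Hom A′ B′} → p ≋ p′ → p ⊗ q ≋ p′ ⊗ q
  ⊗ˡ s = ⊗-cong s ≋-refl
  ⊗ʳ : ∀ {A B A′ B′} {p : Hom A B} {q q′ : Hom A′ B′} → q ≋ q′ → p ⊗ q ≋ p ⊗ q′
  ⊗ʳ s = ⊗-cong ≋-refl s
  assoc⁻ : ∀ {A B C D} (p : Hom C D) (q : Hom B C) (r : Hom A B) → p ∘ (q ∘ r) ≋ (p ∘ q) ∘ r
  assoc⁻ p q r = ≋-sym (∘-assoc p q r)

  infix  1 begin_
  infixr 2 _≋⟨_⟩_
  infix  3 _∎
  begin_ : ∀ {A B} {p q : Hom A B} → p ≋ q → p ≋ q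
  begin p = p
  _≋⟨_⟩_ : ∀ {A B} (p : Hom A B) {q r : Hom A B} → p ≋ q → q ≋ r → p ≋ r
  p ≋⟨ s ⟩ t = ≋-trans s t
  _∎ : ∀ {A B} (p : Hom A B) → p ≋ p
  p ∎ = ≋-refl

  J-id : ∀ {A} (f : Bij A A) → (∀ x → app f x ≡ x) → ∀ {B} (p : Hom A B) → p ∘ J f ≋ p
  J-id f s p = ≋-trans (∘ʳ (J-cong s)) (idʳ p)

  J-idˡ : ∀ {A} (f : Bij A A) → (∀ x → app f x ≡ x) → ∀ {B} (p : Hom B A) → J f ∘ p ≋ p
  J-idˡ f s p = ≋-trans (∘ˡ (J-cong s)) (idˡ p)

  J-mergeʳ : ∀ {A B C D} (p : Hom C D) (g : Bij B C) (f : Bij A B) → (p ∘ J g) ∘ J f ≋ p ∘ J (f ⨾ g)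
  J-mergeʳ p g f = ≋-trans (∘-assoc _ _ _) (∘ʳ (J-∘ g f))

  J-mergeˡ : ∀ {A B C D} (g : Bij C D) (f : Bij B C) (p : Hom A B) → J g ∘ (J f ∘ p) ≋ J (f ⨾ g) ∘ p
  J-mergeˡ g f p = ≋-trans (assoc⁻ _ _ _) (∘ˡ (J-∘ g f))

  J-cancelˡ : ∀ {A B C} (f : Bij B C) (p : Hom A B) → J (symᵇ f) ∘ (J f ∘ p) ≋ p
  J-cancelˡ f p = ≋-trans (J-mergeˡ (symᵇ f) f p) (J-idˡ (f ⨾ symᵇ f) (from-to ⟪ f ⟫) p)

  J-cancelˡ′ : ∀ {A B C} (f : Bij C B) (p : Hom A B) → J f ∘ (J (symᵇ f) ∘ p) ≋ p
  J-cancelˡ′ f p = ≋-trans (J-mergeˡ f (symᵇ f) p) (J-idˡ (symᵇ f ⨾ f) (to-from ⟪ f ⟫) p)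

  J-cancelʳ : ∀ {A B C} (f : Bij B C) (p : Hom C A) → (p ∘ J f) ∘ J (symᵇ f) ≋ p
  J-cancelʳ f p = ≋-trans (J-mergeʳ p f (symᵇ f)) (J-id (symᵇ f ⨾ f) (to-from ⟪ f ⟫) p)

  -- Naturality squares over bijections can be inverted, pasted and tensored. These three rules
  -- yield naturality of a composite wiring such as `shᵇ` from that of `αᵇ` and `γᵇ`.
  flip : ∀ {A B A′ B′} {p : Hom A A′} {q : Hom B B′} (f : Bij A B) (g : Bij A′ B′) →
         J g ∘ p ≋ q ∘ J f → J (symᵇ g) ∘ q ≋ p ∘ J (symᵇ f)
  flip {p = p} {q} f g s = begin
    J (symᵇ g) ∘ q                          ≋⟨ ∘ʳ (≋-sym (J-cancelʳ f q)) ⟩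
    J (symᵇ g) ∘ ((q ∘ J f) ∘ J (symᵇ f))  ≋⟨ ∘ʳ (∘ˡ (≋-sym s)) ⟩
    J (symᵇ g) ∘ ((J g ∘ p) ∘ J (symᵇ f))  ≋⟨ assoc⁻ _ _ _ ⟩
    (J (symᵇ g) ∘ (J g ∘ p)) ∘ J (symᵇ f)  ≋⟨ ∘ˡ (J-cancelˡ g p) ⟩
    p ∘ J (symᵇ f) ∎

  paste : ∀ {A B C A′ B′ C′} {p : Hom A A′} {q : Hom B B′} {r : Hom C C′}
          (f : Bij A B) (g : Bij B C) (f′ : Bij A′ B′) (g′ : Bij B′ C′) →
          J f′ ∘ p ≋ q ∘ J f → J g′ ∘ q ≋ r ∘ J g → J (f′ ⨾ g′) ∘ p ≋ r ∘ J (f ⨾ g)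
  paste {p = p} {q} {r} f g f′ g′ s t = begin
    J (f′ ⨾ g′) ∘ p      ≋⟨ ≋-sym (J-mergeˡ g′ f′ p) ⟩
    J g′ ∘ (J f′ ∘ p)    ≋⟨ ∘ʳ s ⟩
    J g′ ∘ (q ∘ J f)     ≋⟨ assoc⁻ _ _ _ ⟩
    (J g′ ∘ q) ∘ J f     ≋⟨ ∘ˡ t ⟩
    (r ∘ J g) ∘ J f      ≋⟨ J-mergeʳ r g f ⟩
    r ∘ J (f ⨾ g) ∎

  ⊗-square : ∀ {A B A′ B′ C D C′ D′} {p : Hom A A′} {q : Hom B B′} {r : Hom C C′} {t : Hom D D′}
             (f : Bij A B) (f′ : Bij A′ B′) (g : Bij C D) (g′ : Bij C′ D′) →
             J f′ ∘ p ≋ q ∘ J f → J g′ ∘ r ≋ t ∘ J g → J (f′ ⊎ᵇ g′) ∘ (p ⊗ r) ≋ (q ⊗ t) ∘ J (f ⊎ᵇ g)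
  ⊗-square {p = p} {q} {r} {t} f f′ g g′ s u = begin
    J (f′ ⊎ᵇ g′) ∘ (p ⊗ r)  ≋⟨ ∘ˡ (≋-sym (J-⊗ f′ g′)) ⟩
    (J f′ ⊗ J g′) ∘ (p ⊗ r)  ≋⟨ interchange _ _ _ _ ⟩
    (J f′ ∘ p) ⊗ (J g′ ∘ r)  ≋⟨ ⊗-cong s u ⟩
    (q ∘ J f) ⊗ (t ∘ J g)    ≋⟨ ≋-sym (interchange _ _ _ _) ⟩
    (q ⊗ t) ∘ (J f ⊗ J g)    ≋⟨ ∘ʳ (J-⊗ f g) ⟩
    (q ⊗ t) ∘ J (f ⊎ᵇ g) ∎

  sh-nat : ∀ {A B C A′ B′ C′} (p : Hom A A′) (q : Hom B B′) (r : Hom C C′) →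
           J shᵇ ∘ (p ⊗ (q ⊗ r)) ≋ (q ⊗ (p ⊗ r)) ∘ J shᵇ
  sh-nat p q r = paste _ _ _ _ (flip _ _ (α-nat p q r))
    (paste _ _ _ _ (⊗-square _ _ _ _ (γ-nat p q) (≋-trans (idˡ r) (≋-sym (idʳ r)))) (α-nat q p r))

  -- `f` decides which wires enter the block and which bypass it along `R`. It stands before the
  -- block only; a wiring after the block is absorbed by what follows.
  layer : ∀ {A S T} (x : Hom S T) (R : FSet) (f : Bij A (S ⊎ᶠ R)) → Hom A (T ⊎ᶠ R)
  layer x R f = (x ⊗ idᴴ R) ∘ J f

  layer-J : ∀ {A B S T} (x : Hom S T) (R : FSet) (f : Bij A (S ⊎ᶠ R)) (g : Bij B A) →
            layer x R f ∘ J g ≋ layer x R (g ⨾ f)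
  layer-J x R f g = J-mergeʳ _ f g

  idᴴ-⊗ : ∀ A B → idᴴ A ⊗ idᴴ B ≋ idᴴ (A ⊎ᶠ B)
  idᴴ-⊗ A B = ≋-trans (J-⊗ idᵇ idᵇ) (J-cong (λ { (inj₁ _) → refl ; (inj₂ _) → refl }))

  rewire : ∀ {S T R R′} (x : Hom S T) (r : Bij R R′) →
           J (idᵇ ⊎ᵇ r) ∘ (x ⊗ idᴴ R) ≋ (x ⊗ idᴴ R′) ∘ J (idᵇ ⊎ᵇ r)
  rewire x r = ⊗-square _ _ _ _ (≋-trans (idˡ x) (≋-sym (idʳ x))) (≋-trans (idʳ _) (≋-sym (idˡ _)))

  layer-⊗ : ∀ {A S T} (x : Hom S T) (R : FSet) (f : Bij A (S ⊎ᶠ R)) (R′ : FSet) →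
            layer x R f ⊗ idᴴ R′ ≋ J (symᵇ αᵇ) ∘ layer x (R ⊎ᶠ R′) ((f ⊎ᵇ idᵇ) ⨾ αᵇ)
  layer-⊗ x R f R′ = begin
    layer x R f ⊗ idᴴ R′                                       ≋⟨ ⊗ʳ (≋-sym (idˡ _)) ⟩
    ((x ⊗ idᴴ R) ∘ J f) ⊗ (idᴴ R′ ∘ idᴴ R′)                    ≋⟨ ≋-sym (interchange _ _ _ _) ⟩
    ((x ⊗ idᴴ R) ⊗ idᴴ R′) ∘ (J f ⊗ idᴴ R′)                    ≋⟨ ∘-cong (≋-sym (J-cancelˡ αᵇ _)) (J-⊗ f idᵇ) ⟩
    (J (symᵇ αᵇ) ∘ (J αᵇ ∘ ((x ⊗ idᴴ R) ⊗ idᴴ R′))) ∘ J (f ⊎ᵇ idᵇ) ≋⟨ ∘ˡ (∘ʳ (α-nat _ _ _)) ⟩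
    (J (symᵇ αᵇ) ∘ ((x ⊗ (idᴴ R ⊗ idᴴ R′)) ∘ J αᵇ)) ∘ J (f ⊎ᵇ idᵇ) ≋⟨ ∘-assoc _ _ _ ⟩
    J (symᵇ αᵇ) ∘ (((x ⊗ (idᴴ R ⊗ idᴴ R′)) ∘ J αᵇ) ∘ J (f ⊎ᵇ idᵇ)) ≋⟨ ∘ʳ (J-mergeʳ _ _ _) ⟩
    J (symᵇ αᵇ) ∘ ((x ⊗ (idᴴ R ⊗ idᴴ R′)) ∘ J ((f ⊎ᵇ idᵇ) ⨾ αᵇ))    ≋⟨ ∘ʳ (∘ˡ (⊗ʳ (idᴴ-⊗ R R′))) ⟩
    J (symᵇ αᵇ) ∘ layer x (R ⊎ᶠ R′) ((f ⊎ᵇ idᵇ) ⨾ αᵇ) ∎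

  -- k-sh says that no output of the first layer is an input of the second one.
  module Exchange {A S T S′ T′ R R₁ R₄ : FSet} (x : Hom S T) (x′ : Hom S′ T′)
           (f : Bij A (S ⊎ᶠ R)) (k : Bij (T ⊎ᶠ R) (S′ ⊎ᶠ R₁))
           (r : Bij R (S′ ⊎ᶠ R₄)) (r₁ : Bij R₁ (T ⊎ᶠ R₄))
           (k-sh : ((idᵇ ⊎ᵇ r) ⨾ shᵇ) ≐ (k ⨾ (idᵇ ⊎ᵇ r₁))) where

    f₂ : Bij A (S′ ⊎ᶠ (S ⊎ᶠ R₄))
    f₂ = f ⨾ (idᵇ ⊎ᵇ r) ⨾ shᵇ

    g₂ : Bij (T ⊎ᶠ (T′ ⊎ᶠ R₄)) (T′ ⊎ᶠ R₁)
    g₂ = shᵇ ⨾ (idᵇ ⊎ᵇ symᵇ r₁)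

    -- By `k-sh`, `R` consists of the inputs `S′` of the second block and of strands `R₄` that
    -- bypass both blocks, and `R₁` consists of `T` and `R₄`. Both sides therefore run `x` and `x′`
    -- on disjoint strands, and the interchange law slides one past the other.
    exchange : layer x′ R₁ k ∘ layer x R f ≋ (J g₂ ∘ layer x (T′ ⊎ᶠ R₄) shᵇ) ∘ layer x′ (S ⊎ᶠ R₄) f₂
    exchange = begin
      ((x′ ⊗ idᴴ R₁) ∘ J k) ∘ ((x ⊗ idᴴ R) ∘ J f)  ≋⟨ ∘-cong outer inner ⟩
      (J r₁⁻ ∘ (X′T ∘ (J shᵇ ∘ J r↑))) ∘ (J (symᵇ r↑) ∘ (XS′ ∘ J fr))
        ≋⟨ ≋-trans (∘-assoc _ _ _) (∘ʳ (≋-trans (∘ˡ (assoc⁻ _ _ _)) (≋-trans (∘-assoc _ _ _) (∘ʳ (J-cancelˡ′ r↑ _))))) ⟩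
      J r₁⁻ ∘ ((X′T ∘ J shᵇ) ∘ (XS′ ∘ J fr))      ≋⟨ ∘ʳ (∘ˡ (≋-trans (∘ˡ (⊗ʳ (≋-sym (idᴴ-⊗ T R₄)))) (≋-sym (sh-nat _ _ _)))) ⟩
      J r₁⁻ ∘ ((J shᵇ ∘ (idᴴ T ⊗ (x′ ⊗ idᴴ R₄))) ∘ (XS′ ∘ J fr))
        ≋⟨ ∘ʳ (≋-trans (∘-assoc _ _ _) (∘ʳ (assoc⁻ _ _ _))) ⟩
      J r₁⁻ ∘ (J shᵇ ∘ (((idᴴ T ⊗ (x′ ⊗ idᴴ R₄)) ∘ XS′) ∘ J fr))   ≋⟨ J-mergeˡ _ _ _ ⟩
      J g₂ ∘ (((idᴴ T ⊗ (x′ ⊗ idᴴ R₄)) ∘ XS′) ∘ J fr)   ≋⟨ ∘ʳ (∘ˡ slide) ⟩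
      J g₂ ∘ ((XT′ ∘ (idᴴ S ⊗ (x′ ⊗ idᴴ R₄))) ∘ J fr)   ≋⟨ ∘ʳ (∘-assoc _ _ _) ⟩
      J g₂ ∘ (XT′ ∘ ((idᴴ S ⊗ (x′ ⊗ idᴴ R₄)) ∘ J fr))   ≋⟨ ∘ʳ (∘ʳ last) ⟩
      J g₂ ∘ (XT′ ∘ (J shᵇ ∘ layer x′ (S ⊎ᶠ R₄) f₂))   ≋⟨ ∘ʳ (assoc⁻ _ _ _) ⟩
      J g₂ ∘ ((XT′ ∘ J shᵇ) ∘ layer x′ (S ⊎ᶠ R₄) f₂)   ≋⟨ assoc⁻ _ _ _ ⟩
      (J g₂ ∘ layer x (T′ ⊎ᶠ R₄) shᵇ) ∘ layer x′ (S ⊎ᶠ R₄) f₂ ∎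
      where
      fr = f ⨾ (idᵇ ⊎ᵇ r)
      r↑ : Bij (T ⊎ᶠ R) (T ⊎ᶠ (S′ ⊎ᶠ R₄))
      r↑ = idᵇ ⊎ᵇ r
      r₁↑ : ∀ {Q} → Bij (Q ⊎ᶠ R₁) (Q ⊎ᶠ (T ⊎ᶠ R₄))
      r₁↑ = idᵇ ⊎ᵇ r₁
      r₁⁻ : Bij (T′ ⊎ᶠ (T ⊎ᶠ R₄)) (T′ ⊎ᶠ R₁)
      r₁⁻ = idᵇ ⊎ᵇ symᵇ r₁
      XS′ = x ⊗ idᴴ (S′ ⊎ᶠ R₄)
      XT′ = x ⊗ idᴴ (T′ ⊎ᶠ R₄)
      X′T = x′ ⊗ idᴴ (T ⊎ᶠ R₄)
      inner : (x ⊗ idᴴ R) ∘ J f ≋ J (symᵇ r↑) ∘ (XS′ ∘ J fr)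
      inner = begin
        (x ⊗ idᴴ R) ∘ J f                             ≋⟨ ≋-sym (J-cancelˡ r↑ _) ⟩
        J (symᵇ r↑) ∘ (J r↑ ∘ ((x ⊗ idᴴ R) ∘ J f))   ≋⟨ ∘ʳ (≋-trans (assoc⁻ _ _ _) (∘ˡ (rewire x r))) ⟩
        J (symᵇ r↑) ∘ ((XS′ ∘ J _) ∘ J f)            ≋⟨ ∘ʳ (J-mergeʳ _ _ _) ⟩
        J (symᵇ r↑) ∘ (XS′ ∘ J fr) ∎
      outer : (x′ ⊗ idᴴ R₁) ∘ J k ≋ J r₁⁻ ∘ (X′T ∘ (J shᵇ ∘ J r↑))
      outer = begin
        (x′ ⊗ idᴴ R₁) ∘ J k                           ≋⟨ ∘ʳ (≋-sym (≋-trans (J-∘ (symᵇ r₁↑) (k ⨾ r₁↑)) (J-cong (λ y → from-to ⟪ r₁↑ {S′} ⟫ (app k y))))) ⟩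
        (x′ ⊗ idᴴ R₁) ∘ (J (symᵇ r₁↑) ∘ J (k ⨾ r₁↑)) ≋⟨ ≋-trans (assoc⁻ _ _ _) (∘ˡ (∘ʳ (J-cong (λ { (inj₁ _) → refl ; (inj₂ _) → refl })))) ⟩
        ((x′ ⊗ idᴴ R₁) ∘ J (idᵇ ⊎ᵇ symᵇ r₁)) ∘ J (k ⨾ r₁↑) ≋⟨ ∘ˡ (≋-sym (rewire x′ (symᵇ r₁))) ⟩
        (J r₁⁻ ∘ X′T) ∘ J (k ⨾ r₁↑)                   ≋⟨ ∘-assoc _ _ _ ⟩
        J r₁⁻ ∘ (X′T ∘ J (k ⨾ r₁↑))                   ≋⟨ ∘ʳ (∘ʳ (≋-trans (J-cong (λ y → sym (k-sh y))) (≋-sym (J-∘ shᵇ r↑)))) ⟩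
        J r₁⁻ ∘ (X′T ∘ (J shᵇ ∘ J r↑)) ∎
      slide : (idᴴ T ⊗ (x′ ⊗ idᴴ R₄)) ∘ XS′ ≋ XT′ ∘ (idᴴ S ⊗ (x′ ⊗ idᴴ R₄))
      slide = ≋-trans (interchange _ _ _ _) (≋-trans (⊗-cong (≋-trans (idˡ x) (≋-sym (idʳ x))) (≋-trans (idʳ _) (≋-sym (idˡ _))))
                (≋-sym (interchange _ _ _ _)))
      last : (idᴴ S ⊗ (x′ ⊗ idᴴ R₄)) ∘ J fr ≋ J shᵇ ∘ layer x′ (S ⊎ᶠ R₄) f₂
      last = begin
        (idᴴ S ⊗ (x′ ⊗ idᴴ R₄)) ∘ J fr                                ≋⟨ ∘ʳ (≋-sym (≋-trans (J-∘ shᵇ (fr ⨾ shᵇ)) (J-cong (λ y → sh-inv {S} {S′} {R₄} (app fr y))))) ⟩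
        (idᴴ S ⊗ (x′ ⊗ idᴴ R₄)) ∘ (J shᵇ ∘ J (fr ⨾ shᵇ))             ≋⟨ assoc⁻ _ _ _ ⟩
        ((idᴴ S ⊗ (x′ ⊗ idᴴ R₄)) ∘ J shᵇ) ∘ J (fr ⨾ shᵇ)             ≋⟨ ∘ˡ (≋-sym (sh-nat _ _ _)) ⟩
        (J shᵇ ∘ (x′ ⊗ (idᴴ S ⊗ idᴴ R₄))) ∘ J (fr ⨾ shᵇ)             ≋⟨ ∘-assoc _ _ _ ⟩
        J shᵇ ∘ ((x′ ⊗ (idᴴ S ⊗ idᴴ R₄)) ∘ J (fr ⨾ shᵇ))             ≋⟨ ∘ʳ (∘-cong (⊗ʳ (idᴴ-⊗ S R₄)) (J-cong (λ _ → refl))) ⟩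
        J shᵇ ∘ layer x′ (S ⊎ᶠ R₄) f₂ ∎
        where
        sh-inv : ∀ {P Q R} (y : ⟦ P ⊎ᶠ Q ⊎ᶠ R ⟧) → app (shᵇ {Q} {P} {R}) (app (shᵇ {P} {Q} {R}) y) ≡ y
        sh-inv (inj₁ _) = refl
        sh-inv (inj₂ (inj₁ _)) = refl
        sh-inv (inj₂ (inj₂ _)) = refl

-- Sequences of layers

module Sequences {o e a} (𝒞 : SMC o e) (Atom : FSet → FSet → Set a)
                 (ι : ∀ {S T} → Atom S T → SMC.Hom 𝒞 S T) where
  open SMC 𝒞
  open SMC-Properties 𝒞

  -- Layers are listed from the inputs, and `h` is the composite of the remaining ones. The
  -- factorisation is required only up to `≋`, so having a sequence is invariant under equality of
  -- morphisms.
  data Seq {A B : FSet} (z : Hom A B) : Set (lsuc 0ℓ ⊔ o ⊔ e ⊔ a) where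
    wires : (f : Bij A B) → z ≋ J f → Seq z
    step  : ∀ {S T} (x : Atom S T) (R : FSet) (f : Bij A (S ⊎ᶠ R)) (h : Hom (T ⊎ᶠ R) B) →
            Seq h → z ≋ h ∘ layer (ι x) R f → Seq z

  Seq-resp : ∀ {A B} {z w : Hom A B} → z ≋ w → Seq z → Seq w
  Seq-resp s (wires f t) = wires f (≋-trans (≋-sym s) t)
  Seq-resp s (step x R f h d t) = step x R f h d (≋-trans (≋-sym s) t)

  Seq-J : ∀ {A B} (f : Bij A B) → Seq {A} {B} (J f)
  Seq-J f = wires f ≋-refl

  Seq-∘J : ∀ {A B C} {z : Hom B C} → Seq z → (f : Bij A B) → Seq {A} (z ∘ J f)
  Seq-∘J (wires g t) f = wires (f ⨾ g) (≋-trans (∘ˡ t) (J-∘ g f))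
  Seq-∘J (step x R g h d t) f = step x R (f ⨾ g) h d
    (≋-trans (∘ˡ t) (≋-trans (∘-assoc _ _ _) (∘ʳ (layer-J _ R g f))))

  Seq-∘ : ∀ {A B C} {w : Hom B C} {z : Hom A B} → Seq w → Seq z → Seq (w ∘ z)
  Seq-∘ c (wires f t) = Seq-resp (∘ʳ (≋-sym t)) (Seq-∘J c f)
  Seq-∘ {w = w} c (step x R f h d t) = step x R f (w ∘ h) (Seq-∘ c d) (≋-trans (∘ʳ t) (assoc⁻ _ _ _))

  Seq-⊗id : ∀ {A B} {z : Hom A B} → Seq z → ∀ R → Seq (z ⊗ idᴴ R)
  Seq-⊗id (wires f t) R = wires (f ⊎ᵇ idᵇ) (≋-trans (⊗ˡ t) (J-⊗ f idᵇ))
  Seq-⊗id {z = z} (step x R₀ f h d t) R =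
    step x (R₀ ⊎ᶠ R) ((f ⊎ᵇ idᵇ) ⨾ αᵇ) ((h ⊗ idᴴ R) ∘ J (symᵇ αᵇ)) (Seq-∘J (Seq-⊗id d R) _) (begin
      z ⊗ idᴴ R                                        ≋⟨ ⊗-cong t (≋-sym (idˡ _)) ⟩
      (h ∘ layer (ι x) R₀ f) ⊗ (idᴴ R ∘ idᴴ R)         ≋⟨ ≋-sym (interchange _ _ _ _) ⟩
      (h ⊗ idᴴ R) ∘ (layer (ι x) R₀ f ⊗ idᴴ R)         ≋⟨ ∘ʳ (layer-⊗ _ _ _ _) ⟩
      (h ⊗ idᴴ R) ∘ (J (symᵇ αᵇ) ∘ layer (ι x) (R₀ ⊎ᶠ R) _)  ≋⟨ assoc⁻ _ _ _ ⟩
      ((h ⊗ idᴴ R) ∘ J (symᵇ αᵇ)) ∘ layer (ι x) (R₀ ⊎ᶠ R) _ ∎)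

  -- One factor runs at a time: `w` beside the idle strands `A`, then `z` beside `B′`. The
  -- symmetries bring the idle strands to the right, where layers keep them.
  Seq-⊗ : ∀ {A B A′ B′} {z : Hom A B} {w : Hom A′ B′} → Seq z → Seq w → Seq (z ⊗ w)
  Seq-⊗ {A} {B} {A′} {B′} {z} {w} c d = Seq-resp glued
    (Seq-∘ (Seq-⊗id c B′) (Seq-∘ (Seq-J γᵇ) (Seq-∘J (Seq-⊗id d A) γᵇ)))
    where
    glued : (z ⊗ idᴴ B′) ∘ (J γᵇ ∘ ((w ⊗ idᴴ A) ∘ J γᵇ)) ≋ z ⊗ w
    glued = begin
      (z ⊗ idᴴ B′) ∘ (J γᵇ ∘ ((w ⊗ idᴴ A) ∘ J γᵇ))  ≋⟨ ∘ʳ (≋-trans (assoc⁻ _ _ _) (≋-trans (∘ˡ (γ-nat w (idᴴ A))) (J-mergeʳ _ _ _))) ⟩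
      (z ⊗ idᴴ B′) ∘ ((idᴴ A ⊗ w) ∘ J (γᵇ ⨾ γᵇ))    ≋⟨ ∘ʳ (J-id _ (λ { (inj₁ _) → refl ; (inj₂ _) → refl }) _) ⟩
      (z ⊗ idᴴ B′) ∘ (idᴴ A ⊗ w)                      ≋⟨ interchange _ _ _ _ ⟩
      (z ∘ idᴴ A) ⊗ (idᴴ B′ ∘ w)                      ≋⟨ ⊗-cong (idʳ z) (idˡ w) ⟩
      z ⊗ w ∎

  Seq-atom : ∀ {S T} (x : Atom S T) → Seq (ι x)
  Seq-atom x = step x ∅ (symᵇ ρᵇ) (J ρᵇ) (Seq-J ρᵇ) (begin
      ι x                                          ≋⟨ ≋-sym (J-cancelʳ ρᵇ _) ⟩
      (ι x ∘ J ρᵇ) ∘ J (symᵇ ρᵇ)                ≋⟨ ∘ˡ (≋-sym (ρ-nat _)) ⟩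
      (J ρᵇ ∘ (ι x ⊗ idᴴ ∅)) ∘ J (symᵇ ρᵇ)      ≋⟨ ∘-assoc _ _ _ ⟩
      J ρᵇ ∘ layer (ι x) ∅ (symᵇ ρᵇ) ∎)

-- Planar graphs as vertices with ordered ports, and a bijection from the sources of the wires (input
-- indices, output ports) to their targets (output indices, input ports).  A loop is a vertex with
-- loop = true; such vertices have no ports.

data Side : Set where
  inn out : Side

record Ports (V : Set) (loop : V → Bool) : Set₁ where
  field
    port      : FSet
    at        : ⟦ port ⟧ → V
    rank      : ⟦ port ⟧ → ℕ
    rank-inj  : ∀ x y → at x ≡ at y → rank x ≡ rank y → x ≡ y
    loop-free : ∀ x → loop (at x) ≡ false

data VS : Set₁ where
  verts : (V : FSet) (loop : ⟦ V ⟧ → Bool) (P : Side → Ports ⟦ V ⟧ loop) → VS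
  ∅ᵛ    : VS
  _⊕_   : VS → VS → VS

V : VS → FSet
V (verts V _ _) = V
V ∅ᵛ = ∅
V (Λ ⊕ Λ′) = V Λ ⊎ᶠ V Λ′

loop : (Λ : VS) → ⟦ V Λ ⟧ → Bool
loop (verts V l P) v = l v
loop (Λ ⊕ Λ′) (inj₁ v) = loop Λ v
loop (Λ ⊕ Λ′) (inj₂ v) = loop Λ′ v

H : Side → VS → FSet
H d (verts V _ P) = Ports.port (P d)
H d ∅ᵛ = ∅
H d (Λ ⊕ Λ′) = H d Λ ⊎ᶠ H d Λ′

at : ∀ d Λ → ⟦ H d Λ ⟧ → ⟦ V Λ ⟧
at d (verts V _ P) h = Ports.at (P d) h
at d (Λ ⊕ Λ′) (inj₁ h) = inj₁ (at d Λ h)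
at d (Λ ⊕ Λ′) (inj₂ h) = inj₂ (at d Λ′ h)

rank : ∀ d Λ → ⟦ H d Λ ⟧ → ℕ
rank d (verts V _ P) h = Ports.rank (P d) h
rank d (Λ ⊕ Λ′) (inj₁ h) = rank d Λ h
rank d (Λ ⊕ Λ′) (inj₂ h) = rank d Λ′ h

rank-inj : ∀ d Λ x y → at d Λ x ≡ at d Λ y → rank d Λ x ≡ rank d Λ y → x ≡ y
rank-inj d (verts V _ P) x y p q = Ports.rank-inj (P d) x y p q
rank-inj d (Λ ⊕ Λ′) (inj₁ x) (inj₁ y) p q = cong inj₁ (rank-inj d Λ x y (inj₁-injective p) q)
rank-inj d (Λ ⊕ Λ′) (inj₂ x) (inj₂ y) p q = cong inj₂ (rank-inj d Λ′ x y (inj₂-injective p) q)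

loop-free : ∀ d Λ x → loop Λ (at d Λ x) ≡ false
loop-free d (verts V _ P) x = Ports.loop-free (P d) x
loop-free d (Λ ⊕ Λ′) (inj₁ x) = loop-free d Λ x
loop-free d (Λ ⊕ Λ′) (inj₂ x) = loop-free d Λ′ x

-- Isomorphisms of ordered vertex sets

record VIso (Λ Λ′ : VS) : Set where
  field
    fV : ⟦ V Λ ⟧ ↔ ⟦ V Λ′ ⟧
    fH : ∀ d → ⟦ H d Λ ⟧ ↔ ⟦ H d Λ′ ⟧
    loop-comm : ∀ v → loop Λ′ (to fV v) ≡ loop Λ v
    at-comm : ∀ d h → at d Λ′ (to (fH d) h) ≡ to fV (at d Λ h)
    mono : ∀ d x y → at d Λ x ≡ at d Λ y → rank d Λ x < rank d Λ y →
           rank d Λ′ (to (fH d) x) < rank d Λ′ (to (fH d) y)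
open VIso public

rank-preserving : ∀ {Λ Λ′} (fV : ⟦ V Λ ⟧ ↔ ⟦ V Λ′ ⟧) (fH : ∀ d → ⟦ H d Λ ⟧ ↔ ⟦ H d Λ′ ⟧) →
  (∀ v → loop Λ′ (to fV v) ≡ loop Λ v) → (∀ d h → at d Λ′ (to (fH d) h) ≡ to fV (at d Λ h)) →
  (∀ d h → rank d Λ′ (to (fH d) h) ≡ rank d Λ h) → VIso Λ Λ′
rank-preserving fV fH l a r = record { fV = fV ; fH = fH ; loop-comm = l ; at-comm = a
  ; mono = λ d x y _ x<y → subst₂ _<_ (sym (r d x)) (sym (r d y)) x<y }

idᵛ : ∀ {Λ} → VIso Λ Λ
idᵛ = rank-preserving ↔-refl (λ _ → ↔-refl) (λ _ → refl) (λ _ _ → refl) (λ _ _ → refl)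

transᵛ : ∀ {Λ Λ′ Λ″} → VIso Λ Λ′ → VIso Λ′ Λ″ → VIso Λ Λ″
transᵛ i j = record
  { fV = fV i ⨟ fV j ; fH = λ d → fH i d ⨟ fH j d
  ; loop-comm = λ v → trans (loop-comm j _) (loop-comm i v)
  ; at-comm = λ d h → trans (at-comm j d _) (cong (to (fV j)) (at-comm i d h))
  ; mono = λ d x y p x<y → mono j d _ _ (trans (at-comm i d x) (trans (cong (to (fV i)) p) (sym (at-comm i d y))))
                             (mono i d x y p x<y) }

at-from : ∀ {Λ Λ′} (i : VIso Λ Λ′) d h → at d Λ (from (fH i d) h) ≡ from (fV i) (at d Λ′ h)
at-from {Λ′ = Λ′} i d h = to⇒from (fV i) (trans (sym (at-comm i d _)) (cong (at d Λ′) (to-from (fH i d) h)))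

-- Ranks are injective at a vertex and numbers are totally ordered, so a bijection that preserves
-- the strict order also reflects it.
mono-from : ∀ {Λ Λ′} (i : VIso Λ Λ′) d x y → at d Λ′ (to (fH i d) x) ≡ at d Λ′ (to (fH i d) y) →
            rank d Λ′ (to (fH i d) x) < rank d Λ′ (to (fH i d) y) → rank d Λ x < rank d Λ y
mono-from {Λ} {Λ′} i d x y p x<y with at≡ ← to-injective (fV i) (trans (sym (at-comm i d x)) (trans p (at-comm i d y)))
                               | <-cmp (rank d Λ x) (rank d Λ y)
... | tri< lt _ _ = lt
... | tri≈ _ eq _ = ⊥-elim (<-irrefl (cong (λ z → rank d Λ′ (to (fH i d) z)) (rank-inj d Λ x y at≡ eq)) x<y)
... | tri> _ _ gt = ⊥-elim (<-asym x<y (mono i d y x (sym at≡) gt))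

symᵛ : ∀ {Λ Λ′} → VIso Λ Λ′ → VIso Λ′ Λ
symᵛ {Λ} {Λ′} i = record
  { fV = ↔-sym (fV i) ; fH = λ d → ↔-sym (fH i d)
  ; loop-comm = λ v → trans (sym (loop-comm i _)) (cong (loop Λ′) (to-from (fV i) v))
  ; at-comm = at-from i
  ; mono = λ d x y p x<y → mono-from i d _ _
      (subst₂ (λ a b → at d Λ′ a ≡ at d Λ′ b) (sym (to-from (fH i d) x)) (sym (to-from (fH i d) y)) p)
      (subst₂ (λ a b → rank d Λ′ a < rank d Λ′ b) (sym (to-from (fH i d) x)) (sym (to-from (fH i d) y)) x<y) }

infixr 5 _⊕ᵛ_
_⊕ᵛ_ : ∀ {Λ₁ Λ₂ Λ₁′ Λ₂′} → VIso Λ₁ Λ₁′ → VIso Λ₂ Λ₂′ → VIso (Λ₁ ⊕ Λ₂) (Λ₁′ ⊕ Λ₂′)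
i ⊕ᵛ j = record
  { fV = fV i ⊎-↔ fV j ; fH = λ d → fH i d ⊎-↔ fH j d
  ; loop-comm = λ { (inj₁ v) → loop-comm i v ; (inj₂ v) → loop-comm j v }
  ; at-comm = λ { d (inj₁ h) → cong inj₁ (at-comm i d h) ; d (inj₂ h) → cong inj₂ (at-comm j d h) }
  ; mono = λ { d (inj₁ x) (inj₁ y) p → mono i d x y (inj₁-injective p)
             ; d (inj₂ x) (inj₂ y) p → mono j d x y (inj₂-injective p)
             ; d (inj₁ x) (inj₂ y) () ; d (inj₂ x) (inj₁ y) () } }

assocᵛ : ∀ {Λ₁ Λ₂ Λ₃} → VIso ((Λ₁ ⊕ Λ₂) ⊕ Λ₃) (Λ₁ ⊕ (Λ₂ ⊕ Λ₃))
assocᵛ = rank-preserving ⊎-α (λ _ → ⊎-α)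
  (λ { (inj₁ (inj₁ _)) → refl ; (inj₁ (inj₂ _)) → refl ; (inj₂ _) → refl })
  (λ { _ (inj₁ (inj₁ _)) → refl ; _ (inj₁ (inj₂ _)) → refl ; _ (inj₂ _) → refl })
  (λ { _ (inj₁ (inj₁ _)) → refl ; _ (inj₁ (inj₂ _)) → refl ; _ (inj₂ _) → refl })

commᵛ : ∀ {Λ Λ′} → VIso (Λ ⊕ Λ′) (Λ′ ⊕ Λ)
commᵛ = rank-preserving ⊎-γ (λ _ → ⊎-γ) (λ { (inj₁ _) → refl ; (inj₂ _) → refl })
  (λ { _ (inj₁ _) → refl ; _ (inj₂ _) → refl }) (λ { _ (inj₁ _) → refl ; _ (inj₂ _) → refl })

unitʳᵛ : ∀ {Λ} → VIso (Λ ⊕ ∅ᵛ) Λ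
unitʳᵛ = rank-preserving ⊎-ρ (λ _ → ⊎-ρ) (λ { (inj₁ _) → refl ; (inj₂ ()) })
  (λ { _ (inj₁ _) → refl ; _ (inj₂ ()) }) (λ { _ (inj₁ _) → refl ; _ (inj₂ ()) })

unitˡᵛ : ∀ {Λ} → VIso (∅ᵛ ⊕ Λ) Λ
unitˡᵛ = rank-preserving ⊎-λ (λ _ → ⊎-λ) (λ { (inj₁ ()) ; (inj₂ _) → refl })
  (λ { _ (inj₁ ()) ; _ (inj₂ _) → refl }) (λ { _ (inj₁ ()) ; _ (inj₂ _) → refl })

mid4ᵛ : ∀ {Λ₁ Λ₂ Λ₃ Λ₄} → VIso ((Λ₁ ⊕ Λ₂) ⊕ (Λ₃ ⊕ Λ₄)) ((Λ₁ ⊕ Λ₃) ⊕ (Λ₂ ⊕ Λ₄))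
mid4ᵛ = rank-preserving ⊎-mid4 (λ _ → ⊎-mid4)
  (λ { (inj₁ (inj₁ _)) → refl ; (inj₁ (inj₂ _)) → refl ; (inj₂ (inj₁ _)) → refl ; (inj₂ (inj₂ _)) → refl })
  (λ { _ (inj₁ (inj₁ _)) → refl ; _ (inj₁ (inj₂ _)) → refl ; _ (inj₂ (inj₁ _)) → refl ; _ (inj₂ (inj₂ _)) → refl })
  (λ { _ (inj₁ (inj₁ _)) → refl ; _ (inj₁ (inj₂ _)) → refl ; _ (inj₂ (inj₁ _)) → refl ; _ (inj₂ (inj₂ _)) → refl })

-- Composition of wire bijections

after : {M I₁ O₂ B I₂ : Set} → (M ⊎ O₂ → B ⊎ I₂) → M ⊎ I₁ → B ⊎ (I₁ ⊎ I₂)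
after q (inj₁ m) = ⊎map₂ inj₂ (q (inj₁ m))
after q (inj₂ i) = inj₂ (inj₁ i)

module _ {A M O₁ I₁ O₂ B I₂ : Set} where
  -- A wire reaching the interface `M` continues in the second graph, where it ends in `B` or `I₂`
  -- and cannot return to `M`. One passage suffices, and no iteration as in a trace occurs.
  thread : (A ⊎ O₁ → M ⊎ I₁) → (M ⊎ O₂ → B ⊎ I₂) → A ⊎ (O₁ ⊎ O₂) → B ⊎ (I₁ ⊎ I₂)
  thread p q (inj₁ a)        = after q (p (inj₁ a))
  thread p q (inj₂ (inj₁ o)) = after q (p (inj₂ o))
  thread p q (inj₂ (inj₂ o)) = ⊎map₂ inj₂ (q (inj₂ o))

  thread-inj₁ : ∀ p q z → thread p q (⊎map₂ inj₁ z) ≡ after q (p z)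
  thread-inj₁ p q (inj₁ a) = refl
  thread-inj₁ p q (inj₂ o) = refl

module _ {A M O₁ I₁ O₂ B I₂ : Set} (P : (A ⊎ O₁) ↔ (M ⊎ I₁)) (Q : (M ⊎ O₂) ↔ (B ⊎ I₂)) where
  private
    after⁻ : M ⊎ O₂ → A ⊎ (O₁ ⊎ O₂)
    after⁻ (inj₁ m) = ⊎map₂ inj₁ (from P (inj₁ m))
    after⁻ (inj₂ o) = inj₂ (inj₂ o)

    thread⁻ : B ⊎ (I₁ ⊎ I₂) → A ⊎ (O₁ ⊎ O₂)
    thread⁻ (inj₁ b)        = after⁻ (from Q (inj₁ b))
    thread⁻ (inj₂ (inj₁ i)) = ⊎map₂ inj₁ (from P (inj₂ i))
    thread⁻ (inj₂ (inj₂ i)) = after⁻ (from Q (inj₂ i))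

    thread⁻-inj₂ : ∀ y → thread⁻ (⊎map₂ inj₂ y) ≡ after⁻ (from Q y)
    thread⁻-inj₂ (inj₁ b) = refl
    thread⁻-inj₂ (inj₂ o) = refl

    t : A ⊎ (O₁ ⊎ O₂) → B ⊎ (I₁ ⊎ I₂)
    t = thread (to P) (to Q)

    to-after⁻ : ∀ w → t (after⁻ w) ≡ ⊎map₂ inj₂ (to Q w)
    to-after⁻ (inj₁ m) = trans (thread-inj₁ _ _ (from P (inj₁ m))) (cong (after (to Q)) (to-from P (inj₁ m)))
    to-after⁻ (inj₂ o) = refl

    from-after : ∀ w → thread⁻ (after (to Q) w) ≡ ⊎map₂ inj₁ (from P w)
    from-after (inj₁ m) = trans (thread⁻-inj₂ (to Q (inj₁ m))) (cong after⁻ (from-to Q (inj₁ m)))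
    from-after (inj₂ i) = refl

    to-thread⁻ : ∀ y → t (thread⁻ y) ≡ y
    to-thread⁻ (inj₁ b)        = trans (to-after⁻ _) (cong (⊎map₂ inj₂) (to-from Q (inj₁ b)))
    to-thread⁻ (inj₂ (inj₁ i)) = trans (thread-inj₁ _ _ (from P (inj₂ i))) (cong (after (to Q)) (to-from P (inj₂ i)))
    to-thread⁻ (inj₂ (inj₂ i)) = trans (to-after⁻ _) (cong (⊎map₂ inj₂) (to-from Q (inj₂ i)))

    from-thread : ∀ z → thread⁻ (t z) ≡ z
    from-thread (inj₁ a)        = trans (from-after _) (cong (⊎map₂ inj₁) (from-to P (inj₁ a)))
    from-thread (inj₂ (inj₁ o)) = trans (from-after _) (cong (⊎map₂ inj₁) (from-to P (inj₂ o)))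
    from-thread (inj₂ (inj₂ o)) = trans (thread⁻-inj₂ (to Q (inj₂ o))) (cong after⁻ (from-to Q (inj₂ o)))

  composite : (A ⊎ (O₁ ⊎ O₂)) ↔ (B ⊎ (I₁ ⊎ I₂))
  composite = mk↔ₛ′ t thread⁻ to-thread⁻ from-thread

-- The symmetric monoidal category of graphs

infixr 10 _⊚_
infixr 15 _⊛_
-- Composition and tensor product are constructors, as for bijections: unification can recover the
-- factors, while `vs` and `π` still compute.
data CG : FSet → FSet → Set₁ where
  graph : ∀ {A B} (Λ : VS) → (⟦ A ⟧ ⊎ ⟦ H out Λ ⟧) ↔ (⟦ B ⟧ ⊎ ⟦ H inn Λ ⟧) → CG A B
  wiring : ∀ {A B} → Bij A B → CG A B
  _⊚_ : ∀ {A B C} → CG B C → CG A B → CG A C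
  _⊛_ : ∀ {A B A′ B′} → CG A B → CG A′ B′ → CG (A ⊎ᶠ A′) (B ⊎ᶠ B′)

vs : ∀ {A B} → CG A B → VS
vs (graph Λ _) = Λ
vs (wiring f)  = ∅ᵛ
vs (D ⊚ C)     = vs C ⊕ vs D
vs (C ⊛ D)     = vs C ⊕ vs D

O I : ∀ {A B} → CG A B → Set
O C = ⟦ H out (vs C) ⟧
I C = ⟦ H inn (vs C) ⟧

π : ∀ {A B} (C : CG A B) → (⟦ A ⟧ ⊎ O C) ↔ (⟦ B ⟧ ⊎ I C)
π (graph _ p) = p
π (wiring f)  = ⟪ f ⟫ ⊎-↔ ↔-refl
π (D ⊚ C)     = composite (π C) (π D)
π (C ⊛ D)     = ⊎-mid4 ⨟ (π C ⊎-↔ π D) ⨟ ⊎-mid4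

record HIso {A B A′ B′} (f : Bij A A′) (g : Bij B B′) (C : CG A B) (D : CG A′ B′) : Set where
  field
    vi   : VIso (vs C) (vs D)
    comm : ∀ z → to (π D) (⊎map (app f) (to (fH vi out)) z) ≡ ⊎map (app g) (to (fH vi inn)) (to (π C) z)
open HIso public

infix 4 _≈_
_≈_ : ∀ {A B} → CG A B → CG A B → Set
_≈_ = HIso idᵇ idᵇ

⊎map-∘ : {A B C A′ B′ C′ : Set} (f′ : B → C) (g′ : B′ → C′) (f : A → B) (g : A′ → B′) →
         ∀ z → ⊎map f′ g′ (⊎map f g z) ≡ ⊎map (λ x → f′ (f x)) (λ x → g′ (g x)) z
⊎map-∘ f′ g′ f g (inj₁ x) = refl
⊎map-∘ f′ g′ f g (inj₂ x) = refl

⊎map-id : {A B : Set} {f : A → A} {g : B → B} → (∀ x → f x ≡ x) → (∀ x → g x ≡ x) → ∀ z → ⊎map f g z ≡ z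
⊎map-id p q (inj₁ x) = cong inj₁ (p x)
⊎map-id p q (inj₂ x) = cong inj₂ (q x)

transʰ : ∀ {A B A′ B′ A″ B″} {f : Bij A A′} {g : Bij B B′} {f′ : Bij A′ A″} {g′ : Bij B′ B″}
         {C : CG A B} {D : CG A′ B′} {E : CG A″ B″} → HIso f g C D → HIso f′ g′ D E → HIso (f ⨾ f′) (g ⨾ g′) C E
transʰ {C = C} {E = E} i j = record { vi = transᵛ (vi i) (vi j) ; comm = λ z →
  trans (cong (to (π E)) (sym (⊎map-∘ _ _ _ _ z))) (trans (comm j _) (trans (cong (⊎map _ _) (comm i z)) (⊎map-∘ _ _ _ _ (to (π C) z)))) }

symʰ : ∀ {A B A′ B′} {f : Bij A A′} {g : Bij B B′} {C : CG A B} {D : CG A′ B′} → HIso f g C D →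
       HIso (symᵇ f) (symᵇ g) D C
symʰ {f = f} {g} {C} {D} i = record { vi = symᵛ (vi i) ; comm = λ z → to-injective (⟪ g ⟫ ⊎-↔ fH (vi i) inn)
  (trans (sym (comm i _)) (trans (cong (to (π D)) (trans (⊎map-∘ _ _ _ _ z) (⊎map-id (to-from ⟪ f ⟫) (to-from (fH (vi i) out)) z)))
    (sym (trans (⊎map-∘ _ _ _ _ (to (π D) z)) (⊎map-id (to-from ⟪ g ⟫) (to-from (fH (vi i) inn)) _))))) }

reframe : ∀ {A B A′ B′} {f f′ : Bij A A′} {g g′ : Bij B B′} {C : CG A B} {D : CG A′ B′} → f ≐ f′ → g ≐ g′ →
          HIso f g C D → HIso f′ g′ C D
reframe {f = f} {f′} {g} {g′} {C} {D} p q i = record { vi = vi i ; comm = λ z →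
  trans (cong (to (π D)) (left z)) (trans (comm i z) (right (to (π C) z))) }
  where
  left : ∀ z → ⊎map (app f′) (to (fH (vi i) out)) z ≡ ⊎map (app f) (to (fH (vi i) out)) z
  left (inj₁ a) = cong inj₁ (sym (p a))
  left (inj₂ o) = refl
  right : ∀ z → ⊎map (app g) (to (fH (vi i) inn)) z ≡ ⊎map (app g′) (to (fH (vi i) inn)) z
  right (inj₁ b) = cong inj₁ (q b)
  right (inj₂ o) = refl

≈-refl : ∀ {A B} {C : CG A B} → C ≈ C
≈-refl {C = C} = record { vi = idᵛ ; comm = λ z →
  trans (cong (to (π C)) (⊎map-id (λ _ → refl) (λ _ → refl) z)) (sym (⊎map-id (λ _ → refl) (λ _ → refl) _)) }

≈-sym : ∀ {A B} {C D : CG A B} → C ≈ D → D ≈ C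
≈-sym i = reframe (λ _ → refl) (λ _ → refl) (symʰ i)

≈-trans : ∀ {A B} {C D E : CG A B} → C ≈ D → D ≈ E → C ≈ E
≈-trans i j = reframe (λ _ → refl) (λ _ → refl) (transʰ i j)

⊚-congʰ : ∀ {A M B A′ M′ B′} {f : Bij A A′} {m : Bij M M′} {g : Bij B B′}
          {C : CG A M} {D : CG M B} {C′ : CG A′ M′} {D′ : CG M′ B′} →
          HIso f m C C′ → HIso m g D D′ → HIso f g (D ⊚ C) (D′ ⊚ C′)
⊚-congʰ {f = f} {m} {g} {C} {D} {C′} {D′} i j = record { vi = vi i ⊕ᵛ vi j ; comm = λ
  { (inj₁ a)        → trans (cong (after (to (π D′))) (comm i (inj₁ a))) (after-nat (to (π C) (inj₁ a)))
  ; (inj₂ (inj₁ o)) → trans (cong (after (to (π D′))) (comm i (inj₂ o))) (after-nat (to (π C) (inj₂ o)))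
  ; (inj₂ (inj₂ o)) → trans (cong (⊎map₂ inj₂) (comm j (inj₂ o))) (push-nat (to (π D) (inj₂ o))) } }
  where
  push-nat : ∀ y → ⊎map₂ inj₂ (⊎map (app g) (to (fH (vi j) inn)) y)
                 ≡ ⊎map (app g) (to (fH (vi i) inn ⊎-↔ fH (vi j) inn)) (⊎map₂ inj₂ y)
  push-nat (inj₁ b) = refl
  push-nat (inj₂ x) = refl
  after-nat : ∀ y → after (to (π D′)) (⊎map (app m) (to (fH (vi i) inn)) y)
                  ≡ ⊎map (app g) (to (fH (vi i) inn ⊎-↔ fH (vi j) inn)) (after (to (π D)) y)
  after-nat (inj₁ x) = trans (cong (⊎map₂ inj₂) (comm j (inj₁ x))) (push-nat (to (π D) (inj₁ x)))
  after-nat (inj₂ y) = refl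

⊚-cong : ∀ {A M B} {D D′ : CG M B} {C C′ : CG A M} → D ≈ D′ → C ≈ C′ → D ⊚ C ≈ D′ ⊚ C′
⊚-cong j i = ⊚-congʰ i j

mid4-nat : {A B C D A′ B′ C′ D′ : Set} {a : A → A′} {b : B → B′} {c : C → C′} {d : D → D′} → ∀ z →
           to ⊎-mid4 (⊎map (⊎map a b) (⊎map c d) z) ≡ ⊎map (⊎map a c) (⊎map b d) (to ⊎-mid4 z)
mid4-nat (inj₁ (inj₁ _)) = refl
mid4-nat (inj₁ (inj₂ _)) = refl
mid4-nat (inj₂ (inj₁ _)) = refl
mid4-nat (inj₂ (inj₂ _)) = refl

⊛-congʰ : ∀ {A B A′ B′ E F E′ F′} {f : Bij A A′} {g : Bij B B′} {f′ : Bij E E′} {g′ : Bij F F′}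
          {C : CG A B} {C′ : CG A′ B′} {D : CG E F} {D′ : CG E′ F′} →
          HIso f g C C′ → HIso f′ g′ D D′ → HIso (f ⊎ᵇ f′) (g ⊎ᵇ g′) (C ⊛ D) (C′ ⊛ D′)
⊛-congʰ {C = C} {C′} {D} {D′} i j = record { vi = vi i ⊕ᵛ vi j ; comm = λ z →
  trans (cong (λ y → to ⊎-mid4 (⊎map (to (π C′)) (to (π D′)) y)) (mid4-nat z))
  (trans (cong (to ⊎-mid4) (both (to ⊎-mid4 z))) (mid4-nat (⊎map (to (π C)) (to (π D)) (to ⊎-mid4 z)))) }
  where
  both : ∀ z → ⊎map (to (π C′)) (to (π D′)) (⊎map (⊎map _ _) (⊎map _ _) z) ≡ ⊎map (⊎map _ _) (⊎map _ _) (⊎map (to (π C)) (to (π D)) z)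
  both (inj₁ z) = cong inj₁ (comm i z)
  both (inj₂ z) = cong inj₂ (comm j z)

⊛-cong : ∀ {A B A′ B′} {C C′ : CG A B} {D D′ : CG A′ B′} → C ≈ C′ → D ≈ D′ → C ⊛ D ≈ C′ ⊛ D′
⊛-cong i j = reframe (λ { (inj₁ _) → refl ; (inj₂ _) → refl }) (λ { (inj₁ _) → refl ; (inj₂ _) → refl }) (⊛-congʰ i j)

⊚-assoc : ∀ {A B C D} (R : CG C D) (Q : CG B C) (P : CG A B) → (R ⊚ Q) ⊚ P ≈ R ⊚ (Q ⊚ P)
⊚-assoc R Q P = record { vi = symᵛ assocᵛ ; comm = λ
  { (inj₁ a)               → fromP (to (π P) (inj₁ a))
  ; (inj₂ (inj₁ o))        → fromP (to (π P) (inj₂ o))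
  ; (inj₂ (inj₂ (inj₁ o))) → fromQ (to (π Q) (inj₂ o))
  ; (inj₂ (inj₂ (inj₂ o))) → fromR (to (π R) (inj₂ o)) } }
  where
  fromR : ∀ y → ⊎map₂ inj₂ y ≡ ⊎map id (from ⊎-α) (⊎map₂ inj₂ (⊎map₂ inj₂ y))
  fromR (inj₁ _) = refl
  fromR (inj₂ _) = refl
  fromQ : ∀ y → after (to (π R)) (⊎map₂ inj₂ y) ≡ ⊎map id (from ⊎-α) (⊎map₂ inj₂ (after (to (π R)) y))
  fromQ (inj₁ c) = fromR (to (π R) (inj₁ c))
  fromQ (inj₂ _) = refl
  fromP : ∀ y → after (to (π R)) (after (to (π Q)) y) ≡ ⊎map id (from ⊎-α) (after (to (π (R ⊚ Q))) y)
  fromP (inj₁ b) = fromQ (to (π Q) (inj₁ b))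
  fromP (inj₂ _) = refl

⊚-idˡ : ∀ {A B} (P : CG A B) → wiring idᵇ ⊚ P ≈ P
⊚-idˡ {B = B} P = record { vi = unitʳᵛ ; comm = λ
  { (inj₁ a) → lem (to (π P) (inj₁ a)) ; (inj₂ (inj₁ o)) → lem (to (π P) (inj₂ o)) ; (inj₂ (inj₂ ())) } }
  where
  lem : ∀ y → y ≡ ⊎map id (to ⊎-ρ) (after (to (π (wiring {B} idᵇ))) y)
  lem (inj₁ _) = refl
  lem (inj₂ _) = refl

relabelʳ : ∀ {A A′ B} (P : CG A′ B) (f : Bij A A′) → HIso f idᵇ (P ⊚ wiring f) P
relabelʳ P f = record { vi = unitˡᵛ ; comm = λ
  { (inj₁ a) → lem (to (π P) (inj₁ (app f a))) ; (inj₂ (inj₁ ())) ; (inj₂ (inj₂ o)) → lem (to (π P) (inj₂ o)) } }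
  where
  lem : ∀ y → y ≡ ⊎map id (to (⊎-λ)) (⊎map₂ inj₂ y)
  lem (inj₁ _) = refl
  lem (inj₂ _) = refl

relabelˡ : ∀ {A B B′} (P : CG A B) (g : Bij B B′) → HIso idᵇ g P (wiring g ⊚ P)
relabelˡ P g = record { vi = symᵛ unitʳᵛ ; comm = λ
  { (inj₁ a) → lem (to (π P) (inj₁ a)) ; (inj₂ o) → lem (to (π P) (inj₂ o)) } }
  where
  lem : ∀ y → after (to (⟪ g ⟫ ⊎-↔ ↔-refl)) y ≡ ⊎map (app g) inj₁ y
  lem (inj₁ _) = refl
  lem (inj₂ _) = refl

-- The passage from isomorphisms over relabelled interfaces to naturality squares: associativity,
-- symmetry and unit of `⊛` are established in the first form and enter the category in the second.
square : ∀ {A B A′ B′} {f : Bij A A′} {g : Bij B B′} {C : CG A B} {D : CG A′ B′} → HIso f g C D →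
         wiring g ⊚ C ≈ D ⊚ wiring f
square {f = f} {g} {C} {D} i = reframe (λ a → from-to ⟪ f ⟫ a) (λ b → to-from ⟪ g ⟫ b)
  (transʰ (symʰ (relabelˡ C g)) (transʰ i (symʰ (relabelʳ D f))))

wiring-∘ : ∀ {A B C} (g : Bij B C) (f : Bij A B) → wiring g ⊚ wiring f ≈ wiring (f ⨾ g)
wiring-∘ g f = record { vi = unitʳᵛ ; comm = λ { (inj₁ _) → refl ; (inj₂ (inj₁ ())) ; (inj₂ (inj₂ ())) } }

wiring-⊛ : ∀ {A B A′ B′} (f : Bij A B) (g : Bij A′ B′) → wiring f ⊛ wiring g ≈ wiring (f ⊎ᵇ g)
wiring-⊛ f g = record { vi = unitʳᵛ ; comm = λ
  { (inj₁ (inj₁ _)) → refl ; (inj₁ (inj₂ _)) → refl ; (inj₂ (inj₁ ())) ; (inj₂ (inj₂ ())) } }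

⊛-interchange : ∀ {A B C A′ B′ C′} (P : CG B C) (P′ : CG B′ C′) (Q : CG A B) (Q′ : CG A′ B′) →
                (P ⊛ P′) ⊚ (Q ⊛ Q′) ≈ (P ⊚ Q) ⊛ (P′ ⊚ Q′)
⊛-interchange P P′ Q Q′ = record { vi = mid4ᵛ ; comm = λ
  { (inj₁ (inj₁ a))        → fromQ (to (π Q) (inj₁ a))
  ; (inj₁ (inj₂ a))        → fromQ′ (to (π Q′) (inj₁ a))
  ; (inj₂ (inj₁ (inj₁ o))) → fromQ (to (π Q) (inj₂ o))
  ; (inj₂ (inj₁ (inj₂ o))) → fromQ′ (to (π Q′) (inj₂ o))
  ; (inj₂ (inj₂ (inj₁ o))) → fromP (to (π P) (inj₂ o))
  ; (inj₂ (inj₂ (inj₂ o))) → fromP′ (to (π P′) (inj₂ o)) } }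
  where
  R = ⊎map id (to ⊎-mid4)
  fromP : ∀ y → to ⊎-mid4 (inj₁ (⊎map₂ inj₂ y)) ≡ R (⊎map₂ inj₂ (to ⊎-mid4 (inj₁ y)))
  fromP (inj₁ _) = refl
  fromP (inj₂ _) = refl
  fromP′ : ∀ y → to ⊎-mid4 (inj₂ (⊎map₂ inj₂ y)) ≡ R (⊎map₂ inj₂ (to ⊎-mid4 (inj₂ y)))
  fromP′ (inj₁ _) = refl
  fromP′ (inj₂ _) = refl
  fromQ : ∀ y → to ⊎-mid4 (inj₁ (after (to (π P)) y)) ≡ R (after (to (π (P ⊛ P′))) (to ⊎-mid4 (inj₁ y)))
  fromQ (inj₁ b) = fromP (to (π P) (inj₁ b))
  fromQ (inj₂ _) = refl
  fromQ′ : ∀ y → to ⊎-mid4 (inj₂ (after (to (π P′)) y)) ≡ R (after (to (π (P ⊛ P′))) (to ⊎-mid4 (inj₂ y)))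
  fromQ′ (inj₁ b) = fromP′ (to (π P′) (inj₁ b))
  fromQ′ (inj₂ _) = refl

⊛-α : ∀ {A B C A′ B′ C′} (P : CG A A′) (Q : CG B B′) (R : CG C C′) → HIso αᵇ αᵇ ((P ⊛ Q) ⊛ R) (P ⊛ (Q ⊛ R))
⊛-α P Q R = record { vi = assocᵛ ; comm = λ
  { (inj₁ (inj₁ (inj₁ a))) → fromP (to (π P) (inj₁ a))
  ; (inj₁ (inj₁ (inj₂ a))) → fromQ (to (π Q) (inj₁ a))
  ; (inj₁ (inj₂ a))        → fromR (to (π R) (inj₁ a))
  ; (inj₂ (inj₁ (inj₁ o))) → fromP (to (π P) (inj₂ o))
  ; (inj₂ (inj₁ (inj₂ o))) → fromQ (to (π Q) (inj₂ o))
  ; (inj₂ (inj₂ o))        → fromR (to (π R) (inj₂ o)) } }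
  where
  fromP : ∀ y → to ⊎-mid4 (inj₁ y) ≡ ⊎map (to ⊎-α) (to ⊎-α) (to ⊎-mid4 (inj₁ (to ⊎-mid4 (inj₁ y))))
  fromP (inj₁ _) = refl
  fromP (inj₂ _) = refl
  fromQ : ∀ y → to ⊎-mid4 (inj₂ (to ⊎-mid4 (inj₁ y))) ≡ ⊎map (to ⊎-α) (to ⊎-α) (to ⊎-mid4 (inj₁ (to ⊎-mid4 (inj₂ y))))
  fromQ (inj₁ _) = refl
  fromQ (inj₂ _) = refl
  fromR : ∀ y → to ⊎-mid4 (inj₂ (to ⊎-mid4 (inj₂ y))) ≡ ⊎map (to ⊎-α) (to ⊎-α) (to ⊎-mid4 (inj₂ y))
  fromR (inj₁ _) = refl
  fromR (inj₂ _) = refl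

⊛-γ : ∀ {A B A′ B′} (P : CG A A′) (Q : CG B B′) → HIso γᵇ γᵇ (P ⊛ Q) (Q ⊛ P)
⊛-γ P Q = record { vi = commᵛ ; comm = λ
  { (inj₁ (inj₁ a)) → fromP (to (π P) (inj₁ a)) ; (inj₁ (inj₂ a)) → fromQ (to (π Q) (inj₁ a))
  ; (inj₂ (inj₁ o)) → fromP (to (π P) (inj₂ o)) ; (inj₂ (inj₂ o)) → fromQ (to (π Q) (inj₂ o)) } }
  where
  fromP : ∀ y → to ⊎-mid4 (inj₂ y) ≡ ⊎map (to ⊎-γ) (to ⊎-γ) (to ⊎-mid4 (inj₁ y))
  fromP (inj₁ _) = refl
  fromP (inj₂ _) = refl
  fromQ : ∀ y → to ⊎-mid4 (inj₁ y) ≡ ⊎map (to ⊎-γ) (to ⊎-γ) (to ⊎-mid4 (inj₂ y))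
  fromQ (inj₁ _) = refl
  fromQ (inj₂ _) = refl

⊛-ρ : ∀ {A A′} (P : CG A A′) → HIso ρᵇ ρᵇ (P ⊛ wiring {∅} idᵇ) P
⊛-ρ P = record { vi = unitʳᵛ ; comm = λ
  { (inj₁ (inj₁ a)) → lem (to (π P) (inj₁ a)) ; (inj₁ (inj₂ ())) ; (inj₂ (inj₁ o)) → lem (to (π P) (inj₂ o)) ; (inj₂ (inj₂ ())) } }
  where
  lem : ∀ y → y ≡ ⊎map (to ⊎-ρ) (to ⊎-ρ) (to ⊎-mid4 (inj₁ y))
  lem (inj₁ _) = refl
  lem (inj₂ _) = refl

CG-SMC : SMC (lsuc 0ℓ) 0ℓ
CG-SMC = record
  { Hom = CG ; _≋_ = _≈_ ; ≋-refl = ≈-refl ; ≋-sym = ≈-sym ; ≋-trans = ≈-trans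
  ; _∘_ = _⊚_ ; _⊗_ = _⊛_ ; J = wiring ; ∘-cong = ⊚-cong ; ⊗-cong = ⊛-cong
  ; J-cong = λ s → record { vi = idᵛ ; comm = λ { (inj₁ a) → cong inj₁ (sym (s a)) ; (inj₂ ()) } }
  ; ∘-assoc = ⊚-assoc ; idˡ = ⊚-idˡ ; idʳ = λ P → relabelʳ P idᵇ
  ; interchange = ⊛-interchange ; J-∘ = wiring-∘ ; J-⊗ = wiring-⊛
  ; α-nat = λ P Q R → square (⊛-α P Q R) ; γ-nat = λ P Q → square (⊛-γ P Q) ; ρ-nat = λ P → square (⊛-ρ P) }

-- Splitting along a predecessor-closed set

isInj₂ : {A B : Set} → A ⊎ B → Bool
isInj₂ x = not (isInj₁ x)

isInj₂-T : {A B : Set} {x : A ⊎ B} → T (isInj₂ x) → Σ B λ b → x ≡ inj₂ b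
isInj₂-T {x = inj₂ b} _ = b , refl

T-∧ : ∀ {a b} → T a → T b → T (a ∧ b)
T-∧ {true} _ q = q

T-absurd : ∀ {ℓ} {W : Set ℓ} b → T b → T (not b) → W
T-absurd true _ ()

Sub-join : {A : Set} (p : A → Bool) → (Sub p ⊎ Sub (λ a → not (p a))) ↔ A
Sub-join {A} p = match forget id inj id (λ y → forget y , refl) back
  where
  forget : Sub p ⊎ Sub (λ a → not (p a)) → A
  forget (inj₁ x) = proj₁ x
  forget (inj₂ x) = proj₁ x
  inj : ∀ {x y} → forget x ≡ forget y → x ≡ y
  inj {inj₁ x} {inj₁ y} q = cong inj₁ (Sub-≡ p q)
  inj {inj₂ x} {inj₂ y} q = cong inj₂ (Sub-≡ _ q)
  inj {inj₁ (x , s)} {inj₂ (.x , t)} refl = T-absurd (p x) s t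
  inj {inj₂ (x , s)} {inj₁ (.x , t)} refl = T-absurd (p x) t s
  back : ∀ a → Σ _ λ y → forget y ≡ a
  back a with dec-Bool (p a)
  ... | inj₁ q = inj₁ (a , true-T q) , refl
  ... | inj₂ q = inj₂ (a , false-T q) , refl

Subᵛ : (Λ : VS) → (⟦ V Λ ⟧ → Bool) → VS
Subᵛ Λ D = verts (Subᶠ (V Λ) D) (λ v → loop Λ (proj₁ v)) λ d → record
  { port = Subᶠ (H d Λ) (λ h → D (at d Λ h))
  ; at = λ h → at d Λ (proj₁ h) , proj₂ h
  ; rank = λ h → rank d Λ (proj₁ h)
  ; rank-inj = λ x y p q → Sub-≡ _ (rank-inj d Λ _ _ (cong proj₁ p) q)
  ; loop-free = λ x → loop-free d Λ (proj₁ x) }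

joinᵛ : ∀ Λ D → VIso (Subᵛ Λ D ⊕ Subᵛ Λ (λ v → not (D v))) Λ
joinᵛ Λ D = rank-preserving (Sub-join D) (λ d → Sub-join (λ h → D (at d Λ h)))
  (λ { (inj₁ _) → refl ; (inj₂ _) → refl }) (λ { _ (inj₁ _) → refl ; _ (inj₂ _) → refl })
  (λ { _ (inj₁ _) → refl ; _ (inj₂ _) → refl })

Closed : ∀ {A B} (C : CG A B) → (⟦ V (vs C) ⟧ → Bool) → Set
Closed C D = ∀ o i → to (π C) (inj₂ o) ≡ inj₂ i → T (D (at inn (vs C) i)) → T (D (at out (vs C) o))

-- A set of vertices closed under predecessors can be evaluated before its complement.
module Split {A B} (C : CG A B) (D : ⟦ V (vs C) ⟧ → Bool) (closed : Closed C D) where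
  private
    Λ = vs C
    ¬D : ⟦ V Λ ⟧ → Bool
    ¬D v = not (D v)
    DO : O C → Bool
    DO o = D (at out Λ o)
    DI : I C → Bool
    DI i = D (at inn Λ i)
    W = ⟦ A ⟧ ⊎ O C
    src : W → Bool
    src (inj₁ a) = true
    src (inj₂ o) = DO o
    tgt : ⟦ B ⟧ ⊎ I C → Bool
    tgt (inj₁ b) = false
    tgt (inj₂ i) = DI i
    -- Inputs count as lying in `D` and outputs as lying outside. The wires running from inside to
    -- outside are cut and form the middle interface.
    cut : W → Bool
    cut z = src z ∧ not (tgt (to (π C) z))

  M : FSet
  M = Subᶠ (A ⊎ᶠ H out Λ) cut

  private
    -- Sources and targets of both factors are embedded in the set `W` of wires, each wire being
    -- named by its source. The image of `e₁` and `e₂` is the set of wires starting inside, that of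
    -- `e₃` and `e₄` the set of wires ending outside.
    e₁ : ⟦ A ⟧ ⊎ Sub DO → W
    e₁ = ⊎map₂ proj₁
    e₂ : ⟦ M ⟧ ⊎ Sub DI → W
    e₂ (inj₁ (z , _)) = z
    e₂ (inj₂ (i , _)) = from (π C) (inj₂ i)
    e₃ : ⟦ M ⟧ ⊎ Sub (λ o → not (DO o)) → W
    e₃ (inj₁ (z , _)) = z
    e₃ (inj₂ (o , _)) = inj₂ o
    e₄ : ⟦ B ⟧ ⊎ Sub (λ i → not (DI i)) → W
    e₄ y = from (π C) (⊎map₂ proj₁ y)

    map₂-inj : {X Y : Set} (p : Y → Bool) {x y : X ⊎ Sub p} → ⊎map₂ proj₁ x ≡ ⊎map₂ proj₁ y → x ≡ y
    map₂-inj p {inj₁ a} {inj₁ .a} refl = refl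
    map₂-inj p {inj₂ x} {inj₂ y} q = cong inj₂ (Sub-≡ p (inj₂-injective q))

    e₂-inj : ∀ {x y} → e₂ x ≡ e₂ y → x ≡ y
    e₂-inj {inj₁ x} {inj₁ y} q = cong inj₁ (Sub-≡ cut q)
    e₂-inj {inj₂ x} {inj₂ y} q = cong inj₂ (Sub-≡ DI (inj₂-injective (to-injective (↔-sym (π C)) q)))
    e₂-inj {inj₁ (z , s)} {inj₂ (i , t)} q = T-absurd (DI i) t
      (subst (λ y → T (not (tgt y))) (from⇒to (π C) (sym q)) (∧-snd (src z) _ s))
    e₂-inj {inj₂ (i , t)} {inj₁ (z , s)} q = T-absurd (DI i) t
      (subst (λ y → T (not (tgt y))) (from⇒to (π C) q) (∧-snd (src z) _ s))

    e₃-inj : ∀ {x y} → e₃ x ≡ e₃ y → x ≡ y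
    e₃-inj {inj₁ x} {inj₁ y} q = cong inj₁ (Sub-≡ cut q)
    e₃-inj {inj₂ x} {inj₂ y} q = cong inj₂ (Sub-≡ _ (inj₂-injective q))
    e₃-inj {inj₁ (.(inj₂ o) , s)} {inj₂ (o , t)} refl = T-absurd (DO o) (∧-fst _ _ s) t
    e₃-inj {inj₂ (o , t)} {inj₁ (.(inj₂ o) , s)} refl = T-absurd (DO o) (∧-fst _ _ s) t

    via-e₁ : ∀ z → T (src z) → Σ _ λ y → e₁ y ≡ z
    via-e₁ (inj₁ a) _ = inj₁ a , refl
    via-e₁ (inj₂ o) t = inj₂ (o , t) , refl

    via-e₂ : ∀ z → T (src z) → Σ _ λ y → e₂ y ≡ z
    via-e₂ z s with dec-Bool (tgt (to (π C) z))
    ... | inj₂ q = inj₁ (z , T-∧ s (false-T q)) , refl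
    ... | inj₁ q with to (π C) z in eq
    ... | inj₂ i = inj₂ (i , true-T q) , sym (to⇒from (π C) eq)

    via-e₃ : ∀ z → tgt (to (π C) z) ≡ false → Σ _ λ y → e₃ y ≡ z
    via-e₃ z q with dec-Bool (src z)
    ... | inj₁ s = inj₁ (z , T-∧ (true-T s) (false-T q)) , refl
    via-e₃ (inj₂ o) q | inj₂ s = inj₂ (o , false-T s) , refl

    via-e₄ : ∀ z → tgt (to (π C) z) ≡ false → Σ _ λ y → e₄ y ≡ z
    via-e₄ z q with to (π C) z in eq
    ... | inj₁ b = inj₁ b , sym (to⇒from (π C) eq)
    ... | inj₂ i = inj₂ (i , false-T q) , sym (to⇒from (π C) eq)

    -- Closedness enters here and in `tgt-e₃`: a wire that ends in `D` starts inside, so a wire that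
    -- starts outside ends outside.
    src-e₂ : ∀ y → T (src (e₂ y))
    src-e₂ (inj₁ (z , s)) = ∧-fst (src z) _ s
    src-e₂ (inj₂ (i , t)) with from (π C) (inj₂ i) in eq
    ... | inj₁ a = tt
    ... | inj₂ o = closed o i (from⇒to (π C) eq) t

    src-e₁ : ∀ y → T (src (e₁ y))
    src-e₁ (inj₁ a) = tt
    src-e₁ (inj₂ (o , t)) = t

    tgt-e₃ : ∀ y → tgt (to (π C) (e₃ y)) ≡ false
    tgt-e₃ (inj₁ (z , s)) = T-false (∧-snd (src z) _ s)
    tgt-e₃ (inj₂ (o , t)) with to (π C) (inj₂ o) in eq
    ... | inj₁ b = refl
    ... | inj₂ i with dec-Bool (DI i)
    ... | inj₁ q = T-absurd (DO o) (closed o i eq (true-T q)) t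
    ... | inj₂ q = q

    tgt-e₄ : ∀ y → tgt (to (π C) (e₄ y)) ≡ false
    tgt-e₄ (inj₁ b) = cong tgt (to-from (π C) (inj₁ b))
    tgt-e₄ (inj₂ (i , t)) = trans (cong tgt (to-from (π C) (inj₂ i))) (T-false t)

  first : CG A M
  first = graph (Subᵛ Λ D) (match e₁ e₂ (map₂-inj DO) e₂-inj
    (λ y → via-e₂ (e₁ y) (src-e₁ y)) (λ y → via-e₁ (e₂ y) (src-e₂ y)))

  second : CG M B
  second = graph (Subᵛ Λ ¬D) (match e₃ e₄ e₃-inj (λ q → map₂-inj _ (to-injective (↔-sym (π C)) q))
    (λ y → via-e₄ (e₃ y) (tgt-e₃ y)) (λ y → via-e₃ (e₄ y) (tgt-e₄ y)))

  private
    first-spec : ∀ y → e₂ (to (π first) y) ≡ e₁ y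
    first-spec y = proj₂ (via-e₂ (e₁ y) (src-e₁ y))

    second-spec : ∀ y → to (π C) (e₃ y) ≡ ⊎map₂ proj₁ (to (π second) y)
    second-spec y = from⇒to (π C) (proj₂ (via-e₄ (e₃ y) (tgt-e₃ y)))

    fI = to (Sub-join DI)

    glue₂ : ∀ (y : ⟦ B ⟧ ⊎ I second) → ⊎map₂ proj₁ y ≡ ⊎map id fI (⊎map₂ inj₂ y)
    glue₂ (inj₁ b) = refl
    glue₂ (inj₂ i) = refl

    glue₁ : ∀ y → to (π C) (e₂ y) ≡ ⊎map id fI (after (to (π second)) y)
    glue₁ (inj₁ m) = trans (second-spec (inj₁ m)) (glue₂ (to (π second) (inj₁ m)))
    glue₁ (inj₂ (i , t)) = to-from (π C) (inj₂ i)

  split : second ⊚ first ≈ C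
  split = record { vi = joinᵛ Λ D ; comm = λ
    { (inj₁ a)        → trans (cong (to (π C)) (sym (first-spec (inj₁ a)))) (glue₁ (to (π first) (inj₁ a)))
    ; (inj₂ (inj₁ o)) → trans (cong (to (π C)) (sym (first-spec (inj₂ o)))) (glue₁ (to (π first) (inj₂ o)))
    ; (inj₂ (inj₂ o)) → trans (second-spec (inj₂ o)) (glue₂ (to (π second) (inj₂ o))) } }

IO-free : ∀ {A B} → CG A B → Set
IO-free {A} {B} C = ∀ (a : ⟦ A ⟧) (b : ⟦ B ⟧) → ¬ (to (π C) (inj₁ a) ≡ inj₁ b)

-- Removing the input-output edges.
module Strip {A B} (C : CG A B) where
  private
    isS : ⟦ A ⟧ → Bool
    isS a = isInj₂ (to (π C) (inj₁ a))
    isT : ⟦ B ⟧ → Bool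
    isT b = isInj₂ (from (π C) (inj₁ b))

  -- `R` also indexes the outputs of the input-output edges, each edge being named by its input.
  S R T′ : FSet
  S  = Subᶠ A isS
  R  = Subᶠ A (λ a → not (isS a))
  T′ = Subᶠ B isT

  private
    e₁ : ⟦ S ⟧ ⊎ O C → ⟦ A ⟧ ⊎ O C
    e₁ = ⊎map₁ proj₁
    e₂ : ⟦ T′ ⟧ ⊎ I C → ⟦ A ⟧ ⊎ O C
    e₂ y = from (π C) (⊎map₁ proj₁ y)
    e₃ : ⟦ B ⟧ → ⟦ A ⟧ ⊎ O C
    e₃ b = from (π C) (inj₁ b)
    e₄ : ⟦ T′ ⟧ ⊎ ⟦ R ⟧ → ⟦ A ⟧ ⊎ O C
    e₄ (inj₁ t) = e₃ (proj₁ t)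
    e₄ (inj₂ r) = inj₁ (proj₁ r)

    map₁-inj : {X Y : Set} (p : X → Bool) {x y : Sub p ⊎ Y} → ⊎map₁ proj₁ x ≡ ⊎map₁ proj₁ y → x ≡ y
    map₁-inj p {inj₂ a} {inj₂ .a} refl = refl
    map₁-inj p {inj₁ x} {inj₁ y} q = cong inj₁ (Sub-≡ p (inj₁-injective q))

    e₃-inj : ∀ {x y} → e₃ x ≡ e₃ y → x ≡ y
    e₃-inj q = inj₁-injective (to-injective (↔-sym (π C)) q)

    e₄-inj : ∀ {x y} → e₄ x ≡ e₄ y → x ≡ y
    e₄-inj {inj₁ x} {inj₁ y} q = cong inj₁ (Sub-≡ isT (e₃-inj q))
    e₄-inj {inj₂ x} {inj₂ y} q = cong inj₂ (Sub-≡ _ (inj₁-injective q))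
    e₄-inj {inj₁ (b , t)} {inj₂ (a , s)} q = ⊥-elim (subst (λ z → T (isInj₂ z)) q t)
    e₄-inj {inj₂ (a , s)} {inj₁ (b , t)} q = ⊥-elim (subst (λ z → T (isInj₂ z)) (sym q) t)

    g₁₂ : ∀ y → Σ _ λ y′ → e₂ y′ ≡ e₁ y
    g₁₂ (inj₁ (a , t)) with to (π C) (inj₁ a) in eq
    ... | inj₂ i = inj₂ i , sym (to⇒from (π C) eq)
    g₁₂ (inj₂ o) with to (π C) (inj₂ o) in eq
    ... | inj₁ b = inj₁ (b , subst (λ z → T (isInj₂ z)) (to⇒from (π C) eq) tt) , sym (to⇒from (π C) eq)
    ... | inj₂ i = inj₂ i , sym (to⇒from (π C) eq)

    g₂₁ : ∀ y → Σ _ λ y′ → e₁ y′ ≡ e₂ y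
    g₂₁ (inj₁ (b , t)) with from (π C) (inj₁ b)
    ... | inj₂ o = inj₂ o , refl
    g₂₁ (inj₂ i) with from (π C) (inj₂ i) in eq
    ... | inj₁ a = inj₁ (a , subst (λ z → T (isInj₂ z)) (sym (from⇒to (π C) eq)) tt) , refl
    ... | inj₂ o = inj₂ o , refl

    g₃₄ : ∀ b → Σ _ λ y → e₄ y ≡ e₃ b
    g₃₄ b with from (π C) (inj₁ b) in eq
    ... | inj₁ a = inj₂ (a , subst (λ z → T (not (isInj₂ z))) (sym (from⇒to (π C) eq)) tt) , refl
    ... | inj₂ o = inj₁ (b , subst (λ z → T (isInj₂ z)) (sym eq) tt) , eq

    g₄₃ : ∀ y → Σ _ λ b → e₃ b ≡ e₄ y
    g₄₃ (inj₁ (b , t)) = b , refl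
    g₄₃ (inj₂ (a , t)) with to (π C) (inj₁ a) in eq
    ... | inj₁ b = b , sym (to⇒from (π C) eq)

  X : CG S T′
  X = graph (vs C) (match e₁ e₂ (map₁-inj isS) (λ q → map₁-inj isT (to-injective (↔-sym (π C)) q)) g₁₂ g₂₁)

  private
    X-spec : ∀ y → to (π C) (e₁ y) ≡ ⊎map₁ proj₁ (to (π X) y)
    X-spec y = from⇒to (π C) (proj₂ (g₁₂ y))

  f : Bij A (S ⊎ᶠ R)
  f = symᵇ (prim (Sub-join isS))

  g : Bij B (T′ ⊎ᶠ R)
  g = prim (match e₃ e₄ e₃-inj e₄-inj g₃₄ g₄₃)

  enters : ∀ a s → app f a ≡ inj₁ s → Σ _ λ i → to (π C) (inj₁ a) ≡ inj₂ i
  enters a (a′ , t) eq = isInj₂-T (subst (λ z → T (isS z)) (from⇒to (Sub-join isS) eq) t)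

  X-IO-free : IO-free X
  X-IO-free s@(a , t) b eq = subst (λ z → T (isInj₂ z)) (trans (X-spec (inj₁ s)) (cong (⊎map₁ proj₁) eq)) t

  X-internal : ∀ o i → to (π C) (inj₂ o) ≡ inj₂ i → to (π X) (inj₂ o) ≡ inj₂ i
  X-internal o i eq with to (π X) (inj₂ o) | X-spec (inj₂ o)
  ... | inj₁ t | q = ⊥-elim (inj₁≢inj₂ (trans (sym q) eq))
  ... | inj₂ j | q = cong inj₂ (inj₂-injective (trans (sym q) eq))

  private
    core : ∀ y → to (⊎-mid4 {C = ⟦ R ⟧} {D = Fin 0}) (inj₁ (to (π X) y)) ≡ ⊎map (app g) inj₁ (⊎map₁ proj₁ (to (π X) y))
    core y with to (π X) y
    ... | inj₁ t = cong inj₁ (sym (e₄-inj (proj₂ (g₃₄ (proj₁ t)))))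
    ... | inj₂ i = refl

    free : ∀ a (r : Sub (λ a → not (isS a))) → proj₁ r ≡ a → inj₁ (inj₂ r) ≡ ⊎map (app g) (inj₁ {B = Fin 0}) (to (π C) (inj₁ a))
    free a (.a , t) refl = passing _ refl
      where
      passing : ∀ w → to (π C) (inj₁ a) ≡ w → inj₁ (inj₂ (a , t)) ≡ ⊎map (app g) (inj₁ {B = Fin 0}) (to (π C) (inj₁ a))
      passing (inj₁ b) eq = trans (cong inj₁ (sym (e₄-inj (trans (proj₂ (g₃₄ b)) (sym (to⇒from (π C) eq))))))
                                  (cong (⊎map (app g) inj₁) (sym eq))
      passing (inj₂ i) eq = ⊥-elim (subst (λ z → T (not (isInj₂ z))) eq t)

  strip : HIso f g C (X ⊛ wiring {R} idᵇ)
  strip = record { vi = symᵛ unitʳᵛ ; comm = λ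
    { (inj₁ a) → input a (from (Sub-join isS) a) (to-from (Sub-join isS) a)
    ; (inj₂ o) → trans (core (inj₂ o)) (cong (⊎map (app g) inj₁) (sym (X-spec (inj₂ o)))) } }
    where
    input : ∀ a y → to (Sub-join isS) y ≡ a →
            to (π (X ⊛ wiring {R} idᵇ)) (inj₁ y) ≡ ⊎map (app g) inj₁ (to (π C) (inj₁ a))
    input a (inj₁ s) q = trans (core (inj₁ s))
      (cong (⊎map (app g) inj₁) (trans (sym (X-spec (inj₁ s))) (cong (λ x → to (π C) (inj₁ x)) q)))
    input a (inj₂ r) q = free a r q

-- Uniqueness of the factors of a composite

module Restrictᵛ {Λ₁ Λ₂ Λ₁′ Λ₂′} (θ : VIso (Λ₁ ⊕ Λ₂) (Λ₁′ ⊕ Λ₂′))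
                 (l : ∀ v → Σ _ λ v′ → to (fV θ) (inj₁ v) ≡ inj₁ v′)
                 (r : ∀ v → Σ _ λ v′ → to (fV θ) (inj₂ v) ≡ inj₂ v′) where
  -- A port follows its vertex by `at-comm`, so the hypothesis on vertices also decides the side of
  -- each port.
  lH : ∀ d h → Σ _ λ h′ → to (fH θ d) (inj₁ h) ≡ inj₁ h′
  lH d h with to (fH θ d) (inj₁ h) in eq
  ... | inj₁ h′ = h′ , refl
  ... | inj₂ h′ = ⊥-elim (inj₁≢inj₂ (trans (sym (proj₂ (l (at d Λ₁ h))))
                    (trans (sym (at-comm θ d (inj₁ h))) (cong (at d (Λ₁′ ⊕ Λ₂′)) eq))))

  rH : ∀ d h → Σ _ λ h′ → to (fH θ d) (inj₂ h) ≡ inj₂ h′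
  rH d h with to (fH θ d) (inj₂ h) in eq
  ... | inj₂ h′ = h′ , refl
  ... | inj₁ h′ = ⊥-elim (inj₁≢inj₂ (trans (cong (at d (Λ₁′ ⊕ Λ₂′)) (sym eq))
                    (trans (at-comm θ d (inj₂ h)) (proj₂ (r (at d Λ₂ h))))))

  left : VIso Λ₁ Λ₁′
  left = record
    { fV = restrictˡ (fV θ) l r ; fH = λ d → restrictˡ (fH θ d) (lH d) (rH d)
    ; loop-comm = λ v → trans (cong (loop (Λ₁′ ⊕ Λ₂′)) (sym (proj₂ (l v)))) (loop-comm θ (inj₁ v))
    ; at-comm = λ d h → inj₁-injective (trans (cong (at d (Λ₁′ ⊕ Λ₂′)) (sym (proj₂ (lH d h)))) (trans (at-comm θ d (inj₁ h)) (proj₂ (l _))))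
    ; mono = λ d x y p x<y → subst₂ (λ a b → rank d (Λ₁′ ⊕ Λ₂′) a < rank d (Λ₁′ ⊕ Λ₂′) b) (proj₂ (lH d x)) (proj₂ (lH d y))
                               (mono θ d (inj₁ x) (inj₁ y) (cong inj₁ p) x<y) }

  right : VIso Λ₂ Λ₂′
  right = record
    { fV = restrictʳ (fV θ) l r ; fH = λ d → restrictʳ (fH θ d) (lH d) (rH d)
    ; loop-comm = λ v → trans (cong (loop (Λ₁′ ⊕ Λ₂′)) (sym (proj₂ (r v)))) (loop-comm θ (inj₂ v))
    ; at-comm = λ d h → inj₂-injective (trans (cong (at d (Λ₁′ ⊕ Λ₂′)) (sym (proj₂ (rH d h)))) (trans (at-comm θ d (inj₂ h)) (proj₂ (r _))))
    ; mono = λ d x y p x<y → subst₂ (λ a b → rank d (Λ₁′ ⊕ Λ₂′) a < rank d (Λ₁′ ⊕ Λ₂′) b) (proj₂ (rH d x)) (proj₂ (rH d y))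
                               (mono θ d (inj₂ x) (inj₂ y) (cong inj₂ p) x<y) }

  left-H : ∀ d h → to (fH θ d) (inj₁ h) ≡ inj₁ (to (fH left d) h)
  left-H d h = proj₂ (lH d h)

  right-H : ∀ d h → to (fH θ d) (inj₂ h) ≡ inj₂ (to (fH right d) h)
  right-H d h = proj₂ (rH d h)

push-injective : {B I₁ I₂ : Set} {x y : B ⊎ I₂} → ⊎map₂ (inj₂ {A = I₁}) x ≡ ⊎map₂ inj₂ y → x ≡ y
push-injective {x = inj₁ _} {inj₁ ._} refl = refl
push-injective {x = inj₂ _} {inj₂ ._} refl = refl

push≢ : {X I₁ I₂ : Set} {i : I₁} (y : X ⊎ I₂) → ¬ (⊎map₂ inj₂ y ≡ inj₂ (inj₁ i))
push≢ (inj₁ _) ()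
push≢ (inj₂ _) ()

-- The vertices of the first factor determine both factors, up to a bijection of the middle interface.
module Cancel {A M M′ B} {C₁ : CG A M} {C₂ : CG M B} {C₁′ : CG A M′} {C₂′ : CG M′ B}
              (θ : C₂ ⊚ C₁ ≈ C₂′ ⊚ C₁′)
              (l : ∀ v → Σ _ λ v′ → to (fV (vi θ)) (inj₁ v) ≡ inj₁ v′)
              (r : ∀ v → Σ _ λ v′ → to (fV (vi θ)) (inj₂ v) ≡ inj₂ v′) where
  open Restrictᵛ (vi θ) l r
  private
    fO₁ = to (fH left out)
    fI₁ = to (fH left inn)
    fI₂ = to (fH right inn)
    fO₂ = to (fH right out)
    P₂ = to (π C₂)
    P₂′ = to (π C₂′)

    -- `F` sends the target of a wire of `C₁` to the target of the corresponding wire of `C₁′`. In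
    -- the composites, a wire ending at a port of the first factor is distinguished from one that
    -- goes on into the second (`push≢`), so `F` respects the two summands and yields `middle`.
    F : (⟦ M ⟧ ⊎ I C₁) ↔ (⟦ M′ ⟧ ⊎ I C₁′)
    F = ↔-sym (π C₁) ⨟ (↔-refl ⊎-↔ fH left out) ⨟ π C₁′

    Fto : ∀ (z : ⟦ A ⟧ ⊎ O C₁) → ⊎map id fO₁ z ≡ to (↔-refl ⊎-↔ fH left out) z
    Fto (inj₁ _) = refl
    Fto (inj₂ _) = refl

    outer : ∀ z → after P₂′ (to (π C₁′) (⊎map id fO₁ z)) ≡ ⊎map id (to (fH (vi θ) inn)) (after P₂ (to (π C₁) z))
    outer (inj₁ a) = comm θ (inj₁ a)
    outer (inj₂ o) = trans (cong (to (π (C₂′ ⊚ C₁′))) (cong inj₂ (sym (left-H out o)))) (comm θ (inj₂ (inj₁ o)))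

    outerF : ∀ y → after P₂′ (to F y) ≡ ⊎map id (to (fH (vi θ) inn)) (after P₂ y)
    outerF y = trans (cong (λ z → after P₂′ (to (π C₁′) z)) (sym (Fto (from (π C₁) y))))
      (trans (outer (from (π C₁) y)) (cong (λ w → ⊎map id (to (fH (vi θ) inn)) (after P₂ w)) (to-from (π C₁) y)))

    push-θ : ∀ (y : ⟦ B ⟧ ⊎ I C₂) → ⊎map id (to (fH (vi θ) inn)) (⊎map₂ inj₂ y) ≡ ⊎map₂ inj₂ (⊎map id fI₂ y)
    push-θ (inj₁ b) = refl
    push-θ (inj₂ i) = cong inj₂ (right-H inn i)

    F-I : ∀ i → to F (inj₂ i) ≡ inj₂ (fI₁ i)
    F-I i with to F (inj₂ i) | outerF (inj₂ i)
    ... | inj₂ i′ | q = cong inj₂ (inj₁-injective (trans (inj₂-injective q) (left-H inn i)))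
    ... | inj₁ m  | q = ⊥-elim (push≢ (P₂′ (inj₁ m)) (trans q (cong inj₂ (left-H inn i))))

    F-M : ∀ m → Σ _ λ m′ → to F (inj₁ m) ≡ inj₁ m′
    F-M m with to F (inj₁ m) | outerF (inj₁ m)
    ... | inj₁ m′ | q = m′ , refl
    ... | inj₂ i  | q = ⊥-elim (push≢ (⊎map id fI₂ (P₂ (inj₁ m))) (trans (sym (push-θ (P₂ (inj₁ m)))) (sym q)))

  middle : Bij M M′
  middle = prim (restrictˡ F F-M (λ i → _ , F-I i))

  private
    F-M′ : ∀ m → to F (inj₁ m) ≡ inj₁ (app middle m)
    F-M′ = restrictˡ-spec F F-M (λ i → _ , F-I i)

    F-all : ∀ y → to F y ≡ ⊎map (app middle) fI₁ y
    F-all (inj₁ m) = F-M′ m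
    F-all (inj₂ i) = F-I i

  first-iso : HIso idᵇ middle C₁ C₁′
  first-iso = record { vi = left ; comm = λ z → trans (cong (to (π C₁′)) (Fto z))
    (trans (cong (λ w → to (π C₁′) (to (↔-refl ⊎-↔ fH left out) w)) (sym (from-to (π C₁) z))) (F-all (to (π C₁) z))) }

  second-iso : HIso middle idᵇ C₂ C₂′
  second-iso = record { vi = right ; comm = λ
    { (inj₁ m) → push-injective (trans (cong (after P₂′) (sym (F-M′ m))) (trans (outerF (inj₁ m)) (push-θ (P₂ (inj₁ m)))))
    ; (inj₂ o) → push-injective (trans (cong (to (π (C₂′ ⊚ C₁′))) (cong inj₂ (sym (right-H out o))))
                   (trans (comm θ (inj₂ (inj₂ o))) (push-θ (P₂ (inj₂ o))))) } }

mid-inj₁ : {B I B′ I′ : Set} (y : B ⊎ I) → to (⊎-mid4 {B} {I} {B′} {I′}) (inj₁ y) ≡ ⊎map inj₁ inj₁ y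
mid-inj₁ (inj₁ _) = refl
mid-inj₁ (inj₂ _) = refl

-- In X ⊛ wiring, the passing wires are exactly the input-output edges as soon as X has none.
module OneBlock {S T R S′ T′ R′} {X : CG S T} {X′ : CG S′ T′} (io : IO-free X) (io′ : IO-free X′)
                {f : Bij (S ⊎ᶠ R) (S′ ⊎ᶠ R′)} {m : Bij (T ⊎ᶠ R) (T′ ⊎ᶠ R′)}
                (θ : HIso f m (X ⊛ wiring {R} idᵇ) (X′ ⊛ wiring {R′} idᵇ)) where
  private
    l : ∀ v → Σ _ λ v′ → to (fV (vi θ)) (inj₁ v) ≡ inj₁ v′
    l v with to (fV (vi θ)) (inj₁ v)
    ... | inj₁ v′ = v′ , refl
    ... | inj₂ ()
    r′ : ∀ (v : Fin 0) → Σ _ λ v′ → to (fV (vi θ)) (inj₂ v) ≡ inj₂ v′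
    r′ ()
  open Restrictᵛ (vi θ) l r′
  private
    fO = to (fH left out)
    fI = to (fH left inn)
    θI = to (fH (vi θ) inn)
    P  = to (π X)
    P′ = to (π X′)

    -- The image of an idle strand joins an input to an output and meets no port. By `io′` it cannot
    -- start at an input of `X′`, so it is idle as well.
    passes : ∀ y → Σ _ λ y′ → app f (inj₂ y) ≡ inj₂ y′ × app m (inj₂ y) ≡ inj₂ y′
    passes y with app f (inj₂ y) | comm θ (inj₁ (inj₂ y))
    ... | inj₂ y′ | q = y′ , refl , sym (inj₁-injective q)
    ... | inj₁ s  | q with P′ (inj₁ s) in eq
    ... | inj₁ b = ⊥-elim (io′ s b eq)
    passes y | inj₁ s | () | inj₂ i

    enters : ∀ s → Σ _ λ s′ → app f (inj₁ s) ≡ inj₁ s′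
    enters s with app f (inj₁ s) | comm θ (inj₁ (inj₁ s))
    ... | inj₁ s′ | q = s′ , refl
    ... | inj₂ y  | q with P (inj₁ s) in eq
    ... | inj₁ b = ⊥-elim (io s b eq)
    enters s | inj₂ y | () | inj₂ i

    -- An output of `X` comes from a port, since `X` has no input-output edge; the isomorphism is
    -- evaluated on the wire from that port.
    leaves : ∀ t → Σ _ λ t′ → app m (inj₁ t) ≡ inj₁ t′
    leaves t with from (π X) (inj₁ t) in eq
    ... | inj₁ s = ⊥-elim (io s t (from⇒to (π X) eq))
    ... | inj₂ o with trans (cong (to (π (X′ ⊛ wiring {R′} idᵇ))) (cong inj₂ (sym (left-H out o))))
                        (trans (comm θ (inj₂ (inj₁ o))) (cong (λ y → ⊎map (app m) θI (to ⊎-mid4 (inj₁ y))) (from⇒to (π X) eq)))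
    ... | q with P′ (inj₂ (fO o))
    ... | inj₁ t′ = t′ , sym (inj₁-injective q)
    leaves t | inj₂ o | () | inj₂ i

  s : Bij S S′
  s = prim (restrictˡ ⟪ f ⟫ enters (λ y → _ , proj₁ (proj₂ (passes y))))

  t : Bij T T′
  t = prim (restrictˡ ⟪ m ⟫ leaves (λ y → _ , proj₂ (proj₂ (passes y))))

  r : Bij R R′
  r = prim (restrictʳ ⟪ f ⟫ enters (λ y → _ , proj₁ (proj₂ (passes y))))

  f-spec : f ≐ (s ⊎ᵇ r)
  f-spec (inj₁ x) = proj₂ (enters x)
  f-spec (inj₂ y) = proj₁ (proj₂ (passes y))

  m-spec : m ≐ (t ⊎ᵇ r)
  m-spec (inj₁ x) = proj₂ (leaves x)
  m-spec (inj₂ y) = proj₂ (proj₂ (passes y))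

  private
    emb-inj : {B I B′ I′ : Set} (x y : B ⊎ I) → ⊎map (inj₁ {B = B′}) (inj₁ {B = I′}) x ≡ ⊎map inj₁ inj₁ y → x ≡ y
    emb-inj (inj₁ x) (inj₁ .x) refl = refl
    emb-inj (inj₂ x) (inj₂ .x) refl = refl

    rhs : ∀ y → ⊎map (app m) θI (to ⊎-mid4 (inj₁ y)) ≡ ⊎map inj₁ inj₁ (⊎map (app t) fI y)
    rhs (inj₁ t) = cong inj₁ (proj₂ (leaves t))
    rhs (inj₂ i) = cong inj₂ (left-H inn i)

    lhs : ∀ z → to ⊎-mid4 (⊎map (app f) (to (fH (vi θ) out)) (⊎map inj₁ inj₁ z)) ≡ inj₁ (⊎map (app s) fO z)
    lhs (inj₁ a) = cong (λ w → to ⊎-mid4 (inj₁ w)) (proj₂ (enters a))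
    lhs (inj₂ o) = cong (λ w → to ⊎-mid4 (inj₂ w)) (left-H out o)

    mid4-emb : ∀ (z : ⟦ S ⟧ ⊎ O X) → to (⊎-mid4 {D = Fin 0}) (⊎map (inj₁ {B = ⟦ R ⟧}) inj₁ z) ≡ inj₁ {B = ⟦ R ⟧ ⊎ Fin 0} z
    mid4-emb (inj₁ _) = refl
    mid4-emb (inj₂ _) = refl

  block-iso : HIso s t X X′
  block-iso = record { vi = left ; comm = λ z → emb-inj _ _
    (trans (sym (mid-inj₁ (P′ (⊎map (app s) fO z))))
    (trans (cong (λ w → to ⊎-mid4 (⊎map P′ (to (π (wiring {R′} idᵇ))) w)) (sym (lhs z)))
    (trans (comm θ (⊎map inj₁ inj₁ z))
    (trans (cong (λ w → ⊎map (app m) θI (to ⊎-mid4 (⊎map P (to (π (wiring {R} idᵇ))) w))) (mid4-emb z))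
           (rhs (P z)))))) }

-- Atomic blocks

record Atomic {S T} (X : CG S T) : Set where
  field
    io-free : IO-free X
    vertex  : ⟦ V (vs X) ⟧
    -- Strong connectedness: the ancestors of a vertex, itself included, form a closed nonempty set.
    -- Loops are among the vertices here, so a single loop is atomic and no other block contains
    -- one.
    whole   : ∀ D → Closed X D → (∀ v → D v ≡ false) ⊎ (∀ v → D v ≡ true)
open Atomic public

Closed-resp : ∀ {A B A′ B′} {f : Bij A A′} {g : Bij B B′} {C : CG A B} {C′ : CG A′ B′} (θ : HIso f g C C′) →
              ∀ D → Closed C′ D → Closed C (λ v → D (to (fV (vi θ)) v))
Closed-resp {C = C} {C′} θ D c o i eq t = subst (λ v → T (D v)) (at-comm (vi θ) out o)
  (c _ _ (trans (comm θ (inj₂ o)) (cong (⊎map _ _) eq)) (subst (λ v → T (D v)) (sym (at-comm (vi θ) inn i)) t))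

Atomic-resp : ∀ {S T S′ T′} {s : Bij S S′} {t : Bij T T′} {X : CG S T} {X′ : CG S′ T′} → HIso s t X X′ →
              IO-free X → Atomic X′ → Atomic X
Atomic-resp {X = X} θ io a = record
  { io-free = io
  ; vertex = from (fV (vi θ)) (vertex a)
  ; whole = λ D c → transport D (whole a _ (Closed-resp (symʰ θ) D c)) }
  where
  transport : ∀ D → (∀ v → D (from (fV (vi θ)) v) ≡ false) ⊎ (∀ v → D (from (fV (vi θ)) v) ≡ true) →
              (∀ v → D v ≡ false) ⊎ (∀ v → D v ≡ true)
  transport D (inj₁ p) = inj₁ (λ v → trans (cong D (sym (from-to (fV (vi θ)) v))) (p _))
  transport D (inj₂ p) = inj₂ (λ v → trans (cong D (sym (from-to (fV (vi θ)) v))) (p _))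

isInj₁-true : {X Y : Set} {x : X ⊎ Y} → isInj₁ x ≡ true → Σ X λ a → x ≡ inj₁ a
isInj₁-true {x = inj₁ a} _ = a , refl

isInj₁-false : {X Y : Set} {x : X ⊎ Y} → isInj₁ x ≡ false → Σ Y λ b → x ≡ inj₂ b
isInj₁-false {x = inj₂ b} _ = b , refl

-- A wire that starts at a port of the second factor never meets the interface and hence no port of
-- the first.
Closed-first : ∀ {A B M} (C₁ : CG A M) (C₂ : CG M B) → Closed (C₂ ⊚ C₁) isInj₁
Closed-first C₁ C₂ (inj₁ o) i eq t = tt
Closed-first C₁ C₂ (inj₂ o) (inj₁ i) eq t = ⊥-elim (push≢ (to (π C₂) (inj₂ o)) eq)

Closed-second : ∀ {A B M} (C₁ : CG A M) (C₂ : CG M B) D → Closed (C₂ ⊚ C₁) D → Closed C₂ (λ v → D (inj₂ v))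
Closed-second C₁ C₂ D c o i eq = c (inj₂ o) (inj₂ i) (cong (⊎map₂ inj₂) eq)

module 𝒢 = SMC-Properties CG-SMC
open 𝒢 public using () renaming (layer to layerᴳ)

inLayer : ∀ {A S T R} {X : CG S T} {f : Bij A (S ⊎ᶠ R)} → ⟦ V (vs X) ⟧ → ⟦ V (vs (layerᴳ X R f)) ⟧
inLayer x = inj₂ (inj₁ x)

layer-vertex : ∀ {A S T R} {X : CG S T} {f : Bij A (S ⊎ᶠ R)} (v : ⟦ V (vs (layerᴳ X R f)) ⟧) →
               Σ _ λ x → v ≡ inLayer {A} {S} {T} {R} {X} {f} x
layer-vertex (inj₂ (inj₁ x)) = x , refl
layer-vertex (inj₂ (inj₂ ()))
layer-vertex (inj₁ ())

Closed-layer : ∀ {A S T R B} (X : CG S T) (f : Bij A (S ⊎ᶠ R)) (C : CG (T ⊎ᶠ R) B) D → Closed (C ⊚ layerᴳ X R f) D →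
               Closed X (λ x → D (inj₁ (inj₂ (inj₁ x))))
Closed-layer X f C D c o i eq = c (inj₁ (inj₂ (inj₁ o))) (inj₁ (inj₂ (inj₁ i)))
  (cong (λ y → after (to (π C)) (⊎map₂ inj₂ (to ⊎-mid4 (inj₁ y)))) eq)

wiring-injective : ∀ {A B} {f g : Bij A B} → wiring f ≈ wiring g → f ≐ g
wiring-injective θ a = sym (inj₁-injective (comm θ (inj₁ a)))

-- Two consecutive layers without a common wire

module Refine {T₀ R S R₁} (k : Bij (T₀ ⊎ᶠ R) (S ⊎ᶠ R₁)) (disjoint : ∀ t → Σ _ λ y → app k (inj₁ t) ≡ inj₂ y) where
  private
    keep : ⟦ R ⟧ → Bool
    keep ρ = isInj₂ (app k (inj₂ ρ))

  -- The strands that bypass both blocks.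
  R₄ : FSet
  R₄ = Subᶠ R keep

  private
    e : ⟦ S ⟧ ⊎ Sub keep → ⟦ S ⟧ ⊎ ⟦ R₁ ⟧
    e (inj₁ s) = inj₁ s
    e (inj₂ (ρ , _)) = app k (inj₂ ρ)
    e′ : ⟦ T₀ ⟧ ⊎ Sub keep → ⟦ S ⟧ ⊎ ⟦ R₁ ⟧
    e′ y = app k (⊎map₂ proj₁ y)

    map₂-inj : ∀ {x y : ⟦ T₀ ⟧ ⊎ Sub keep} → ⊎map₂ proj₁ x ≡ ⊎map₂ proj₁ y → x ≡ y
    map₂-inj {inj₁ a} {inj₁ .a} refl = refl
    map₂-inj {inj₂ x} {inj₂ y} q = cong inj₂ (Sub-≡ keep (inj₂-injective q))

    e-inj : ∀ {x y} → e x ≡ e y → x ≡ y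
    e-inj {inj₁ s} {inj₁ s′} q = cong inj₁ (inj₁-injective q)
    e-inj {inj₂ x} {inj₂ y} q = cong inj₂ (Sub-≡ keep (inj₂-injective (to-injective ⟪ k ⟫ q)))
    e-inj {inj₁ s} {inj₂ (ρ , t)} q = ⊥-elim (subst (λ z → T (isInj₂ z)) (sym q) t)
    e-inj {inj₂ (ρ , t)} {inj₁ s} q = ⊥-elim (subst (λ z → T (isInj₂ z)) q t)

    e′-inj : ∀ {x y} → e′ x ≡ e′ y → x ≡ y
    e′-inj q = map₂-inj (to-injective ⟪ k ⟫ q)

    toR : ∀ ρ → Σ _ λ y → e y ≡ app k (inj₂ ρ)
    toR ρ with app k (inj₂ ρ) in eq
    ... | inj₁ s = inj₁ s , refl
    ... | inj₂ y = inj₂ (ρ , subst (λ z → T (isInj₂ z)) (sym eq) tt) , eq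

    -- An input of the second block is not an output of the first, by `disjoint`, so it was an idle
    -- strand of the first layer.
    ofR : ∀ y → Σ _ λ ρ → app k (inj₂ ρ) ≡ e y
    ofR (inj₁ s) with from ⟪ k ⟫ (inj₁ s) in eq
    ... | inj₁ t = ⊥-elim (inj₁≢inj₂ (trans (sym (from⇒to ⟪ k ⟫ eq)) (proj₂ (disjoint t))))
    ... | inj₂ ρ = ρ , from⇒to ⟪ k ⟫ eq
    ofR (inj₂ (ρ , t)) = ρ , refl

    toR₁ : ∀ (y : ⟦ R₁ ⟧) → Σ _ λ z → e′ z ≡ inj₂ y
    toR₁ y with from ⟪ k ⟫ (inj₂ y) in eq
    ... | inj₁ t = inj₁ t , from⇒to ⟪ k ⟫ eq
    ... | inj₂ ρ = inj₂ (ρ , subst (λ z → T (isInj₂ z)) (sym (from⇒to ⟪ k ⟫ eq)) tt) , from⇒to ⟪ k ⟫ eq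

    ofR₁ : ∀ z → Σ ⟦ R₁ ⟧ λ y → inj₂ y ≡ e′ z
    ofR₁ (inj₁ t) = proj₁ (disjoint t) , sym (proj₂ (disjoint t))
    ofR₁ (inj₂ (ρ , t)) with app k (inj₂ ρ)
    ... | inj₂ y = y , refl

  r : Bij R (S ⊎ᶠ R₄)
  r = prim (match (λ ρ → app k (inj₂ ρ)) e (λ q → inj₂-injective (to-injective ⟪ k ⟫ q)) e-inj toR ofR)

  r₁ : Bij R₁ (T₀ ⊎ᶠ R₄)
  r₁ = prim (match inj₂ e′ inj₂-injective e′-inj toR₁ ofR₁)

  k-sh : ((idᵇ ⊎ᵇ r) ⨾ shᵇ) ≐ (k ⨾ (idᵇ ⊎ᵇ r₁))
  k-sh (inj₁ t) = trans (cong inj₂ (sym (e′-inj (trans (proj₂ (toR₁ (proj₁ (disjoint t)))) (sym (proj₂ (disjoint t)))))))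
                        (cong (app (idᵇ {S} ⊎ᵇ r₁)) (sym (proj₂ (disjoint t))))
  k-sh (inj₂ ρ) with toR ρ
  ... | inj₁ s , q = cong (app (idᵇ {S} ⊎ᵇ r₁)) q
  ... | inj₂ (ρ′ , t) , q with ofR₁ (inj₂ (ρ′ , t))
  ... | y , q′ = trans (cong inj₂ (sym (e′-inj (trans (proj₂ (toR₁ y)) q′)))) (cong (app (idᵇ {S} ⊎ᵇ r₁)) (trans q′ q))

-- The exchange argument is carried out for an arbitrary instance, so that the construction of `R₄`
-- never unfolds in it.
record Refined {T R S R₁} (k : Bij (T ⊎ᶠ R) (S ⊎ᶠ R₁)) : Set₁ where
  field
    R₄   : FSet
    r    : Bij R (S ⊎ᶠ R₄)
    r₁   : Bij R₁ (T ⊎ᶠ R₄)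
    k-sh : ((idᵇ ⊎ᵇ r) ⨾ shᵇ) ≐ (k ⨾ (idᵇ ⊎ᵇ r₁))

refine : ∀ {T R S R₁} (k : Bij (T ⊎ᶠ R) (S ⊎ᶠ R₁)) → (∀ t → Σ _ λ y → app k (inj₁ t) ≡ inj₂ y) → Refined k
refine k disjoint = record { Refine k disjoint }

-- Atomicity of `X` is not part of the data: in the application it is transported from a known block
-- with the same vertices.
record Peeled {A B} (C : CG A B) (D : ⟦ V (vs C) ⟧ → Bool) : Set₁ where
  field
    {S T₁ R} : FSet
    X    : CG S T₁
    free : IO-free X
    k    : Bij A (S ⊎ᶠ R)
    rest : CG (T₁ ⊎ᶠ R) B
    σ    : rest ⊚ layerᴳ X R k ≈ C
    σ-X    : ∀ v → D (to (fV (vi σ)) (inj₁ (inj₂ (inj₁ v)))) ≡ true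
    σ-rest : ∀ v → D (to (fV (vi σ)) (inj₂ v)) ≡ false
    enters : ∀ a s → app k a ≡ inj₁ s → Σ _ λ i → to (π C) (inj₁ a) ≡ inj₂ i × D (at inn (vs C) i) ≡ true

-- `C` is split along `D`, and the input-output edges of the first factor become the idle strands
-- `R`. The renaming `g` of its outputs is undone in front of the second factor.
peel : ∀ {A B} (C : CG A B) D → Closed C D → Peeled C D
peel C D closed = record
  { X = X ; free = X-IO-free ; k = f ; rest = second ⊚ wiring (symᵇ g)
  ; σ = ≈-trans (⊚-assoc second (wiring (symᵇ g)) (layerᴳ X R f))
          (≈-trans (⊚-cong {D = second} ≈-refl (≈-trans (⊚-cong {D = wiring (symᵇ g)} ≈-refl (≈-sym (square strip))) (𝒢.J-cancelˡ g first))) split)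
  ; σ-X = λ v → T-true (proj₂ v)
  ; σ-rest = λ { (inj₁ ()) ; (inj₂ v) → T-false (proj₂ v) }
  ; enters = λ a s q → let (i , q′) = enters a s q in
      proj₁ i , trans (comm split (inj₁ a)) (cong (λ y → ⊎map id _ (after (to (π second)) y)) q′) , T-true (proj₂ i) }
  where open Split C D closed
        open Strip first

infixr 4 _×ᶜ_
_×ᶜ_ : ∀ {o e o′ e′} → SMC o e → SMC o′ e′ → SMC (o ⊔ o′) (e ⊔ e′)
𝒞 ×ᶜ 𝒟 = record
  { Hom = λ A B → C.Hom A B × D.Hom A B ; _≋_ = λ p q → (proj₁ p C.≋ proj₁ q) × (proj₂ p D.≋ proj₂ q)
  ; ≋-refl = C.≋-refl , D.≋-refl ; ≋-sym = λ s → C.≋-sym (proj₁ s) , D.≋-sym (proj₂ s)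
  ; ≋-trans = λ s t → C.≋-trans (proj₁ s) (proj₁ t) , D.≋-trans (proj₂ s) (proj₂ t)
  ; _∘_ = λ p q → proj₁ p C.∘ proj₁ q , proj₂ p D.∘ proj₂ q ; _⊗_ = λ p q → proj₁ p C.⊗ proj₁ q , proj₂ p D.⊗ proj₂ q
  ; J = λ f → C.J f , D.J f
  ; ∘-cong = λ s t → C.∘-cong (proj₁ s) (proj₁ t) , D.∘-cong (proj₂ s) (proj₂ t)
  ; ⊗-cong = λ s t → C.⊗-cong (proj₁ s) (proj₁ t) , D.⊗-cong (proj₂ s) (proj₂ t)
  ; J-cong = λ s → C.J-cong s , D.J-cong s
  ; ∘-assoc = λ p q r → C.∘-assoc _ _ _ , D.∘-assoc _ _ _
  ; idˡ = λ p → C.idˡ _ , D.idˡ _ ; idʳ = λ p → C.idʳ _ , D.idʳ _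
  ; interchange = λ p p′ q q′ → C.interchange _ _ _ _ , D.interchange _ _ _ _
  ; J-∘ = λ g f → C.J-∘ g f , D.J-∘ g f ; J-⊗ = λ f g → C.J-⊗ f g , D.J-⊗ f g
  ; α-nat = λ p q r → C.α-nat _ _ _ , D.α-nat _ _ _ ; γ-nat = λ p q → C.γ-nat _ _ , D.γ-nat _ _ ; ρ-nat = λ p → C.ρ-nat _ , D.ρ-nat _ }
  where module C = SMC 𝒞
        module D = SMC 𝒟

-- Decisions over finite sets

_≟ᶠ_ : ∀ {A : FSet} (x y : ⟦ A ⟧) → Dec (x ≡ y)
_≟ᶠ_ {A} x y = map′ (to-injective (enum A)) (cong (to (enum A))) (to (enum A) x ≟ᶠⁱⁿ to (enum A) y)

all? : (A : FSet) {P : ⟦ A ⟧ → Set} → (∀ a → Dec (P a)) → Dec (∀ a → P a)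
all? A {P} d = map′ (λ f a → subst P (from-to (enum A) a) (f (to (enum A) a))) (λ f i → f _) (allᶠⁱⁿ? (λ i → d (from (enum A) i)))

any? : (A : FSet) {P : ⟦ A ⟧ → Set} → (∀ a → Dec (P a)) → Dec (Σ ⟦ A ⟧ P)
any? A {P} d = map′ (λ { (i , p) → from (enum A) i , p })
  (λ { (a , p) → to (enum A) a , subst P (sym (from-to (enum A) a)) p }) (anyᶠⁱⁿ? (λ i → d (from (enum A) i)))

any≡? : (A : FSet) (D : ⟦ A ⟧ → Bool) (b : Bool) → Dec (Σ ⟦ A ⟧ λ a → D a ≡ b)
any≡? A D b = any? A (λ a → D a ≟ᵇ b)

Proper : ∀ {A B} (C : CG A B) → (⟦ V (vs C) ⟧ → Bool) → Set
Proper C D = Closed C D × Σ _ (λ v → D v ≡ true) × Σ _ (λ v → D v ≡ false)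

Closed-ext : ∀ {A B} (C : CG A B) {D D′} → (∀ v → D v ≡ D′ v) → Closed C D → Closed C D′
Closed-ext C s c o i eq t = subst T (s _) (c o i eq (subst T (sym (s _)) t))

-- Vertex sets are searched as Boolean vectors. An arbitrary predicate agrees pointwise with its
-- tabulation, and `Closed-ext` carries closedness over to it.
proper? : ∀ {A B} (C : CG A B) →
          (Σ _ (Proper C)) ⊎ (∀ D → Closed C D → (∀ v → D v ≡ false) ⊎ (∀ v → D v ≡ true))
proper? {A} {B} C = decide (anySubset? {P = λ s → Proper C (ofSubset s)} dec)
  where
  Vᶜ = V (vs C)
  ofSubset : Subset (card Vᶜ) → ⟦ Vᶜ ⟧ → Bool
  ofSubset s v = lookup s (to (enum Vᶜ) v)
  closed? : ∀ D → Dec (Closed C D)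
  closed? D = all? (H out (vs C)) λ o → all? (H inn (vs C)) λ i →
    ≡-dec (_≟ᶠ_ {B}) (_≟ᶠ_ {H inn (vs C)}) (to (π C) (inj₂ o)) (inj₂ i) →-dec (T? _ →-dec T? _)
  dec : ∀ s → Dec (Proper C (ofSubset s))
  dec s = closed? (ofSubset s) ×-dec (any≡? Vᶜ (ofSubset s) true ×-dec any≡? Vᶜ (ofSubset s) false)
  decide : Dec (Σ _ λ s → Proper C (ofSubset s)) → _
  decide (yes (s , p)) = inj₁ (ofSubset s , p)
  decide (no ¬p) = inj₂ λ D c → test D c (any≡? Vᶜ D true) (any≡? Vᶜ D false)
    where
    test : ∀ D → Closed C D → Dec (Σ _ λ v → D v ≡ true) → Dec (Σ _ λ v → D v ≡ false) →
           (∀ v → D v ≡ false) ⊎ (∀ v → D v ≡ true)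
    test D c (no ¬t) _ = inj₁ λ v → [ (λ t → ⊥-elim (¬t (v , t))) , id ]′ (dec-Bool (D v))
    test D c _ (no ¬f) = inj₂ λ v → [ id , (λ f → ⊥-elim (¬f (v , f))) ]′ (dec-Bool (D v))
    test D c (yes (v , t)) (yes (w , f)) = ⊥-elim (¬p (tabulate (λ i → D (from (enum Vᶜ) i)) ,
      Closed-ext C same c , (v , trans (sym (same v)) t) , (w , trans (sym (same w)) f)))
      where
      same : ∀ v → D v ≡ ofSubset (tabulate (λ i → D (from (enum Vᶜ) i))) v
      same v = sym (trans (lookup∘tabulate _ (to (enum Vᶜ) v)) (cong D (from-to (enum Vᶜ) v)))

no-vertices : ∀ {A B} (C : CG A B) → (⟦ V (vs C) ⟧ → ⊥) → Σ (Bij A B) λ f → C ≈ wiring f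
no-vertices {A} {B} C none = prim f , record
  { vi = record { fV = empty none ; fH = λ d → empty (λ h → none (at d (vs C) h))
                ; loop-comm = λ v → ⊥-elim (none v) ; at-comm = λ d h → ⊥-elim (none (at d (vs C) h))
                ; mono = λ d h → ⊥-elim (none (at d (vs C) h)) }
  ; comm = λ { (inj₁ a) → trans (cong inj₁ (inj₁-injective (trans (sym (restrictˡ-spec (π C) l r a)) (proj₂ (l a)))))
                            (cong (⊎map id _) (sym (proj₂ (l a))))
             ; (inj₂ o) → ⊥-elim (none (at out (vs C) o)) } }
  where
  empty : {W : Set} → (W → ⊥) → W ↔ Fin 0
  empty n = mk↔ₛ′ (λ w → ⊥-elim (n w)) (λ ()) (λ ()) (λ w → ⊥-elim (n w))
  l : ∀ a → Σ _ λ b → to (π C) (inj₁ a) ≡ inj₁ b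
  l a with to (π C) (inj₁ a)
  ... | inj₁ b = b , refl
  ... | inj₂ i = ⊥-elim (none (at inn (vs C) i))
  r : ∀ o → Σ _ λ i → to (π C) (inj₂ o) ≡ inj₂ i
  r o = ⊥-elim (none (at out (vs C) o))
  f : ⟦ A ⟧ ↔ ⟦ B ⟧
  f = restrictˡ (π C) l r

card>0 : (A : FSet) → ⟦ A ⟧ → 0 < card A
card>0 A a = ≤-<-trans z≤n (toℕ<n (to (enum A) a))

card-↔ : (A B : FSet) → ⟦ A ⟧ ↔ ⟦ B ⟧ → card A ≡ card B
card-↔ A B f = ↔⇒≡ (↔-sym (enum A) ⨟ f ⨟ enum B)

layer-iso : ∀ {A S T R S′ T′ R′} {X : CG S T} {X′ : CG S′ T′} {f : Bij A (S ⊎ᶠ R)} {f′ : Bij A (S′ ⊎ᶠ R′)}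
            {m : Bij (T ⊎ᶠ R) (T′ ⊎ᶠ R′)} → HIso idᵇ m (layerᴳ X R f) (layerᴳ X′ R′ f′) →
            HIso (symᵇ f ⨾ f′) m (X ⊛ wiring {R} idᵇ) (X′ ⊛ wiring {R′} idᵇ)
layer-iso {f = f} {f′} θ = reframe (λ _ → refl) (λ _ → refl)
  (transʰ (symʰ (relabelʳ _ f)) (transʰ θ (relabelʳ _ f′)))

-- Evaluation of sequences and independence of their order

module Evaluation {o e} (𝒫 : SMC o e)
  (φ : ∀ {S T} (X : CG S T) → Atomic X → SMC.Hom 𝒫 S T)
  (φ-nat : ∀ {S T S′ T′} {s : Bij S S′} {t : Bij T T′} {X : CG S T} {X′ : CG S′ T′} (a : Atomic X) (a′ : Atomic X′) →
           HIso s t X X′ → SMC._≋_ 𝒫 (SMC._∘_ 𝒫 (SMC.J 𝒫 t) (φ X a)) (SMC._∘_ 𝒫 (φ X′ a′) (SMC.J 𝒫 s)))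
  where
  open SMC 𝒫
  open SMC-Properties 𝒫

  Atom : FSet → FSet → Set₁
  Atom S T = Σ (CG S T) Atomic

  ι : ∀ {S T} → Atom S T → CG S T × Hom S T
  ι (X , a) = X , φ X a

  open Sequences (CG-SMC ×ᶜ 𝒫) Atom ι public

  -- By `OneBlock` such an isomorphism is an isomorphism of the blocks beside a bijection of the
  -- idle strands; `φ-nat` treats the former, and identities are natural for the latter.
  layer-unique : ∀ {A S T R S′ T′ R′} {X : CG S T} {X′ : CG S′ T′} {f : Bij A (S ⊎ᶠ R)} {f′ : Bij A (S′ ⊎ᶠ R′)}
                 {m : Bij (T ⊎ᶠ R) (T′ ⊎ᶠ R′)} (a : Atomic X) (a′ : Atomic X′) →
                 HIso idᵇ m (layerᴳ X R f) (layerᴳ X′ R′ f′) → J m ∘ layer (φ X a) R f ≋ layer (φ X′ a′) R′ f′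
  layer-unique {R = R} {R′ = R′} {X} {X′} {f} {f′} {m} a a′ θ = begin
    J m ∘ ((φ X a ⊗ idᴴ R) ∘ J f)                ≋⟨ assoc⁻ _ _ _ ⟩
    (J m ∘ (φ X a ⊗ idᴴ R)) ∘ J f                ≋⟨ ∘ˡ (∘ˡ (J-cong m-spec)) ⟩
    (J (t ⊎ᵇ r) ∘ (φ X a ⊗ idᴴ R)) ∘ J f         ≋⟨ ∘ˡ (⊗-square s t r r (φ-nat a a′ block-iso) (≋-trans (idʳ _) (≋-sym (idˡ _)))) ⟩
    ((φ X′ a′ ⊗ idᴴ R′) ∘ J (s ⊎ᵇ r)) ∘ J f      ≋⟨ J-mergeʳ _ _ _ ⟩
    (φ X′ a′ ⊗ idᴴ R′) ∘ J (f ⨾ (s ⊎ᵇ r))        ≋⟨ ∘ʳ (J-cong (λ x → trans (sym (f-spec (app f x))) (cong (app f′) (from-to ⟪ f ⟫ x)))) ⟩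
    (φ X′ a′ ⊗ idᴴ R′) ∘ J f′ ∎
    where open OneBlock (io-free a) (io-free a′) (layer-iso {f = f} {f′} θ)

  -- The value `p` can be computed with `x` first. The remaining graph `H` is prescribed; only its
  -- value `q` is to be found.
  Inverted : ∀ {A B S T} → Hom A B → Atom S T → (R : FSet) → Bij A (S ⊎ᶠ R) → CG (T ⊎ᶠ R) B → Set _
  Inverted p x R f H = Σ _ λ q → Seq (H , q) × p ≋ q ∘ layer (proj₂ (ι x)) R f

  -- The bijection `m` between the two middle interfaces is absorbed into the remainder.
  replace : ∀ {A B S T R S′ T′ R′} {H : CG (T ⊎ᶠ R) B} {q : Hom (T ⊎ᶠ R) B} {p : Hom A B} (x : Atom S T) (x′ : Atom S′ T′)
            (f : Bij A (S ⊎ᶠ R)) (f′ : Bij A (S′ ⊎ᶠ R′)) (H′ : CG (T′ ⊎ᶠ R′) B) (m : Bij (T ⊎ᶠ R) (T′ ⊎ᶠ R′)) →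
            HIso idᵇ m (layerᴳ (proj₁ x) R f) (layerᴳ (proj₁ x′) R′ f′) → HIso m idᵇ H H′ →
            Seq (H , q) → p ≋ q ∘ layer (proj₂ (ι x)) R f → Inverted p x′ R′ f′ H′
  replace {H = H} {q} {p} (X , a) (X′ , a′) f f′ H′ m θ₁ θ₂ d eq = q ∘ J (symᵇ m) ,
    Seq-resp (same , ≋-refl) (Seq-∘J d (symᵇ m)) , (begin
      p                                                   ≋⟨ eq ⟩
      q ∘ layer (φ X a) _ f                               ≋⟨ ∘ʳ (≋-sym (J-cancelˡ m _)) ⟩
      q ∘ (J (symᵇ m) ∘ (J m ∘ layer (φ X a) _ f))        ≋⟨ assoc⁻ _ _ _ ⟩
      (q ∘ J (symᵇ m)) ∘ (J m ∘ layer (φ X a) _ f)        ≋⟨ ∘ʳ (layer-unique a a′ θ₁) ⟩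
      (q ∘ J (symᵇ m)) ∘ layer (φ X′ a′) _ f′ ∎)
    where
    same : H ⊚ wiring (symᵇ m) ≈ H′
    same = ≈-trans (⊚-cong (≈-trans (≈-sym (⊚-idˡ H)) (square θ₂)) ≈-refl) (𝒢.J-cancelʳ m H′)

  module _ {A B S T R S′ T′ R′} (x : Atom S T) (x′ : Atom S′ T′) (f : Bij A (S ⊎ᶠ R)) (f′ : Bij A (S′ ⊎ᶠ R′))
           (H : CG (T ⊎ᶠ R) B) (H′ : CG (T′ ⊎ᶠ R′) B)
           (θ : H ⊚ layerᴳ (proj₁ x) R f ≈ H′ ⊚ layerᴳ (proj₁ x′) R′ f′) where
    private
      X = proj₁ x
      X′ = proj₁ x′
      θV = to (fV (vi θ))
      L = layerᴳ X R f
      L′ = layerᴳ X′ R′ f′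

      -- The vertices that `θ` sends into the block `X′`. They are closed because `X′` comes first
      -- on the other side, so the atomic block `X` lies among them entirely or not at all.
      D : ⟦ V (vs (H ⊚ L)) ⟧ → Bool
      D v = isInj₁ (θV v)
      D-closed : Closed (H ⊚ L) D
      D-closed = Closed-resp θ isInj₁ (Closed-first L′ H′)

      inX : ⟦ V (vs X) ⟧ → ⟦ V (vs (H ⊚ L)) ⟧
      inX v = inj₁ (inj₂ (inj₁ v))

    DX : ⟦ V (vs X) ⟧ → Bool
    DX v = D (inX v)

    DX-cases : (∀ v → DX v ≡ false) ⊎ (∀ v → DX v ≡ true)
    DX-cases = whole (proj₂ x) DX (Closed-layer X f H D D-closed)

    module SameBlock (all : ∀ v → DX v ≡ true) where
      private
        l : ∀ v → Σ _ λ v′ → θV (inj₁ v) ≡ inj₁ v′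
        l v with layer-vertex {X = X} {f = f} v
        ... | w , refl = isInj₁-true (all w)

        θ⁻ = from (fV (vi θ))
        -- `X` lies inside `X′`. Conversely the vertices of `X′` that come from `X` form a closed
        -- set, nonempty because `X` has a vertex, hence all of `X′`.
        E : ⟦ V (vs X′) ⟧ → Bool
        E v = isInj₁ (θ⁻ (inj₁ (inj₂ (inj₁ v))))
        E-all : ∀ v → E v ≡ true
        E-all with whole (proj₂ x′) E (Closed-layer X′ f′ H′ (λ v → isInj₁ (θ⁻ v)) (Closed-resp (symʰ θ) isInj₁ (Closed-first L H)))
        ... | inj₂ t = t
        ... | inj₁ n with l (inj₂ (inj₁ (vertex (proj₂ x))))
        ... | w , q with layer-vertex {X = X′} {f = f′} w
        ... | w′ , refl = ⊥-elim (true≢false (trans (cong isInj₁ (to⇒from (fV (vi θ)) q)) (n w′)))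

        r : ∀ v → Σ _ λ v′ → θV (inj₂ v) ≡ inj₂ v′
        r v with θV (inj₂ v) in q
        ... | inj₂ v′ = v′ , refl
        ... | inj₁ w with layer-vertex {X = X′} {f = f′} w
        ... | w′ , refl = ⊥-elim (true≢false (trans (sym (E-all w′)) (cong isInj₁ (sym (to⇒from (fV (vi θ)) q)))))
      open Cancel {C₁ = L} {H} {L′} {H′} θ l r public

    -- The second block does not meet the first one, hence lies in H: it is moved before the first block.
    DH : ⟦ V (vs H) ⟧ → Bool
    DH v = D (inj₂ v)

    DH-closed : Closed H DH
    DH-closed = Closed-second L H D D-closed

    module OtherBlock (none : ∀ v → DX v ≡ false) (𝒦 : Peeled H DH) where
      open Peeled 𝒦 public
        renaming (X to X₁; free to X₁-free; S to S₁; R to R₁; rest to H₃)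

      private
        source : ∀ t → Σ _ λ u → to (π X) (inj₂ u) ≡ inj₁ t
        source t with from (π X) (inj₁ t) in q
        ... | inj₁ s = ⊥-elim (io-free (proj₂ x) s t (from⇒to (π X) q))
        ... | inj₂ u = u , from⇒to (π X) q

      -- An output of `X` starts at a port of `X`. If it entered the peeled block, it would lead
      -- from a vertex outside `D` to one in `D`, against closedness.
      disjoint : ∀ t → Σ _ λ y → app k (inj₁ t) ≡ inj₂ y
      disjoint t with app k (inj₁ t) in q
      ... | inj₂ y = y , refl
      ... | inj₁ s with enters (inj₁ t) s q | source t
      ... | i , wireH , i∈ | u , q′ = ⊥-elim (true≢false (trans
              (sym (T-true (D-closed (inj₁ (inj₂ (inj₁ u))) (inj₂ i) wire (true-T i∈)))) (none (at out (vs X) u))))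
        where
        wire : to (π (H ⊚ L)) (inj₂ (inj₁ (inj₂ (inj₁ u)))) ≡ inj₂ (inj₂ i)
        wire = trans (cong (λ y → after (to (π H)) (⊎map₂ inj₂ (to ⊎-mid4 (inj₁ y)))) q′) (cong (⊎map₂ inj₂) wireH)
      module Moved (ℛ : Refined k) where
        open Refined ℛ
        open 𝒢.Exchange X X₁ f k r r₁ k-sh using (f₂; g₂; exchange)

        W : CG (T₁ ⊎ᶠ (S ⊎ᶠ R₄)) (T₁ ⊎ᶠ R₁)
        W = wiring g₂ ⊚ layerᴳ X (T₁ ⊎ᶠ R₄) shᵇ

        -- After the exchange the first layer carries exactly the vertices that `θ` sends into `L′`.
        -- `Cancel` therefore identifies it with `L′`, and `H₃ ⊚ W` with `H′`.
        Θ : (H₃ ⊚ W) ⊚ layerᴳ X₁ (S ⊎ᶠ R₄) f₂ ≈ H′ ⊚ L′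
        Θ = ≈-trans (⊚-assoc H₃ W (layerᴳ X₁ (S ⊎ᶠ R₄) f₂)) (≈-trans (⊚-cong ≈-refl (≈-sym exchange))
              (≈-trans (≈-sym (⊚-assoc H₃ (layerᴳ X₁ R₁ k) L)) (≈-trans (⊚-cong σ ≈-refl) θ)))

        private
          l : ∀ v → Σ _ λ v′ → to (fV (vi Θ)) (inj₁ v) ≡ inj₁ v′
          l v with layer-vertex {X = X₁} {f = f₂} v
          ... | w , refl = isInj₁-true (σ-X w)

          r′ : ∀ v → Σ _ λ v′ → to (fV (vi Θ)) (inj₂ v) ≡ inj₂ v′
          r′ (inj₁ (inj₁ v)) with layer-vertex {X = X} {f = shᵇ {S₁} {S} {R₄}} v
          ... | w , refl = isInj₁-false {x = θV (inX w)} (none w)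
          r′ (inj₁ (inj₂ ()))
          r′ (inj₂ v) = isInj₁-false (σ-rest v)
        open Cancel {C₁ = layerᴳ X₁ (S ⊎ᶠ R₄) f₂} {H₃ ⊚ W} {L′} {H′} Θ l r′ public

        -- `X₁` is the image of `X′` inside `H` and inherits its atomicity through `OneBlock`.
        x₁ : Atom S₁ T₁
        x₁ = X₁ , Atomic-resp (OneBlock.block-iso X₁-free (io-free (proj₂ x′)) (layer-iso {f = f₂} {f′} first-iso))
                    X₁-free (proj₂ x′)

        conclude : ∀ {q p} → Inverted q x₁ R₁ k H₃ → p ≋ q ∘ layer (proj₂ (ι x)) R f → Inverted p x′ R′ f′ H′
        conclude {q} {p} (q₃ , d , eq₃) eq = replace x₁ x′ f₂ f′ H′ middle first-iso second-iso
          (Seq-∘ d (Seq-∘ (Seq-J g₂) (step x _ shᵇ _ (Seq-J idᵇ) (≈-sym (⊚-idˡ _) , ≋-sym (idˡ _)))))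
          (begin
            p                                                       ≋⟨ eq ⟩
            q ∘ layer (proj₂ (ι x)) R f                             ≋⟨ ∘ˡ eq₃ ⟩
            (q₃ ∘ layer (proj₂ (ι x₁)) R₁ k) ∘ layer (proj₂ (ι x)) R f  ≋⟨ ∘-assoc _ _ _ ⟩
            q₃ ∘ (layer (proj₂ (ι x₁)) R₁ k ∘ layer (proj₂ (ι x)) R f)  ≋⟨ ∘ʳ (Exchange.exchange (proj₂ (ι x)) (proj₂ (ι x₁)) f k r r₁ k-sh) ⟩
            q₃ ∘ (_ ∘ layer (proj₂ (ι x₁)) _ f₂)                    ≋⟨ assoc⁻ _ _ _ ⟩
            (q₃ ∘ _) ∘ layer (proj₂ (ι x₁)) _ f₂ ∎)

    private
      OnH : ∀ {q} → Set _
      OnH {q} = ∀ {S₁ T₁} (x₁ : Atom S₁ T₁) R₁ (k : Bij (T ⊎ᶠ R) (S₁ ⊎ᶠ R₁)) H₃ →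
                H ≈ H₃ ⊚ layerᴳ (proj₁ x₁) R₁ k → Inverted q x₁ R₁ k H₃

      other : ∀ {q p} (none : ∀ v → DX v ≡ false) (𝒦 : Peeled H DH) → Refined (Peeled.k 𝒦) → OnH {q} →
              p ≋ q ∘ layer (proj₂ (ι x)) R f → Inverted p x′ R′ f′ H′
      other none 𝒦 ℛ rec = Moved.conclude ℛ (rec (Moved.x₁ ℛ) _ k H₃ (≈-sym σ))
        where open OtherBlock none 𝒦

    advance : ∀ {q p} → Seq (H , q) → OnH {q} → p ≋ q ∘ layer (proj₂ (ι x)) R f → Inverted p x′ R′ f′ H′
    advance d rec eq with DX-cases
    ... | inj₁ none = other none 𝒦 (refine (Peeled.k 𝒦) (OtherBlock.disjoint none 𝒦)) rec eq
      where 𝒦 = peel H DH DH-closed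
    ... | inj₂ all = replace x x′ f f′ H′ middle first-iso second-iso d eq
      where open SameBlock all

  -- Any atom that can come first in the graph of a sequence can be moved to its front.
  invert : ∀ {A B S T} {C : CG A B} {p} → Seq (C , p) → (x : Atom S T) (R : FSet) (f : Bij A (S ⊎ᶠ R)) (H : CG (T ⊎ᶠ R) B) →
           C ≈ H ⊚ layerᴳ (proj₁ x) R f → Inverted p x R f H
  -- A wiring has no vertices, whereas the atom `x` has one.
  invert (wires g t) x R f H eq with to (fV (vi (≈-trans (≈-sym eq) (proj₁ t)))) (inj₁ (inj₂ (inj₁ (vertex (proj₂ x)))))
  ... | ()
  invert (step x₀ R₀ f₀ (H₀ , q) d t) x R f H eq =
    -- The recursive call on the shorter sequence `d` is passed as a function, because the atom it
    -- is applied to is found only inside `advance`.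
    advance x₀ x f₀ f H₀ H (≈-trans (≈-sym (proj₁ t)) eq) d (λ x₁ → invert d x₁) (proj₂ t)

  Seq-unique : ∀ {A B} {C C′ : CG A B} {p p′} → Seq (C , p) → Seq (C′ , p′) → C ≈ C′ → p ≋ p′
  Seq-unique (wires f s) (wires g t) θ =
    ≋-trans (proj₂ s) (≋-trans (J-cong (wiring-injective (≈-trans (≈-sym (proj₁ s)) (≈-trans θ (proj₁ t))))) (≋-sym (proj₂ t)))
  Seq-unique (step x R f h d s) (wires g t) θ
    with to (fV (vi (≈-trans (≈-sym (proj₁ s)) (≈-trans θ (proj₁ t))))) (inj₁ (inj₂ (inj₁ (vertex (proj₂ x)))))
  ... | ()
  -- The first atom of the second sequence is moved to the front of the first one. Both remainders
  -- are then sequences for the same graph `H`, and the induction is on the second sequence.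
  Seq-unique c (step x R f (H , q) d t) θ with invert c x R f H (≈-trans θ (proj₁ t))
  ... | q′ , d′ , eq = ≋-trans eq (≋-trans (∘ˡ (Seq-unique d′ d ≈-refl)) (≋-sym (proj₂ t)))

  Seq-total : ∀ {A B} (C : CG A B) → Σ _ λ p → Seq (C , p)
  Seq-total C = go (suc (card (V (vs C)))) C ≤-refl
    where
    go : ∀ n {A B} (C : CG A B) → card (V (vs C)) < n → Σ _ λ p → Seq (C , p)
    go (suc n) C (s≤s small) with proper? C
    -- The witnesses `v` and `w` make both factors nonempty, so each has fewer vertices than `C`.
    ... | inj₁ (D , closed , (v , v∈) , (w , w∉)) = _ , Seq-resp (split , ≋-refl) (Seq-∘ (proj₂ rec₂) (proj₂ rec₁))
      where
      open Split C D closed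
      sum : card (V (vs first)) + card (V (vs second)) ≡ card (V (vs C))
      sum = card-↔ (V (vs first) ⊎ᶠ V (vs second)) (V (vs C)) (fV (vi split))
      rec₁ = go n first (≤-trans (subst₂ _<_ (+-identityʳ _) sum (+-monoʳ-< (card (V (vs first))) (card>0 (V (vs second)) (w , false-T w∉)))) small)
      rec₂ = go n second (≤-trans (subst (card (V (vs second)) <_) sum (+-monoˡ-≤ (card (V (vs second))) (card>0 (V (vs first)) (v , true-T v∈)))) small)
    ... | inj₂ whole with any? (V (vs C)) (λ _ → yes tt)
    ... | no none with no-vertices C (λ v → none (v , tt))
    ... | f , eq = J f , wires f (eq , ≋-refl)
    -- With a vertex and no proper closed set, `C` is one atom once its input-output edges are
    -- stripped; these become the idle strands of its layer.
    go (suc n) C (s≤s small) | inj₂ whole | yes (v , _) = _ , Seq-resp (≈-sym decomposition , ≋-refl)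
        (Seq-∘ (Seq-J (symᵇ g)) (Seq-∘J (Seq-⊗id (Seq-atom x) R) f))
      where
      open Strip C
      x : Atom S T′
      x = X , record { io-free = X-IO-free ; vertex = v
                     ; whole = λ D c → whole D (λ o i eq → c o i (X-internal o i eq)) }
      decomposition : C ≈ wiring (symᵇ g) ⊚ layerᴳ X R f
      decomposition = ≈-trans (≈-sym (𝒢.J-cancelˡ g C)) (⊚-cong ≈-refl (square strip))

-- The symmetric monoidal category underlying a ProP

module Underlying {c ℓ m ℓm} {R : CommutativeRing c ℓ} (P : ProP R m ℓm) where
  open ProP P hiding (_∘_; _*_)
  open ProP P using () renaming (_∘_ to infixr 10 _∙_; _*_ to infixl 15 _⋆_)

  ≋-refl : ∀ {k l} {p : Car k l} → p ≋ p
  ≋-refl {k} {l} = Module.≈ᴹ-refl (M k l)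
  ≋-sym : ∀ {k l} {p q : Car k l} → p ≋ q → q ≋ p
  ≋-sym {k} {l} = Module.≈ᴹ-sym (M k l)
  infixr 3 _▸_
  _▸_ : ∀ {k l} {p q r : Car k l} → p ≋ q → q ≋ r → p ≋ r
  _▸_ {k} {l} = Module.≈ᴹ-trans (M k l)

  private
    Jof : ∀ {k l} → k ≡ l → Fin k ↔ Fin l → Car k l
    Jof {k} refl f = f ▷ Iₙ k

  -- A bijection forces `k ≡ l`, after which it is a permutation and can act on the identity.
  -- Equality proofs between numbers are unique, so nothing depends on the one supplied by `↔⇒≡`.
  JN : ∀ {k l} → Fin k ↔ Fin l → Car k l
  JN f = Jof (↔⇒≡ f) f

  JN-perm : ∀ {k} (f : Permutation′ k) → JN f ≋ f ▷ Iₙ k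
  JN-perm f rewrite ≡-irrelevant (↔⇒≡ f) refl = ≋-refl

  JN-cong : ∀ {k l} {f g : Fin k ↔ Fin l} → (∀ i → to f i ≡ to g i) → JN f ≋ JN g
  JN-cong {f = f} = aux (↔⇒≡ f)
    where
    aux : ∀ {k l} → k ≡ l → {f g : Fin k ↔ Fin l} → (∀ i → to f i ≡ to g i) → JN f ≋ JN g
    aux refl {f} {g} s = JN-perm f ▸ ▷-cong s ≋-refl ▸ ≋-sym (JN-perm g)

  JN-id : ∀ {k} {f : Permutation′ k} → (∀ i → to f i ≡ i) → JN f ≋ Iₙ k
  JN-id {f = f} s = JN-perm f ▸ ▷-cong {σ′ = idₚ} s ≋-refl ▸ ▷-id _

  -- The axiom `◁▷-∘ᴾ`, applied to a composite of two identities, carries a permutation from the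
  -- left of an identity to its right.
  JN-permʳ : ∀ {k} (f : Permutation′ k) → JN f ≋ Iₙ k ◁ f
  JN-permʳ f = JN-perm f ▸ ≋-sym (∘-identityˡ _) ▸ ≋-sym (◁▷-∘ᴾ f _ _) ▸ ∘-identityʳ _

  ▷-JN : ∀ {k l} (f : Permutation′ l) (p : Car k l) → JN f ∙ p ≋ f ▷ p
  ▷-JN f p = ∘-cong (JN-perm f) ≋-refl ▸ ≋-sym (▷-∘ᴾ f _ p) ▸ ▷-cong (λ _ → refl) (∘-identityˡ p)

  ◁-JN : ∀ {k l} (f : Permutation′ k) (p : Car k l) → p ∙ JN f ≋ p ◁ f
  ◁-JN f p = ∘-cong ≋-refl (JN-permʳ f) ▸ ≋-sym (◁-∘ᴾ f p _) ▸ ◁-cong (λ _ → refl) (∘-identityʳ p)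

  JN-∘ : ∀ {k l n} (g : Fin l ↔ Fin n) (f : Fin k ↔ Fin l) (h : Fin k ↔ Fin n) → (∀ i → to h i ≡ to g (to f i)) →
         JN g ∙ JN f ≋ JN h
  JN-∘ g f h = aux (↔⇒≡ f) (↔⇒≡ g) g f h
    where
    aux : ∀ {k l n} → k ≡ l → l ≡ n → (g : Fin l ↔ Fin n) (f : Fin k ↔ Fin l) (h : Fin k ↔ Fin n) →
          (∀ i → to h i ≡ to g (to f i)) → JN g ∙ JN f ≋ JN h
    aux refl refl g f h s = ▷-JN g _ ▸ ▷-cong (λ _ → refl) (JN-perm f) ▸ ▷-∘ g f _ ▸
      ▷-cong {σ = f ∘ₚ g} (λ i → sym (s i)) ≋-refl ▸ ≋-sym (JN-perm h)

  Iₙ-⋆ : ∀ k l → Iₙ k ⋆ Iₙ l ≋ Iₙ (k + l)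
  Iₙ-⋆ zero l = *-identityˡ _
  Iₙ-⋆ (suc k) l = *-assoc I₁ (Iₙ k) (Iₙ l) ▸ *-cong ≋-refl (Iₙ-⋆ k l)

  JN-⋆ : ∀ {k l k′ l′} (f : Fin k ↔ Fin l) (g : Fin k′ ↔ Fin l′) (h : Fin (k + k′) ↔ Fin (l + l′)) →
         (∀ i → to h i ≡ join l l′ (⊎map (to f) (to g) (splitAt k i))) → JN f ⋆ JN g ≋ JN h
  JN-⋆ f g h = aux (↔⇒≡ f) (↔⇒≡ g) f g h
    where
    aux : ∀ {k l k′ l′} → k ≡ l → k′ ≡ l′ → (f : Fin k ↔ Fin l) (g : Fin k′ ↔ Fin l′) (h : Fin (k + k′) ↔ Fin (l + l′)) →
          (∀ i → to h i ≡ join l l′ (⊎map (to f) (to g) (splitAt k i))) → JN f ⋆ JN g ≋ JN h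
    aux {k} {k′ = k′} refl refl f g h s = *-cong (JN-perm f) (JN-perm g) ▸ ▷-*ᴾ f g _ _ ▸
      ▷-cong {σ = f ⊗ₚ g} (λ i → trans (same (splitAt k i)) (sym (s i))) (Iₙ-⋆ k k′) ▸ ≋-sym (JN-perm h)
      where
      same : ∀ z → join k k′ (to (f ⊎-↔ g) z) ≡ join k k′ (⊎map (to f) (to g) z)
      same (inj₁ _) = refl
      same (inj₂ _) = refl

  -- Axioms stated with transported arities become naturality squares: once the equalities are
  -- matched, a bijection is determined by its values under `toℕ`, which transport does not change.
  cast-square : ∀ {a b a′ b′} (e₁ : a′ ≡ a) (e₂ : b′ ≡ b) {x : Car a b} {y : Car a′ b′} (f₁ : Fin a ↔ Fin a′) (f₂ : Fin b ↔ Fin b′)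
                (c₁ : Permutation′ a) (c₂ : Permutation′ b) → (∀ i → toℕ (to f₁ i) ≡ toℕ (to c₁ i)) → (∀ i → toℕ (to f₂ i) ≡ toℕ (to c₂ i)) →
                c₂ ▷ x ≋ subst₂ Car e₁ e₂ y ◁ c₁ → JN f₂ ∙ x ≋ y ∙ JN f₁
  cast-square refl refl {x} {y} f₁ f₂ c₁ c₂ s₁ s₂ eq = ▷-JN f₂ x ▸ ▷-cong (λ i → toℕ-injective (s₂ i)) ≋-refl ▸ eq ▸
    ◁-cong (λ i → sym (toℕ-injective (s₁ i))) ≋-refl ▸ ≋-sym (◁-JN f₁ y)

  cast-square-id : ∀ {a b a′ b′} (e₁ : a ≡ a′) (e₂ : b ≡ b′) {x : Car a b} {y : Car a′ b′} (f₁ : Fin a ↔ Fin a′) (f₂ : Fin b ↔ Fin b′) →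
                   (∀ i → toℕ (to f₁ i) ≡ toℕ i) → (∀ i → toℕ (to f₂ i) ≡ toℕ i) →
                   subst₂ Car e₁ e₂ x ≋ y → JN f₂ ∙ x ≋ y ∙ JN f₁
  cast-square-id refl refl f₁ f₂ s₁ s₂ eq =
    cast-square refl refl f₁ f₂ idₚ idₚ s₁ s₂ (▷-id _ ▸ eq ▸ ≋-sym (◁-id _))

  Homᴾ : FSet → FSet → Set m
  Homᴾ A B = Car (card A) (card B)

  num : ∀ {A B} → Bij A B → Fin (card A) ↔ Fin (card B)
  num {A} {B} f = ↔-sym (enum A) ⨟ ⟪ f ⟫ ⨟ enum B

  private
    via : ∀ {A B} (f : Bij A B) (s : Fin (card A) → ℕ) → (∀ x → toℕ (to (enum B) (app f x)) ≡ s (to (enum A) x)) →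
          ∀ i → toℕ (to (num f) i) ≡ s i
    via {A} f s h i = trans (h (from (enum A) i)) (cong s (to-from (enum A) i))

    α-num : ∀ A B C x → toℕ (to (enum (A ⊎ᶠ B ⊎ᶠ C)) (app (αᵇ {A} {B} {C}) x)) ≡ toℕ (to (enum ((A ⊎ᶠ B) ⊎ᶠ C)) x)
    α-num A B C (inj₁ (inj₁ a)) = trans (toℕ-↑ˡ i _) (sym (trans (toℕ-↑ˡ (i ↑ˡ card B) _) (toℕ-↑ˡ i _)))
      where i = to (enum A) a
    α-num A B C (inj₁ (inj₂ b)) = trans (toℕ-↑ʳ (card A) _) (trans (cong (card A +_) (toℕ-↑ˡ i _)) (sym (trans (toℕ-↑ˡ (card A ↑ʳ i) _) (toℕ-↑ʳ (card A) i))))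
      where i = to (enum B) b
    α-num A B C (inj₂ c) = trans (toℕ-↑ʳ (card A) _) (trans (cong (card A +_) (toℕ-↑ʳ (card B) i)) (trans (sym (+-assoc (card A) (card B) (toℕ i))) (sym (toℕ-↑ʳ (card A + card B) i))))
      where i = to (enum C) c

    γ-num : ∀ A B x → toℕ (to (enum (B ⊎ᶠ A)) (app (γᵇ {A} {B}) x)) ≡ toℕ (to (cₚ (card A) (card B)) (to (enum (A ⊎ᶠ B)) x))
    γ-num A B (inj₁ a) rewrite splitAt-↑ˡ (card A) (to (enum A) a) (card B) = sym (toℕ-cast _ (card B ↑ʳ to (enum A) a))
    γ-num A B (inj₂ b) rewrite splitAt-↑ʳ (card A) (card B) (to (enum B) b) = sym (toℕ-cast _ (to (enum B) b ↑ˡ card A))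

    ρ-num : ∀ A x → toℕ (to (enum A) (app (ρᵇ {A}) x)) ≡ toℕ (to (enum (A ⊎ᶠ ∅)) x)
    ρ-num A (inj₁ a) = sym (toℕ-↑ˡ (to (enum A) a) 0)
    ρ-num A (inj₂ ())

  ProP-SMC : SMC m ℓm
  ProP-SMC = record
    { Hom = Homᴾ ; _≋_ = _≋_ ; ≋-refl = ≋-refl ; ≋-sym = ≋-sym ; ≋-trans = _▸_
    ; _∘_ = _∙_ ; _⊗_ = _⋆_ ; J = λ f → JN (num f) ; ∘-cong = ∘-cong ; ⊗-cong = *-cong
    ; J-cong = λ {A} {B} s → JN-cong (λ i → cong (to (enum B)) (s _))
    ; ∘-assoc = ∘-assoc
    ; idˡ = λ {A} {B} p → ∘-cong (JN-id (to-from (enum B))) ≋-refl ▸ ∘-identityˡ p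
    ; idʳ = λ {A} {B} p → ∘-cong ≋-refl (JN-id (to-from (enum A))) ▸ ∘-identityʳ p
    ; interchange = interchange
    ; J-∘ = λ {A} {B} {C} g f → JN-∘ (num g) (num f) (num (f ⨾ g)) (λ i → cong (λ b → to (enum C) (app g b)) (sym (from-to (enum B) _)))
    ; J-⊗ = λ {A} {B} {A′} {B′} f g → JN-⋆ (num f) (num g) (num (f ⊎ᵇ g)) (λ i → sum {A} {B} {A′} {B′} f g (splitAt (card A) i))
    ; α-nat = λ {A} {B} {C} {A′} {B′} {C′} p q r → cast-square-id (+-assoc (card A) (card B) (card C)) (+-assoc (card A′) (card B′) (card C′))
        (num (αᵇ {A} {B} {C})) (num (αᵇ {A′} {B′} {C′})) (via (αᵇ {A} {B} {C}) toℕ (α-num A B C)) (via (αᵇ {A′} {B′} {C′}) toℕ (α-num A′ B′ C′)) (*-assoc p q r)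
    ; γ-nat = λ {A} {B} {A′} {B′} p q → cast-square (+-comm (card B) (card A)) (+-comm (card B′) (card A′)) (num (γᵇ {A} {B})) (num (γᵇ {A′} {B′}))
        (cₚ (card A) (card B)) (cₚ (card A′) (card B′)) (via (γᵇ {A} {B}) _ (γ-num A B)) (via (γᵇ {A′} {B′}) _ (γ-num A′ B′)) (c-*ᴾ p q)
    ; ρ-nat = λ {A} {A′} p → ∘-cong ≋-refl (*-cong ≋-refl (JN-id (λ _ → refl))) ▸
        cast-square-id (+-identityʳ (card A)) (+-identityʳ (card A′)) (num (ρᵇ {A})) (num (ρᵇ {A′})) (via (ρᵇ {A}) toℕ (ρ-num A)) (via (ρᵇ {A′}) toℕ (ρ-num A′)) (*-identityʳ p) }
    where
    sum : ∀ {A B A′ B′} (f : Bij A B) (g : Bij A′ B′) z →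
          join (card B) (card B′) (to (enum B ⊎-↔ enum B′) (to (⟪ f ⟫ ⊎-↔ ⟪ g ⟫) (from (enum A ⊎-↔ enum A′) z)))
          ≡ join (card B) (card B′) (⊎map (to (num f)) (to (num g)) z)
    sum f g (inj₁ _) = refl
    sum f g (inj₂ _) = refl

-- Orders at the vertices as numerical codes

idx<size : ∀ A a → idx A a < size A
idx<size (FinTy.fin n) i = toℕ<n i
idx<size (A FinTy.⊕ B) (inj₁ a) = <-≤-trans (idx<size A a) (m≤m+n (size A) (size B))
idx<size (A FinTy.⊕ B) (inj₂ b) = +-monoʳ-< (size A) (idx<size B b)
idx<size (FinTy.sub n p) (i , _) = toℕ<n i

offset-clash : ∀ {ℓ} {W : Set ℓ} {n i} j → i < n → i ≡ n + j → W
offset-clash {n = n} j i<n refl = ⊥-elim (<-irrefl refl (≤-<-trans (m≤m+n n j) i<n))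

idx-injective : ∀ A {a b} → idx A a ≡ idx A b → a ≡ b
idx-injective (FinTy.fin n) p = toℕ-injective p
idx-injective (A FinTy.⊕ B) {inj₁ a} {inj₁ b} p = cong inj₁ (idx-injective A p)
idx-injective (A FinTy.⊕ B) {inj₂ a} {inj₂ b} p = cong inj₂ (idx-injective B (+-cancelˡ-≡ (size A) _ _ p))
idx-injective (A FinTy.⊕ B) {inj₁ a} {inj₂ b} p = offset-clash (idx B b) (idx<size A a) p
idx-injective (A FinTy.⊕ B) {inj₂ a} {inj₁ b} p = offset-clash (idx B a) (idx<size A b) (sym p)
idx-injective (FinTy.sub n p) q = Sub-≡ p (toℕ-injective q)

module Lexicographic {W : Set} (N : ℕ) (r i : W → ℕ) (bound : ∀ x → i x < N) where
  code : W → ℕ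
  code x = r x * N + i x

  -- A rank larger by one adds a full `N`, which outweighs every difference of indices because these
  -- are below `N`.
  code-mono : ∀ {x y} → r x < r y → code x < code y
  code-mono {x} {y} lt = <-≤-trans (+-monoʳ-< (r x * N) (bound x))
    (≤-trans (≤-reflexive (+-comm (r x * N) N)) (≤-trans (*-monoˡ-≤ N lt) (m≤m+n (r y * N) (i y))))

  lex⇒code : ∀ {x y} → r x < r y ⊎ (r x ≡ r y × i x < i y) → code x < code y
  lex⇒code (inj₁ lt) = code-mono lt
  lex⇒code {x} {y} (inj₂ (eq , lt)) = subst (λ z → code x < z * N + i y) eq (+-monoʳ-< (r x * N) lt)

  code⇒lex : ∀ {x y} → code x < code y → r x < r y ⊎ (r x ≡ r y × i x < i y)
  code⇒lex {x} {y} lt with <-cmp (r x) (r y)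
  ... | tri< a _ _ = inj₁ a
  ... | tri≈ _ eq _ = inj₂ (eq , +-cancelˡ-< (r x * N) _ _ (subst (λ z → code x < z * N + i y) (sym eq) lt))
  ... | tri> _ _ gt = ⊥-elim (<-asym lt (code-mono gt))

  code-injective : (∀ {x y} → i x ≡ i y → x ≡ y) → ∀ {x y} → code x ≡ code y → x ≡ y
  code-injective inj {x} {y} eq with <-cmp (r x) (r y)
  ... | tri< a _ _ = ⊥-elim (<-irrefl eq (code-mono a))
  ... | tri> _ _ a = ⊥-elim (<-irrefl (sym eq) (code-mono a))
  ... | tri≈ _ e _ = inj (+-cancelˡ-≡ (r x * N) _ _ (trans eq (cong (λ z → z * N + i y) (sym e))))

op : Side → Side
op inn = out
op out = inn

arity : ℕ → ℕ → Side → ℕ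
arity k l inn = k
arity k l out = l

module _ {k l : ℕ} (G : PGraph k l) where
  open PGraph G using (E; inRank; outRank)

  Half : Side → Set
  Half d = El E ⊎ Fin (arity k l d)

  end : ∀ d → Half d → El (PGraph.V G) ⊎ Fin (arity k l (op d))
  end inn = inTgt G
  end out = outSrc G

  prerank : ∀ d → Half d → ℕ
  prerank inn = inRank
  prerank out = outRank

  index : ∀ d → Half d → ℕ
  index inn = idxIn G
  index out = idxOut G

  enc : ∀ d → Half d → ℕ
  enc inn = encIn G
  enc out = encOut G

  index-bound : ∀ d x → index d x < size E + arity k l d
  index-bound inn (inj₁ e) = <-≤-trans (idx<size E e) (m≤m+n (size E) k)
  index-bound inn (inj₂ r) = +-monoʳ-< (size E) (toℕ<n r)
  index-bound out (inj₁ e) = <-≤-trans (idx<size E e) (m≤m+n (size E) l)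
  index-bound out (inj₂ r) = +-monoʳ-< (size E) (toℕ<n r)

  index-injective : ∀ d {x y} → index d x ≡ index d y → x ≡ y
  index-injective inn {inj₁ x} {inj₁ y} p = cong inj₁ (idx-injective E p)
  index-injective inn {inj₂ x} {inj₂ y} p = cong inj₂ (toℕ-injective (+-cancelˡ-≡ (size E) _ _ p))
  index-injective inn {inj₁ x} {inj₂ y} p = offset-clash (toℕ y) (idx<size E x) p
  index-injective inn {inj₂ x} {inj₁ y} p = offset-clash (toℕ x) (idx<size E y) (sym p)
  index-injective out {inj₁ x} {inj₁ y} p = cong inj₁ (idx-injective E p)
  index-injective out {inj₂ x} {inj₂ y} p = cong inj₂ (toℕ-injective (+-cancelˡ-≡ (size E) _ _ p))
  index-injective out {inj₁ x} {inj₂ y} p = offset-clash (toℕ y) (idx<size E x) p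
  index-injective out {inj₂ x} {inj₁ y} p = offset-clash (toℕ x) (idx<size E y) (sym p)

  private
    module Lex d = Lexicographic (size E + arity k l d) (prerank d) (index d) (index-bound d)

  enc-injective : ∀ d {x y} → enc d x ≡ enc d y → x ≡ y
  enc-injective inn = Lex.code-injective inn (index-injective inn)
  enc-injective out = Lex.code-injective out (index-injective out)

  enc-mono : ∀ d {x y} → prerank d x < prerank d y → enc d x < enc d y
  enc-mono inn = Lex.code-mono inn
  enc-mono out = Lex.code-mono out

  lex⇒enc : ∀ d {x y} → prerank d x < prerank d y ⊎ (prerank d x ≡ prerank d y × index d x < index d y) → enc d x < enc d y
  lex⇒enc inn = Lex.lex⇒code inn
  lex⇒enc out = Lex.lex⇒code out

  enc⇒lex : ∀ d {x y} → enc d x < enc d y → prerank d x < prerank d y ⊎ (prerank d x ≡ prerank d y × index d x < index d y)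
  enc⇒lex inn = Lex.code⇒lex inn
  enc⇒lex out = Lex.code⇒lex out

getInj₁-spec : {A B : Set} (x : A ⊎ B) (t : T (isInj₁ x)) → inj₁ (getInj₁ x t) ≡ x
getInj₁-spec (inj₁ a) _ = refl

isInj₁-T : {A B : Set} {x : A ⊎ B} {a : A} → x ≡ inj₁ a → T (isInj₁ x)
isInj₁-T refl = tt

-- The combinatorial graph of a planar graph

module _ {k l : ℕ} (G : PGraph k l) where
  open PGraph G using (E; L; s; t; inT; outS; io→; io←) renaming (V to Vᴳ)

  private
    flag : El Vᴳ ⊎ El L → Bool
    flag (inj₁ _) = false
    flag (inj₂ _) = true

    isPort : ∀ d → Half G d → Bool
    isPort d x = isInj₁ (end G d x)

    halves : Side → FSet
    halves d = Elᶠ E ⊎ᶠ Finᶠ (arity k l d)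

  -- Only half-edges that end at a vertex are ports. They are ranked by `enc`, in which ties are
  -- already broken, so that ranks are injective.
  vsᴾ : VS
  vsᴾ = verts (Elᶠ Vᴳ ⊎ᶠ Elᶠ L) flag λ d → record
    { port = Subᶠ (halves d) (isPort d)
    ; at = λ h → inj₁ (getInj₁ (end G d (proj₁ h)) (proj₂ h))
    ; rank = λ h → enc G d (proj₁ h)
    ; rank-inj = λ x y _ p → Sub-≡ (isPort d) (enc-injective G d p)
    ; loop-free = λ _ → refl }

  private
    Out In : Set
    Out = Sub (isPort out)
    In  = Sub (isPort inn)

    -- The value of `inT r` is a separate argument, given with its equation, so that later lemmas
    -- can analyse it by cases without abstracting over `inT r`.
    enter : (x : El Vᴳ ⊎ Fin l) (r : Fin k) → (inT r ≡ x) → Fin l ⊎ In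
    enter (inj₁ v) r eq = inj₂ (inj₂ r , isInj₁-T eq)
    enter (inj₂ j) r eq = inj₁ j

    leave : (x : El Vᴳ ⊎ Fin k) (j : Fin l) → (outS j ≡ x) → Fin k ⊎ Out
    leave (inj₁ v) j eq = inj₂ (inj₂ j , isInj₁-T eq)
    leave (inj₂ r) j eq = inj₁ r

    toᴾ : Fin k ⊎ Out → Fin l ⊎ In
    toᴾ (inj₁ r) = enter (inT r) r refl
    toᴾ (inj₂ (inj₁ e , _)) = inj₂ (inj₁ e , tt)
    toᴾ (inj₂ (inj₂ j , _)) = inj₁ j

    fromᴾ : Fin l ⊎ In → Fin k ⊎ Out
    fromᴾ (inj₁ j) = leave (outS j) j refl
    fromᴾ (inj₂ (inj₁ e , _)) = inj₂ (inj₁ e , tt)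
    fromᴾ (inj₂ (inj₂ r , _)) = inj₁ r

    enter-in : ∀ {x v} r (eq : inT r ≡ x) → x ≡ inj₁ v → ∀ t → enter x r eq ≡ inj₂ (inj₂ r , t)
    enter-in r eq refl t = cong inj₂ (Sub-≡ (isPort inn) refl)

    enter-io : ∀ {x j} r (eq : inT r ≡ x) → x ≡ inj₂ j → enter x r eq ≡ inj₁ j
    enter-io r eq refl = refl

    leave-out : ∀ {x v} j (eq : outS j ≡ x) → x ≡ inj₁ v → ∀ t → leave x j eq ≡ inj₂ (inj₂ j , t)
    leave-out j eq refl t = cong inj₂ (Sub-≡ (isPort out) refl)

    leave-io : ∀ {x r} j (eq : outS j ≡ x) → x ≡ inj₂ r → leave x j eq ≡ inj₁ r
    leave-io j eq refl = refl

    from-toᴾ : ∀ z → fromᴾ (toᴾ z) ≡ z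
    from-toᴾ (inj₁ r) = aux (inT r) refl
      where
      aux : ∀ x (eq : inT r ≡ x) → fromᴾ (enter x r eq) ≡ inj₁ r
      aux (inj₁ v) eq = refl
      aux (inj₂ j) eq = leave-io j refl (io→ r j eq)
    from-toᴾ (inj₂ (inj₁ e , _)) = refl
    from-toᴾ (inj₂ (inj₂ j , t)) = leave-out j refl (sym (getInj₁-spec (outS j) t)) t

    to-fromᴾ : ∀ z → toᴾ (fromᴾ z) ≡ z
    to-fromᴾ (inj₁ j) = aux (outS j) refl
      where
      aux : ∀ x (eq : outS j ≡ x) → toᴾ (leave x j eq) ≡ inj₁ j
      aux (inj₁ v) eq = refl
      aux (inj₂ r) eq = enter-io r refl (io← r j eq)
    to-fromᴾ (inj₂ (inj₁ e , _)) = refl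
    to-fromᴾ (inj₂ (inj₂ r , t)) = enter-in r refl (sym (getInj₁-spec (inT r) t)) t

  𝔽 : CG (Finᶠ k) (Finᶠ l)
  𝔽 = graph vsᴾ (mk↔ₛ′ toᴾ fromᴾ to-fromᴾ from-toᴾ)

  𝔽-in : ∀ r t → to (π 𝔽) (inj₁ r) ≡ inj₂ (inj₂ r , t)
  𝔽-in r t = enter-in r refl (sym (getInj₁-spec (inT r) t)) t

  𝔽-io : ∀ {r j} → inT r ≡ inj₂ j → to (π 𝔽) (inj₁ r) ≡ inj₁ j
  𝔽-io {r} eq = enter-io r refl eq

  𝔽-io⁻ : ∀ {r j} → to (π 𝔽) (inj₁ r) ≡ inj₁ j → inT r ≡ inj₂ j
  𝔽-io⁻ {r} = aux (inT r) refl
    where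
    aux : ∀ {j} x (eq : inT r ≡ x) → enter x r eq ≡ inj₁ j → x ≡ inj₂ j
    aux (inj₂ j) eq refl = refl

  𝔽-in⁻ : ∀ {r h} → to (π 𝔽) (inj₁ r) ≡ inj₂ h → proj₁ h ≡ inj₂ r
  𝔽-in⁻ {r} = aux (inT r) refl
    where
    aux : ∀ {h} x (eq : inT r ≡ x) → enter x r eq ≡ inj₂ h → proj₁ h ≡ inj₂ r
    aux (inj₁ v) eq refl = refl

  -- To identify the vertices and ports of Λ with those of G, each port is sent to its half-edge.
  module Into (Λ : VS) (fV : ⟦ V Λ ⟧ ↔ (El Vᴳ ⊎ El L)) (loop-comm : ∀ v → flag (to fV v) ≡ loop Λ v)
              (u : ∀ d → ⟦ H d Λ ⟧ → Half G d)
              (u-end : ∀ d h → Σ _ λ v → end G d (u d h) ≡ inj₁ v × to fV (at d Λ h) ≡ inj₁ v)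
              (u-inj : ∀ d {h h′} → u d h ≡ u d h′ → h ≡ h′)
              (u-surj : ∀ d x v → end G d x ≡ inj₁ v → Σ _ λ h → u d h ≡ x)
              (u-mono : ∀ d h h′ → at d Λ h ≡ at d Λ h′ → rank d Λ h < rank d Λ h′ → enc G d (u d h) < enc G d (u d h′)) where

    into : VIso Λ vsᴾ
    into = record
      { fV = fV
      ; fH = λ d → match (u d) proj₁ (u-inj d) (Sub-≡ (isPort d)) (λ h → (u d h , isInj₁-T (proj₁ (proj₂ (u-end d h)))) , refl)
                         (λ { (x , t) → u-surj d x _ (sym (getInj₁-spec (end G d x) t)) })
      ; loop-comm = loop-comm
      ; at-comm = λ d h → trans (cong inj₁ (inj₁-injective (trans (getInj₁-spec _ _) (proj₁ (proj₂ (u-end d h)))))) (sym (proj₂ (proj₂ (u-end d h))))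
      ; mono = u-mono }

flagᴾ : ∀ {k l} (G : PGraph k l) → El (PGraph.V G) ⊎ El (PGraph.L G) → Bool
flagᴾ G = loop (vsᴾ G)

label : ∀ {k l k′ l′} (f : Fin k ↔ Fin k′) (g : Fin l ↔ Fin l′) d → Fin (arity k l d) ↔ Fin (arity k′ l′ d)
label f g inn = f
label f g out = g

-- Isomorphisms of planar graphs over relabellings of the inputs and outputs.
record PH {k l k′ l′} (f : Fin k ↔ Fin k′) (g : Fin l ↔ Fin l′) (G : PGraph k l) (G′ : PGraph k′ l′) : Set where
  field
    gV : El (PGraph.V G) ↔ El (PGraph.V G′)
    gE : El (PGraph.E G) ↔ El (PGraph.E G′)
    gL : El (PGraph.L G) ↔ El (PGraph.L G′)
  half : ∀ d → Half G d → Half G′ d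
  half d = ⊎map (to gE) (to (label f g d))
  field
    end-comm : ∀ d x → end G′ d (half d x) ≡ ⊎map (to gV) (to (label f g (op d))) (end G d x)
    monotone : ∀ d x y v → end G d x ≡ inj₁ v → end G d y ≡ inj₁ v → enc G d x < enc G d y → enc G′ d (half d x) < enc G′ d (half d y)

⊎map-inj₁ : {A B A′ B′ : Set} (f : A ↔ A′) (g : B → B′) {x : A ⊎ B} {v : A′} → ⊎map (to f) g x ≡ inj₁ v → x ≡ inj₁ (from f v)
⊎map-inj₁ f g {inj₁ a} refl = cong inj₁ (sym (from-to f a))

PH⇒HIso : ∀ {k l k′ l′} {f : Fin k ↔ Fin k′} {g : Fin l ↔ Fin l′} {G : PGraph k l} {G′ : PGraph k′ l′} →
          PH f g G G′ → HIso (prim f) (prim g) (𝔽 G) (𝔽 G′)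
PH⇒HIso {k} {l} {k′} {l′} {f} {g} {G} {G′} i = record { vi = into ; comm = λ
  { (inj₁ r)              → input r
  ; (inj₂ (inj₁ e , t))   → cong inj₂ (Sub-≡ _ refl)
  ; (inj₂ (inj₂ j , t))   → refl } }
  where
  open PH i
  end⁺ : ∀ d x v → end G d x ≡ inj₁ v → end G′ d (half d x) ≡ inj₁ (to gV v)
  end⁺ d x v eq = trans (end-comm d x) (cong (⊎map _ _) eq)
  halfᵇ : ∀ d → Half G d ↔ Half G′ d
  halfᵇ d = gE ⊎-↔ label f g d
  half≡ : ∀ d x → half d x ≡ to (halfᵇ d) x
  half≡ d (inj₁ _) = refl
  half≡ d (inj₂ _) = refl
  flag-comm : ∀ v → flagᴾ G′ (to (gV ⊎-↔ gL) v) ≡ flagᴾ G v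
  flag-comm (inj₁ _) = refl
  flag-comm (inj₂ _) = refl
  surj : ∀ d x v → end G′ d x ≡ inj₁ v → Σ _ λ h → half d (proj₁ {B = λ y → T (isInj₁ (end G d y))} h) ≡ x
  surj d x v eq = (y , isInj₁-T (⊎map-inj₁ gV _ (trans (sym (end-comm d y)) (trans (cong (end G′ d) y≡) eq)))) , y≡
    where
    y = from (halfᵇ d) x
    y≡ = trans (half≡ d y) (to-from (halfᵇ d) x)
  open Into G′ (vsᴾ G) (gV ⊎-↔ gL) flag-comm
    (λ d h → half d (proj₁ h))
    (λ d h → _ , end⁺ d (proj₁ h) _ (sym (getInj₁-spec (end G d (proj₁ h)) (proj₂ h))) , refl)
    (λ d {h} {h′} eq → Sub-≡ _ (to-injective (halfᵇ d) (trans (sym (half≡ d (proj₁ h))) (trans eq (half≡ d (proj₁ h′))))))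
    surj
    (λ d h h′ eq lt → monotone d _ _ _ (sym (getInj₁-spec _ (proj₂ h)))
      (trans (sym (getInj₁-spec _ (proj₂ h′))) (cong inj₁ (sym (inj₁-injective eq)))) lt)
  input : ∀ r → to (π (𝔽 G′)) (inj₁ (to f r)) ≡ ⊎map (to g) (to (fH into inn)) (to (π (𝔽 G)) (inj₁ r))
  input r with to (π (𝔽 G)) (inj₁ r) in eq
  ... | inj₁ j = 𝔽-io G′ (trans (end-comm inn (inj₂ r)) (cong (⊎map (to gV) (to g)) (𝔽-io⁻ G eq)))
  ... | inj₂ (x , t) with 𝔽-in⁻ G eq
  ... | refl = 𝔽-in G′ (to f r) _

-- The graph can be read off from the bijection: the flag separates vertices from loops, and
-- internal edges are the wires from port to port.
HIso⇒PH : ∀ {k l k′ l′} {f : Bij (Finᶠ k) (Finᶠ k′)} {g : Bij (Finᶠ l) (Finᶠ l′)} {G : PGraph k l} {G′ : PGraph k′ l′} →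
          HIso f g (𝔽 G) (𝔽 G′) → PH ⟪ f ⟫ ⟪ g ⟫ G G′
HIso⇒PH {k} {l} {k′} {l′} {f} {g} {G} {G′} θ = record
  { gV = gV ; gE = gE ; gL = restrictʳ (fV i) lV rV
  ; end-comm = end-comm
  ; monotone = λ d x y v p q lt → subst₂ (λ a b → enc G′ d a < enc G′ d b) (fH-half d (x , isInj₁-T p)) (fH-half d (y , isInj₁-T q))
      (mono i d _ _ (cong inj₁ (inj₁-injective (trans (getInj₁-spec (end G d x) _) (trans (trans p (sym q)) (sym (getInj₁-spec (end G d y) _)))))) lt) }
  where
  i = vi θ
  lV : ∀ v → Σ _ λ v′ → to (fV i) (inj₁ v) ≡ inj₁ v′
  lV v with to (fV i) (inj₁ v) | loop-comm i (inj₁ v)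
  ... | inj₁ v′ | _ = v′ , refl
  rV : ∀ v → Σ _ λ v′ → to (fV i) (inj₂ v) ≡ inj₂ v′
  rV v with to (fV i) (inj₂ v) | loop-comm i (inj₂ v)
  ... | inj₂ v′ | _ = v′ , refl
  gV = restrictˡ (fV i) lV rV

  -- The wire of an internal edge ends at a port and not at an output index, so its image is an
  -- internal edge again. The statement is general because it is also applied to the inverse
  -- isomorphism.
  internal : ∀ {k l k′ l′} {f : Bij (Finᶠ k) (Finᶠ k′)} {g : Bij (Finᶠ l) (Finᶠ l′)} {G : PGraph k l} {G′ : PGraph k′ l′}
             (θ : HIso f g (𝔽 G) (𝔽 G′)) e → Σ _ λ e′ → proj₁ (to (fH (vi θ) out) (inj₁ e , tt)) ≡ inj₁ e′
  internal θ e with to (fH (vi θ) out) (inj₁ e , tt) | comm θ (inj₂ (inj₁ e , tt))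
  ... | inj₁ e′ , _ | q = e′ , refl
  ... | inj₂ j , _  | ()

  gE : El (PGraph.E G) ↔ El (PGraph.E G′)
  gE = match (λ e → proj₁ (to (fH i out) (inj₁ e , tt))) inj₁
    (λ q → inj₁-injective (cong proj₁ (to-injective (fH i out) (Sub-≡ _ q)))) inj₁-injective
    (λ e → proj₁ (internal {f = f} {g} θ e) , sym (proj₂ (internal {f = f} {g} θ e))) back
    where
    back : ∀ e′ → Σ _ λ e → proj₁ (to (fH i out) (inj₁ e , tt)) ≡ inj₁ e′
    back e′ with from (fH i out) (inj₁ e′ , tt) in eq | internal (symʰ θ) e′
    ... | inj₁ e , _ | _ = e , cong proj₁ (from⇒to (fH i out) eq)
    ... | inj₂ j , _ | _ , ()

  outE : ∀ e → to (fH i out) (inj₁ e , tt) ≡ (inj₁ (to gE e) , tt)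
  outE e = Sub-≡ _ (proj₂ (internal {f = f} {g} θ e))

  half : ∀ d → Half G d → Half G′ d
  half d = ⊎map (to gE) (to (label ⟪ f ⟫ ⟪ g ⟫ d))

  fH-half : ∀ d h → proj₁ (to (fH i d) h) ≡ half d (proj₁ h)
  fH-half out (inj₁ e , t) = cong proj₁ (outE e)
  fH-half inn (inj₁ e , t) = sym (cong proj₁ (inj₂-injective
    (trans (cong (λ z → to (π (𝔽 G′)) (inj₂ z)) (sym (outE e))) (comm θ (inj₂ (inj₁ e , tt))))))
  fH-half out (inj₂ j , t) with to (fH i out) (inj₂ j , t) | comm θ (inj₂ (inj₂ j , t))
  ... | inj₂ j′ , _ | q = cong inj₂ (inj₁-injective q)
  fH-half inn (inj₂ r , t) = 𝔽-in⁻ G′ (trans (comm θ (inj₁ r)) (cong (⊎map (app g) (to (fH i inn))) (𝔽-in G r t)))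

  at-end : ∀ d h → end G′ d (half d (proj₁ h)) ≡ inj₁ (to gV (getInj₁ (end G d (proj₁ h)) (proj₂ h)))
  at-end d h = trans (cong (end G′ d) (sym (fH-half d h))) (trans (sym (getInj₁-spec (end G′ d (proj₁ (to (fH i d) h))) _))
    (cong inj₁ (inj₁-injective (trans (at-comm i d h) (proj₂ (lV _))))))

  io-comm : ∀ {r j} → inTgt G (inj₂ r) ≡ inj₂ j → inTgt G′ (inj₂ (app f r)) ≡ inj₂ (app g j)
  io-comm {r} q = 𝔽-io⁻ G′ (trans (comm θ (inj₁ r)) (cong (⊎map (app g) (to (fH i inn))) (𝔽-io G q)))

  end-comm : ∀ d x → end G′ d (half d x) ≡ ⊎map (to gV) (to (label ⟪ f ⟫ ⟪ g ⟫ (op d))) (end G d x)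
  end-comm d x = aux d x (end G d x) refl
    where
    aux : ∀ d x w → end G d x ≡ w → end G′ d (half d x) ≡ ⊎map (to gV) (to (label ⟪ f ⟫ ⟪ g ⟫ (op d))) w
    aux d x (inj₁ v) eq = trans (at-end d (x , isInj₁-T eq)) (cong (λ z → inj₁ (to gV z)) (inj₁-injective (trans (getInj₁-spec (end G d x) _) eq)))
    aux inn (inj₁ e) (inj₂ j) ()
    aux out (inj₁ e) (inj₂ j) ()
    aux inn (inj₂ r) (inj₂ j) eq = io-comm eq
    aux out (inj₂ j) (inj₂ r) eq = PGraph.io→ G′ _ _ (io-comm (PGraph.io← G r j eq))

PH⇒PIso : ∀ {k l} {G H : PGraph k l} → PH ↔-refl ↔-refl G H → PIso G H
PH⇒PIso {G = G} {H} i = record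
  { giso = record { fV = gV ; fE = gE ; fL = gL
                  ; s-comm = λ e → sym (inj₁-injective (end-comm out (inj₁ e))) ; t-comm = λ e → sym (inj₁-injective (end-comm inn (inj₁ e)))
                  ; inT-comm = λ r → end-comm inn (inj₂ r) ; outS-comm = λ j → end-comm out (inj₂ j) }
  ; in-order = λ v x y p q → mk⇔ (λ lt → enc⇒lex H inn (monotone inn x y v p q (lex⇒enc G inn lt)))
                                 (λ lt → enc⇒lex G inn (reflect inn x y v p q (lex⇒enc H inn lt)))
  ; out-order = λ v x y p q → mk⇔ (λ lt → enc⇒lex H out (monotone out x y v p q (lex⇒enc G out lt)))
                                  (λ lt → enc⇒lex G out (reflect out x y v p q (lex⇒enc H out lt))) }
  where
  open PH i
  reflect : ∀ d x y v → end G d x ≡ inj₁ v → end G d y ≡ inj₁ v → enc H d (half d x) < enc H d (half d y) → enc G d x < enc G d y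
  reflect d x y v p q lt with <-cmp (enc G d x) (enc G d y)
  ... | tri< a _ _ = a
  ... | tri≈ _ e _ = ⊥-elim (<-irrefl (cong (λ z → enc H d (half d z)) (enc-injective G d e)) lt)
  ... | tri> _ _ b = ⊥-elim (<-asym lt (monotone d y x v q p b))

PIso⇒PH : ∀ {k l} {G H : PGraph k l} → PIso G H → PH ↔-refl ↔-refl G H
PIso⇒PH {G = G} {H} i = record
  { gV = GIso.fV giso ; gE = fE ; gL = fL
  ; end-comm = λ { inn (inj₁ e) → cong inj₁ (sym (GIso.t-comm giso e)) ; inn (inj₂ r) → inT-comm r
                 ; out (inj₁ e) → cong inj₁ (sym (s-comm e)) ; out (inj₂ j) → outS-comm j }
  ; monotone = λ { inn x y v p q lt → lex⇒enc H inn (Equivalence.to (in-order v x y p q) (enc⇒lex G inn lt))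
                 ; out x y v p q lt → lex⇒enc H out (Equivalence.to (out-order v x y p q) (enc⇒lex G out lt)) } }
  where open PIso i
        open GIso giso hiding (fV; t-comm)

𝔽-full : ∀ {k l} {G H : PGraph k l} → 𝔽 G ≈ 𝔽 H → PIso G H
𝔽-full θ = PH⇒PIso (HIso⇒PH θ)

𝔽-iso : ∀ {k l} {G H : PGraph k l} → PIso G H → 𝔽 G ≈ 𝔽 H
𝔽-iso i = reframe (λ _ → refl) (λ _ → refl) (PH⇒HIso (PIso⇒PH i))

private
  map-id : {A B : Set} (x : A ⊎ B) → x ≡ ⊎map id id x
  map-id (inj₁ _) = refl
  map-id (inj₂ _) = refl

-- Operations on planar graphs in terms of bijections

▷-PH : ∀ {k l} (σ : Permutation′ l) (G : PGraph k l) → PH ↔-refl σ G (σ ▷P G)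
▷-PH {k} {l} σ G = record
  { gV = ↔-refl ; gE = ↔-refl ; gL = ↔-refl
  ; end-comm = λ { inn (inj₁ _) → refl ; inn (inj₂ r) → refl
                 ; out (inj₁ _) → refl ; out (inj₂ j) → trans (cong (PGraph.outS G) (inverseˡ σ)) (map-id _) }
  ; monotone = λ { inn x y _ _ _ lt → subst₂ _<_ (same x) (same y) lt
                 ; out x y _ _ _ lt → enc-mono (σ ▷P G) out {⊎map id (to σ) x} {⊎map id (to σ) y} (subst₂ _<_ (pre x) (pre y) lt) } }
  where
  same : ∀ x → encIn G x ≡ encIn (σ ▷P G) (⊎map id id x)
  same (inj₁ _) = refl
  same (inj₂ _) = refl
  pre : ∀ x → encOut G x ≡ PGraph.outRank (σ ▷P G) (⊎map id (to σ) x)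
  pre (inj₁ _) = refl
  pre (inj₂ j) = cong (λ z → encOut G (inj₂ z)) (sym (inverseˡ σ))

◁-PH : ∀ {k l} (τ : Permutation′ k) (G : PGraph k l) → PH (↔-sym τ) ↔-refl G (G ◁P τ)
◁-PH {k} {l} τ G = record
  { gV = ↔-refl ; gE = ↔-refl ; gL = ↔-refl
  ; end-comm = λ { inn (inj₁ _) → refl ; inn (inj₂ r) → trans (cong (PGraph.inT G) (inverseʳ τ)) (map-id _)
                 ; out (inj₁ _) → refl ; out (inj₂ j) → refl }
  ; monotone = λ { inn x y _ _ _ lt → enc-mono (G ◁P τ) inn {⊎map id (from τ) x} {⊎map id (from τ) y} (subst₂ _<_ (pre x) (pre y) lt)
                 ; out x y _ _ _ lt → subst₂ _<_ (same x) (same y) lt } }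
  where
  same : ∀ x → encOut G x ≡ encOut (G ◁P τ) (⊎map id id x)
  same (inj₁ _) = refl
  same (inj₂ _) = refl
  pre : ∀ x → encIn G x ≡ PGraph.inRank (G ◁P τ) (⊎map id (from τ) x)
  pre (inj₁ _) = refl
  pre (inj₂ j) = cong (λ z → encIn G (inj₂ z)) (sym (inverseʳ τ))

map-isInj₁ : {A B A′ B′ : Set} {f : A → A′} {g : B → B′} {x : A ⊎ B} {v : A′} → ⊎map f g x ≡ inj₁ v → T (isInj₁ x)
map-isInj₁ {x = inj₁ _} _ = tt

module _ {k l k′ l′ : ℕ} (G : PGraph k l) (G′ : PGraph k′ l′) where
  private
    GG = G *P G′

    J : ∀ d → (Fin (arity k l d) ⊎ Fin (arity k′ l′ d)) ↔ Fin (arity (k + k′) (l + l′) d)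
    J inn = ↔-sym +↔⊎
    J out = ↔-sym +↔⊎

    halvesᵇ : ∀ d → (Half G d ⊎ Half G′ d) ↔ Half GG d
    halvesᵇ d = ⊎-mid4 ⨟ (↔-refl ⊎-↔ J d)

    end₁ : ∀ d x → end GG d (to (halvesᵇ d) (inj₁ x)) ≡ ⊎map inj₁ (λ r → to (J (op d)) (inj₁ r)) (end G d x)
    end₁ inn (inj₁ e) = refl
    end₁ inn (inj₂ r) rewrite splitAt-↑ˡ k r k′ = refl
    end₁ out (inj₁ e) = refl
    end₁ out (inj₂ r) rewrite splitAt-↑ˡ l r l′ = refl

    end₂ : ∀ d x → end GG d (to (halvesᵇ d) (inj₂ x)) ≡ ⊎map inj₂ (λ r → to (J (op d)) (inj₂ r)) (end G′ d x)
    end₂ inn (inj₁ e) = refl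
    end₂ inn (inj₂ r) rewrite splitAt-↑ʳ k k′ r = refl
    end₂ out (inj₁ e) = refl
    end₂ out (inj₂ r) rewrite splitAt-↑ʳ l l′ r = refl

    prerank₁ : ∀ d x → prerank GG d (to (halvesᵇ d) (inj₁ x)) ≡ enc G d x
    prerank₁ inn (inj₁ e) = refl
    prerank₁ inn (inj₂ r) rewrite splitAt-↑ˡ k r k′ = refl
    prerank₁ out (inj₁ e) = refl
    prerank₁ out (inj₂ r) rewrite splitAt-↑ˡ l r l′ = refl

    prerank₂ : ∀ d x → prerank GG d (to (halvesᵇ d) (inj₂ x)) ≡ enc G′ d x
    prerank₂ inn (inj₁ e) = refl
    prerank₂ inn (inj₂ r) rewrite splitAt-↑ʳ k k′ r = refl
    prerank₂ out (inj₁ e) = refl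
    prerank₂ out (inj₂ r) rewrite splitAt-↑ʳ l l′ r = refl

    Λ : VS
    Λ = vsᴾ G ⊕ vsᴾ G′

    forget : ∀ d → ⟦ H d Λ ⟧ → Half G d ⊎ Half G′ d
    forget d = ⊎map proj₁ proj₁

    forget-inj : ∀ d {h h′} → forget d h ≡ forget d h′ → h ≡ h′
    forget-inj d {inj₁ _} {inj₁ _} q = cong inj₁ (Sub-≡ _ (inj₁-injective q))
    forget-inj d {inj₂ _} {inj₂ _} q = cong inj₂ (Sub-≡ _ (inj₂-injective q))

    u : ∀ d → ⟦ H d Λ ⟧ → Half GG d
    u d h = to (halvesᵇ d) (forget d h)

    u-end : ∀ d h → Σ _ λ v → end GG d (u d h) ≡ inj₁ v × to ⊎-mid4 (at d Λ h) ≡ inj₁ v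
    u-end d (inj₁ (x , t)) = _ , trans (end₁ d x) (cong (⊎map _ _) (sym (getInj₁-spec (end G d x) t))) , refl
    u-end d (inj₂ (x , t)) = _ , trans (end₂ d x) (cong (⊎map _ _) (sym (getInj₁-spec (end G′ d x) t))) , refl

    u-surj : ∀ d x v → end GG d x ≡ inj₁ v → Σ _ λ h → u d h ≡ x
    u-surj d x v q with from (halvesᵇ d) x in eq
    ... | inj₁ y = inj₁ (y , map-isInj₁ (trans (sym (end₁ d y)) (trans (cong (end GG d) y≡) q))) , y≡
      where y≡ = from⇒to (halvesᵇ d) eq
    ... | inj₂ y = inj₂ (y , map-isInj₁ (trans (sym (end₂ d y)) (trans (cong (end GG d) y≡) q))) , y≡
      where y≡ = from⇒to (halvesᵇ d) eq

    u-mono : ∀ d h h′ → at d Λ h ≡ at d Λ h′ → rank d Λ h < rank d Λ h′ → enc GG d (u d h) < enc GG d (u d h′)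
    u-mono d (inj₁ (x , _)) (inj₁ (y , _)) _ lt = enc-mono GG d {to (halvesᵇ d) (inj₁ x)} {to (halvesᵇ d) (inj₁ y)} (subst₂ _<_ (sym (prerank₁ d x)) (sym (prerank₁ d y)) lt)
    u-mono d (inj₂ (x , _)) (inj₂ (y , _)) _ lt = enc-mono GG d {to (halvesᵇ d) (inj₂ x)} {to (halvesᵇ d) (inj₂ y)} (subst₂ _<_ (sym (prerank₂ d x)) (sym (prerank₂ d y)) lt)

    flag-comm : ∀ v → flagᴾ GG (to ⊎-mid4 v) ≡ loop Λ v
    flag-comm (inj₁ (inj₁ _)) = refl
    flag-comm (inj₁ (inj₂ _)) = refl
    flag-comm (inj₂ (inj₁ _)) = refl
    flag-comm (inj₂ (inj₂ _)) = refl

    open Into GG Λ ⊎-mid4 flag-comm u u-end (λ d q → forget-inj d (to-injective (halvesᵇ d) q)) u-surj u-mono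

    j : Bij (Finᶠ k ⊎ᶠ Finᶠ k′) (Finᶠ (k + k′))
    j = prim (↔-sym +↔⊎)
    j′ : Bij (Finᶠ l ⊎ᶠ Finᶠ l′) (Finᶠ (l + l′))
    j′ = prim (↔-sym +↔⊎)

    R : (⟦ Finᶠ l ⟧ ⊎ ⟦ Finᶠ l′ ⟧) ⊎ ⟦ H inn Λ ⟧ → Fin (l + l′) ⊎ ⟦ H inn (vsᴾ GG) ⟧
    R = ⊎map (app j′) (to (fH into inn))

    input₁ : ∀ r → to (π (𝔽 GG)) (inj₁ (app j (inj₁ r))) ≡ R (to ⊎-mid4 (inj₁ (to (π (𝔽 G)) (inj₁ r))))
    input₁ r with to (π (𝔽 G)) (inj₁ r) in eq
    ... | inj₁ x = 𝔽-io GG (trans (end₁ inn (inj₂ r)) (cong (⊎map inj₁ _) (𝔽-io⁻ G eq)))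
    ... | inj₂ (x , t) with 𝔽-in⁻ G eq
    ... | refl = 𝔽-in GG (r ↑ˡ k′) _

    input₂ : ∀ r → to (π (𝔽 GG)) (inj₁ (app j (inj₂ r))) ≡ R (to ⊎-mid4 (inj₂ (to (π (𝔽 G′)) (inj₁ r))))
    input₂ r with to (π (𝔽 G′)) (inj₁ r) in eq
    ... | inj₁ x = 𝔽-io GG (trans (end₂ inn (inj₂ r)) (cong (⊎map inj₂ _) (𝔽-io⁻ G′ eq)))
    ... | inj₂ (x , t) with 𝔽-in⁻ G′ eq
    ... | refl = 𝔽-in GG (k ↑ʳ r) _

  𝔽-* : HIso (prim (↔-sym +↔⊎)) (prim (↔-sym +↔⊎)) (𝔽 G ⊛ 𝔽 G′) (𝔽 (G *P G′))
  𝔽-* = record { vi = into ; comm = λ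
    { (inj₁ (inj₁ r)) → input₁ r
    ; (inj₁ (inj₂ r)) → input₂ r
    ; (inj₂ (inj₁ (inj₁ _ , _))) → cong inj₂ (Sub-≡ _ refl)
    ; (inj₂ (inj₁ (inj₂ _ , _))) → refl
    ; (inj₂ (inj₂ (inj₁ _ , _))) → cong inj₂ (Sub-≡ _ refl)
    ; (inj₂ (inj₂ (inj₂ _ , _))) → refl } }

module _ {k l m : ℕ} (G′ : PGraph l m) (G : PGraph k l) where
  private
    GG = G′ ⊚P G
    module G = PGraph G
    module G′ = PGraph G′

    -- The input `j` of `G′` is followed back into `G`: it becomes the target half of a glued edge
    -- if output `j` of `G` has a source vertex, and an input of the composite if it is an
    -- input-output edge. `passOut` is the mirror image.
    passIn : ∀ j (x : El G.V ⊎ Fin k) → G.outS j ≡ x → T (isInj₁ (G′.inT j)) → Half GG inn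
    passIn j (inj₁ v) eq t = inj₁ (inj₂ (j , T-∧ (isInj₁-T eq) t))
    passIn j (inj₂ r) eq t = inj₂ r

    passOut : ∀ j (x : El G′.V ⊎ Fin m) → G′.inT j ≡ x → T (isInj₁ (G.outS j)) → Half GG out
    passOut j (inj₁ v) eq t = inj₁ (inj₂ (j , T-∧ t (isInj₁-T eq)))
    passOut j (inj₂ r) eq t = inj₂ r

    passIn-out : ∀ {j r} x eq t → x ≡ inj₂ r → passIn j x eq t ≡ inj₂ r
    passIn-out x eq t refl = refl

    passIn-glue : ∀ {j} x eq t → T (isInj₁ x) → ∀ p → passIn j x eq t ≡ inj₁ (inj₂ (j , p))
    passIn-glue (inj₁ v) eq t _ p = cong (λ z → inj₁ (inj₂ z)) (Sub-≡ _ refl)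

    passOut-out : ∀ {j r} x eq t → x ≡ inj₂ r → passOut j x eq t ≡ inj₂ r
    passOut-out x eq t refl = refl

    passOut-glue : ∀ {j} x eq t → T (isInj₁ x) → ∀ p → passOut j x eq t ≡ inj₁ (inj₂ (j , p))
    passOut-glue (inj₁ v) eq t _ p = cong (λ z → inj₁ (inj₂ z)) (Sub-≡ _ refl)

    Λ : VS
    Λ = vsᴾ G ⊕ vsᴾ G′

    u : ∀ d → ⟦ H d Λ ⟧ → Half GG d
    u d   (inj₁ (inj₁ e , _)) = inj₁ (inj₁ (inj₁ e))
    u d   (inj₂ (inj₁ e , _)) = inj₁ (inj₁ (inj₂ e))
    u inn (inj₁ (inj₂ r , _)) = inj₂ r
    u inn (inj₂ (inj₂ j , t)) = passIn j (G.outS j) refl t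
    u out (inj₁ (inj₂ j , t)) = passOut j (G′.inT j) refl t
    u out (inj₂ (inj₂ j , _)) = inj₂ j

    -- A retraction of `u`, up to `forget`. It gives injectivity of `u`, and the orders too, since
    -- ranks in the composite are by definition codes of the half-edges of origin.
    origin : ∀ d → Half GG d → Half G d ⊎ Half G′ d
    origin d   (inj₁ (inj₁ (inj₁ e))) = inj₁ (inj₁ e)
    origin d   (inj₁ (inj₁ (inj₂ e))) = inj₂ (inj₁ e)
    origin inn (inj₁ (inj₂ (j , _))) = inj₂ (inj₂ j)
    origin out (inj₁ (inj₂ (j , _))) = inj₁ (inj₂ j)
    origin inn (inj₂ r) = [ (λ _ → inj₁ (inj₂ r)) , (λ j → inj₂ (inj₂ j)) ]′ (G.inT r)
    origin out (inj₂ j) = [ (λ _ → inj₂ (inj₂ j)) , (λ i → inj₁ (inj₂ i)) ]′ (G′.outS j)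

    prerank-origin : ∀ d x → prerank GG d x ≡ [ enc G d , enc G′ d ]′ (origin d x)
    prerank-origin inn (inj₁ (inj₁ (inj₁ e))) = refl
    prerank-origin out (inj₁ (inj₁ (inj₁ e))) = refl
    prerank-origin inn (inj₁ (inj₁ (inj₂ e))) = refl
    prerank-origin out (inj₁ (inj₁ (inj₂ e))) = refl
    prerank-origin inn (inj₁ (inj₂ _)) = refl
    prerank-origin out (inj₁ (inj₂ _)) = refl
    prerank-origin inn (inj₂ r) with G.inT r
    ... | inj₁ _ = refl
    ... | inj₂ _ = refl
    prerank-origin out (inj₂ j) with G′.outS j
    ... | inj₁ _ = refl
    ... | inj₂ _ = refl

    forget : ∀ d → ⟦ H d Λ ⟧ → Half G d ⊎ Half G′ d
    forget d = ⊎map proj₁ proj₁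

    forget-inj : ∀ d {h h′} → forget d h ≡ forget d h′ → h ≡ h′
    forget-inj d {inj₁ _} {inj₁ _} q = cong inj₁ (Sub-≡ _ (inj₁-injective q))
    forget-inj d {inj₂ _} {inj₂ _} q = cong inj₂ (Sub-≡ _ (inj₂-injective q))

    origin-u : ∀ d h → origin d (u d h) ≡ forget d h
    origin-u d   (inj₁ (inj₁ e , _)) = refl
    origin-u d   (inj₂ (inj₁ e , _)) = refl
    origin-u inn (inj₁ (inj₂ r , t)) with G.inT r
    ... | inj₁ _ = refl
    origin-u inn (inj₂ (inj₂ j , t)) = aux (G.outS j) refl
      where
      aux : ∀ x (eq : G.outS j ≡ x) → origin inn (passIn j x eq t) ≡ inj₂ (inj₂ j)
      aux (inj₁ v) eq = refl
      aux (inj₂ r) eq = cong [ _ , _ ]′ (G.io← r j eq)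
    origin-u out (inj₁ (inj₂ j , t)) = aux (G′.inT j) refl
      where
      aux : ∀ x (eq : G′.inT j ≡ x) → origin out (passOut j x eq t) ≡ inj₁ (inj₂ j)
      aux (inj₁ v) eq = refl
      aux (inj₂ r) eq = cong [ _ , _ ]′ (G′.io→ j r eq)
    origin-u out (inj₂ (inj₂ j , t)) with G′.outS j
    ... | inj₁ _ = refl

    u-end : ∀ d h → Σ _ λ v → end GG d (u d h) ≡ inj₁ v × to ⊎-mid4 (at d Λ h) ≡ inj₁ v
    u-end inn (inj₁ (inj₁ e , _)) = _ , refl , refl
    u-end inn (inj₂ (inj₁ e , _)) = _ , refl , refl
    u-end out (inj₁ (inj₁ e , _)) = _ , refl , refl
    u-end out (inj₂ (inj₁ e , _)) = _ , refl , refl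
    u-end inn (inj₁ (inj₂ r , t)) with G.inT r
    ... | inj₁ _ = _ , refl , refl
    u-end inn (inj₂ (inj₂ j , t)) = _ , aux (G.outS j) refl , refl
      where
      aux : ∀ x (eq : G.outS j ≡ x) → end GG inn (passIn j x eq t) ≡ inj₁ (inj₂ (getInj₁ (G′.inT j) t))
      aux (inj₁ v) eq = cong (λ s → inj₁ (inj₂ (getInj₁ (G′.inT j) s))) (T-irrelevant _ t)
      aux (inj₂ r) eq = trans (cong [ _ , _ ]′ (G.io← r j eq)) (cong (⊎map₁ inj₂) (sym (getInj₁-spec (G′.inT j) t)))
    u-end out (inj₁ (inj₂ j , t)) = _ , aux (G′.inT j) refl , refl
      where
      aux : ∀ x (eq : G′.inT j ≡ x) → end GG out (passOut j x eq t) ≡ inj₁ (inj₁ (getInj₁ (G.outS j) t))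
      aux (inj₁ v) eq = cong (λ s → inj₁ (inj₁ (getInj₁ (G.outS j) s))) (T-irrelevant _ t)
      aux (inj₂ r) eq = trans (cong [ _ , _ ]′ (G′.io→ j r eq)) (cong (⊎map₁ inj₁) (sym (getInj₁-spec (G.outS j) t)))
    u-end out (inj₂ (inj₂ j , t)) with G′.outS j
    ... | inj₁ _ = _ , refl , refl

    u-surj : ∀ d x v → end GG d x ≡ inj₁ v → Σ _ λ h → u d h ≡ x
    u-surj inn (inj₁ (inj₁ (inj₁ e))) v _ = inj₁ (inj₁ e , tt) , refl
    u-surj inn (inj₁ (inj₁ (inj₂ e))) v _ = inj₂ (inj₁ e , tt) , refl
    u-surj out (inj₁ (inj₁ (inj₁ e))) v _ = inj₁ (inj₁ e , tt) , refl
    u-surj out (inj₁ (inj₁ (inj₂ e))) v _ = inj₂ (inj₁ e , tt) , refl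
    u-surj inn (inj₁ (inj₂ (j , p))) v _ = inj₂ (inj₂ j , ∧-snd _ _ p) , passIn-glue (G.outS j) refl _ (∧-fst _ _ p) p
    u-surj out (inj₁ (inj₂ (j , p))) v _ = inj₁ (inj₂ j , ∧-fst _ _ p) , passOut-glue (G′.inT j) refl _ (∧-snd _ _ p) p
    u-surj inn (inj₂ r) v q with G.inT r in eq
    ... | inj₁ w = inj₁ (inj₂ r , isInj₁-T eq) , refl
    ... | inj₂ j = inj₂ (inj₂ j , map-isInj₁ q) , passIn-out (G.outS j) refl _ (G.io→ r j eq)
    u-surj out (inj₂ j) v q with G′.outS j in eq
    ... | inj₁ w = inj₂ (inj₂ j , isInj₁-T eq) , refl
    ... | inj₂ i = inj₁ (inj₂ i , map-isInj₁ q) , passOut-out (G′.inT i) refl _ (G′.io← i j eq)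

    u-mono : ∀ d h h′ → at d Λ h ≡ at d Λ h′ → rank d Λ h < rank d Λ h′ → enc GG d (u d h) < enc GG d (u d h′)
    u-mono d h h′ _ lt = enc-mono GG d {u d h} {u d h′} (subst₂ _<_ (pre h) (pre h′) lt)
      where
      rank-forget : ∀ h → rank d Λ h ≡ [ enc G d , enc G′ d ]′ (forget d h)
      rank-forget (inj₁ _) = refl
      rank-forget (inj₂ _) = refl
      pre : ∀ h → rank d Λ h ≡ prerank GG d (u d h)
      pre h = trans (rank-forget h) (trans (cong [ enc G d , enc G′ d ]′ (sym (origin-u d h))) (sym (prerank-origin d (u d h))))

    flag-comm : ∀ v → flagᴾ GG (to ⊎-mid4 v) ≡ loop Λ v
    flag-comm (inj₁ (inj₁ _)) = refl
    flag-comm (inj₁ (inj₂ _)) = refl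
    flag-comm (inj₂ (inj₁ _)) = refl
    flag-comm (inj₂ (inj₂ _)) = refl

    open Into GG Λ ⊎-mid4 flag-comm u u-end
      (λ d {h} {h′} q → forget-inj d (trans (sym (origin-u d h)) (trans (cong (origin d) q) (origin-u d h′)))) u-surj u-mono

    R : Fin m ⊎ ⟦ H inn Λ ⟧ → Fin m ⊎ ⟦ H inn (vsᴾ GG) ⟧
    R = ⊎map id (to (fH into inn))

    input : ∀ r → to (π (𝔽 GG)) (inj₁ r) ≡ R (after (to (π (𝔽 G′))) (to (π (𝔽 G)) (inj₁ r)))
    input r with to (π (𝔽 G)) (inj₁ r) in eq
    ... | inj₂ (x , t) with 𝔽-in⁻ G eq
    ... | refl = 𝔽-in GG r _
    input r | inj₁ j with to (π (𝔽 G′)) (inj₁ j) in eq′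
    ... | inj₁ j′ = 𝔽-io GG (trans (cong [ _ , _ ]′ (𝔽-io⁻ G eq)) (cong (⊎map₁ inj₂) (𝔽-io⁻ G′ eq′)))
    ... | inj₂ (x , t) with 𝔽-in⁻ G′ eq′
    ... | refl = trans (𝔽-in GG r (subst (λ z → T (isInj₁ (end GG inn z))) pass (isInj₁-T (proj₁ (proj₂ (u-end inn (inj₂ (inj₂ j , t))))))))
                       (cong inj₂ (Sub-≡ _ (sym pass)))
      where pass = passIn-out (G.outS j) refl t (G.io→ r j (𝔽-io⁻ G eq))

    middle : ∀ j t → to (π (𝔽 GG)) (inj₂ (to (fH into out) (inj₁ (inj₂ j , t)))) ≡ R (after (to (π (𝔽 G′))) (inj₁ j))
    middle j t with to (π (𝔽 G′)) (inj₁ j) in eq′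
    ... | inj₁ j′ = cong (to (π (𝔽 GG))) (cong inj₂ (Sub-≡ _ {y = inj₂ j′ , subst (λ z → T (isInj₁ (end GG out z))) pass (isInj₁-T (proj₁ (proj₂ (u-end out (inj₁ (inj₂ j , t))))))} pass))
      where pass = passOut-out (G′.inT j) refl t (𝔽-io⁻ G′ eq′)
    ... | inj₂ (x , t′) with 𝔽-in⁻ G′ eq′
    ... | refl = trans (cong (to (π (𝔽 GG))) (cong inj₂ (Sub-≡ _ {y = inj₁ (inj₂ (j , T-∧ t t′)) , tt} (passOut-glue (G′.inT j) refl t t′ _))))
                       (cong inj₂ (Sub-≡ _ (sym (passIn-glue (G.outS j) refl t′ t _))))

  𝔽-⊚ : 𝔽 G′ ⊚ 𝔽 G ≈ 𝔽 (G′ ⊚P G)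
  𝔽-⊚ = record { vi = into ; comm = λ
    { (inj₁ r) → input r
    ; (inj₂ (inj₁ (inj₁ e , _))) → cong inj₂ (Sub-≡ _ refl)
    ; (inj₂ (inj₁ (inj₂ j , t))) → middle j t
    ; (inj₂ (inj₂ (inj₁ e , _))) → cong inj₂ (Sub-≡ _ refl)
    ; (inj₂ (inj₂ (inj₂ j , t))) → refl } }

𝔽-I₀ : 𝔽 I₀P ≈ wiring idᵇ
𝔽-I₀ = ≈-trans (proj₂ bare) (SMC.J-cong CG-SMC {f = proj₁ bare} {idᵇ} (λ ()))
  where bare = no-vertices (𝔽 I₀P) (λ { (inj₁ ()) ; (inj₂ ()) })

𝔽-I₁ : 𝔽 I₁P ≈ wiring idᵇ
𝔽-I₁ = ≈-trans (proj₂ bare) (SMC.J-cong CG-SMC {f = proj₁ bare} {idᵇ} only)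
  where
  bare = no-vertices (𝔽 I₁P) (λ { (inj₁ ()) ; (inj₂ ()) })
  only : proj₁ bare ≐ idᵇ
  only fzero with app (proj₁ bare) fzero
  ... | fzero = refl

-- The planar graph of a combinatorial graph

module Realize {k l : ℕ} (C : CG (Finᶠ k) (Finᶠ l)) where
  private
    Λ = vs C
    nV = card (V Λ)
    nO = card (H out Λ)
    vN : Fin nV → ⟦ V Λ ⟧
    vN = from (enum (V Λ))
    oN : Fin nO → O C
    oN = from (enum (H out Λ))
    looped : Fin nV → Bool
    looped n = loop Λ (vN n)
    isE : Fin nO → Bool
    isE n = isInj₂ (to (π C) (inj₂ (oN n)))
    Vᶜ Lᶜ Eᶜ : FinTy
    Vᶜ = FinTy.sub nV (λ n → not (looped n))
    Lᶜ = FinTy.sub nV looped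
    Eᶜ = FinTy.sub nO isE

  vtx : ∀ v → loop Λ v ≡ false → El Vᶜ
  vtx v p = to (enum (V Λ)) v , false-T (trans (cong (loop Λ) (from-to (enum (V Λ)) v)) p)

  private
    atᵥ : ∀ d → ⟦ H d Λ ⟧ → El Vᶜ
    atᵥ d h = vtx (at d Λ h) (loop-free d Λ h)

    tgtE : El Eᶜ → I C
    tgtE (n , t) = proj₁ (isInj₂-T t)

    classT : Fin l ⊎ I C → El Vᶜ ⊎ Fin l
    classT (inj₁ j) = inj₂ j
    classT (inj₂ i) = inj₁ (atᵥ inn i)
    classS : Fin k ⊎ O C → El Vᶜ ⊎ Fin k
    classS (inj₁ r) = inj₂ r
    classS (inj₂ o) = inj₁ (atᵥ out o)

    -- The value 0 is a placeholder for wires that end at an output index and so have no target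
    -- port; `rankS` treats wires from inputs likewise.
    rankT : Fin l ⊎ I C → ℕ
    rankT = [ (λ _ → 0) , rank inn Λ ]′
    rankS : Fin k ⊎ O C → ℕ
    rankS = [ (λ _ → 0) , rank out Λ ]′

    -- Every half-edge of the graph under construction is named by the source of its wire. Internal
    -- edges are the output ports whose wire ends at a port.
    originᶜ : ∀ d → El Eᶜ ⊎ Fin (arity k l d) → Fin k ⊎ O C
    originᶜ d   (inj₁ (n , _)) = inj₂ (oN n)
    originᶜ inn (inj₂ r) = inj₁ r
    originᶜ out (inj₂ j) = from (π C) (inj₁ j)

    classT-io : ∀ {x j} → classT x ≡ inj₂ j → x ≡ inj₁ j
    classT-io {inj₁ j} refl = refl
    classS-io : ∀ {x r} → classS x ≡ inj₂ r → x ≡ inj₁ r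
    classS-io {inj₁ r} refl = refl

  𝕌 : PGraph k l
  𝕌 = record
    { graph = record
      { V = Vᶜ ; E = Eᶜ ; L = Lᶜ ; s = λ e → atᵥ out (oN (proj₁ e)) ; t = λ e → atᵥ inn (tgtE e)
      ; inT = λ r → classT (to (π C) (inj₁ r)) ; outS = λ j → classS (from (π C) (inj₁ j))
      ; io→ = λ r j eq → cong classS (sym (to⇒from (π C) (classT-io eq)))
      ; io← = λ r j eq → cong classT (from⇒to (π C) (classS-io eq)) }
    ; inRank = λ x → rankT (to (π C) (originᶜ inn x))
    ; outRank = λ x → rankS (originᶜ out x) }

  private
    origin : ∀ d → Half 𝕌 d → Fin k ⊎ O C
    origin = originᶜ

    key : ∀ d → ⟦ H d Λ ⟧ → Fin k ⊎ O C
    key inn i = from (π C) (inj₂ i)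
    key out o = inj₂ o

    oE : ∀ o → T (isInj₂ (to (π C) (inj₂ o))) → El Eᶜ
    oE o t = to (enum (H out Λ)) o , subst (λ z → T (isInj₂ (to (π C) (inj₂ z)))) (sym (from-to (enum (H out Λ)) o)) t

    halfI : ∀ z → T (isInj₂ (to (π C) z)) → Half 𝕌 inn
    halfI (inj₁ r) t = inj₂ r
    halfI (inj₂ o) t = inj₁ (oE o t)

    origin-halfI : ∀ z t → origin inn (halfI z t) ≡ z
    origin-halfI (inj₁ r) t = refl
    origin-halfI (inj₂ o) t = cong inj₂ (from-to (enum (H out Λ)) o)

    halfO : ∀ o x → to (π C) (inj₂ o) ≡ x → Half 𝕌 out
    halfO o (inj₁ j) eq = inj₂ j
    halfO o (inj₂ i) eq = inj₁ (oE o (subst (λ z → T (isInj₂ z)) (sym eq) tt))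

    origin-halfO : ∀ o x eq → origin out (halfO o x eq) ≡ inj₂ o
    origin-halfO o (inj₁ j) eq = sym (to⇒from (π C) eq)
    origin-halfO o (inj₂ i) eq = cong inj₂ (from-to (enum (H out Λ)) o)

    u : ∀ d → ⟦ H d Λ ⟧ → Half 𝕌 d
    u inn i = halfI (from (π C) (inj₂ i)) (subst (λ z → T (isInj₂ z)) (sym (to-from (π C) (inj₂ i))) tt)
    u out o = halfO o _ refl

    origin-u : ∀ d h → origin d (u d h) ≡ key d h
    origin-u inn i = origin-halfI _ _
    origin-u out o = origin-halfO o _ refl

    oN-inj : ∀ {x y : El Eᶜ} → oN (proj₁ x) ≡ oN (proj₁ y) → x ≡ y
    oN-inj q = Sub-≡ isE (to-injective (↔-sym (enum (H out Λ))) q)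

    origin-inj : ∀ d x y → origin d x ≡ origin d y → x ≡ y
    origin-inj inn (inj₁ x) (inj₁ y) q = cong inj₁ (oN-inj (inj₂-injective q))
    origin-inj out (inj₁ x) (inj₁ y) q = cong inj₁ (oN-inj (inj₂-injective q))
    origin-inj inn (inj₂ x) (inj₂ y) q = cong inj₂ (inj₁-injective q)
    origin-inj out (inj₂ x) (inj₂ y) q = cong inj₂ (inj₁-injective (to-injective (↔-sym (π C)) q))
    origin-inj out (inj₁ (n , t)) (inj₂ j) q = ⊥-elim (subst (λ z → T (isInj₂ z)) (from⇒to (π C) (sym q)) t)
    origin-inj out (inj₂ j) (inj₁ (n , t)) q = ⊥-elim (subst (λ z → T (isInj₂ z)) (from⇒to (π C) q) t)

    u-unique : ∀ d h x → key d h ≡ origin d x → u d h ≡ x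
    u-unique d h x q = origin-inj d _ x (trans (origin-u d h) q)

    end-inn : ∀ x → end 𝕌 inn x ≡ classT (to (π C) (origin inn x))
    end-inn (inj₁ (n , t)) = cong classT (sym (proj₂ (isInj₂-T t)))
    end-inn (inj₂ r) = refl
    end-out : ∀ x → end 𝕌 out x ≡ classS (origin out x)
    end-out (inj₁ _) = refl
    end-out (inj₂ _) = refl

    key-inj : ∀ d {h h′} → key d h ≡ key d h′ → h ≡ h′
    key-inj inn q = inj₂-injective (to-injective (↔-sym (π C)) q)
    key-inj out q = inj₂-injective q

    fVᶜ : ⟦ V Λ ⟧ ↔ (El Vᶜ ⊎ El Lᶜ)
    fVᶜ = enum (V Λ) ⨟ ↔-sym (Sub-join looped) ⨟ ⊎-γ

  vtx-spec : ∀ v p → to fVᶜ v ≡ inj₁ (vtx v p)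
  vtx-spec v p = from⇒to fVᶜ (from-to (enum (V Λ)) v)

  private
    flag-comm : ∀ v → flagᴾ 𝕌 (to fVᶜ v) ≡ loop Λ v
    flag-comm v = trans (flagged (to fVᶜ v)) (cong (loop Λ) (from-to fVᶜ v))
      where
      flagged : ∀ x → flagᴾ 𝕌 x ≡ loop Λ (from fVᶜ x)
      flagged (inj₁ (n , t)) = sym (T-false t)
      flagged (inj₂ (n , t)) = sym (T-true t)

    u-end : ∀ d h → Σ _ λ v → end 𝕌 d (u d h) ≡ inj₁ v × to fVᶜ (at d Λ h) ≡ inj₁ v
    u-end inn i = _ , trans (end-inn (u inn i)) (cong classT (trans (cong (to (π C)) (origin-u inn i)) (to-from (π C) (inj₂ i)))) , vtx-spec _ _
    u-end out o = _ , trans (end-out (u out o)) (cong classS (origin-u out o)) , vtx-spec _ _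

    classT-port : ∀ {x v} → classT x ≡ inj₁ v → Σ _ λ i → x ≡ inj₂ i
    classT-port {inj₂ i} _ = i , refl
    classS-port : ∀ {x v} → classS x ≡ inj₁ v → Σ _ λ i → x ≡ inj₂ i
    classS-port {inj₂ i} _ = i , refl

    u-surj : ∀ d x v → end 𝕌 d x ≡ inj₁ v → Σ _ λ h → u d h ≡ x
    u-surj inn x v q with classT-port (trans (sym (end-inn x)) q)
    ... | i , eq = i , u-unique inn i x (sym (to⇒from (π C) eq))
    u-surj out x v q with classS-port (trans (sym (end-out x)) q)
    ... | o , eq = o , u-unique out o x (sym eq)

    pre : ∀ d h → rank d Λ h ≡ prerank 𝕌 d (u d h)
    pre inn i = cong rankT (sym (trans (cong (to (π C)) (origin-u inn i)) (to-from (π C) (inj₂ i))))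
    pre out o = cong rankS (sym (origin-u out o))

    open Into 𝕌 Λ fVᶜ flag-comm u u-end
      (λ d {h} {h′} q → key-inj d (trans (sym (origin-u d h)) (trans (cong (origin d) q) (origin-u d h′)))) u-surj
      (λ d h h′ _ lt → enc-mono 𝕌 d {u d h} {u d h′} (subst₂ _<_ (pre d h) (pre d h′) lt))

    input : ∀ r x → to (π C) (inj₁ r) ≡ x → to (π (𝔽 𝕌)) (inj₁ r) ≡ ⊎map id (to (fH into inn)) x
    input r (inj₁ j) eq = 𝔽-io 𝕌 (cong classT eq)
    input r (inj₂ i) eq = trans (𝔽-in 𝕌 r (subst (λ z → T (isInj₁ (end 𝕌 inn z))) same (proj₂ (to (fH into inn) i)))) (cong inj₂ (Sub-≡ _ (sym same)))
      where same = u-unique inn i (inj₂ r) (sym (to⇒from (π C) eq))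

    output : ∀ o x → to (π C) (inj₂ o) ≡ x → to (π (𝔽 𝕌)) (inj₂ (to (fH into out) o)) ≡ ⊎map id (to (fH into inn)) x
    output o (inj₁ j) eq = cong (to (π (𝔽 𝕌))) (cong inj₂ (Sub-≡ _
        {y = inj₂ j , subst (λ z → T (isInj₁ (end 𝕌 out z))) same (proj₂ (to (fH into out) o))} same))
      where same = u-unique out o (inj₂ j) (to⇒from (π C) eq)
    output o (inj₂ i) eq = trans (cong (to (π (𝔽 𝕌))) (cong inj₂ (Sub-≡ _ {y = inj₁ e , tt} (u-unique out o (inj₁ e) (cong inj₂ (sym back))))))
        (cong inj₂ (Sub-≡ _ (sym (u-unique inn i (inj₁ e) (trans (sym (to⇒from (π C) eq)) (cong inj₂ (sym back)))))))
      where e = oE o (subst (λ z → T (isInj₂ z)) (sym eq) tt)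
            back = from-to (enum (H out Λ)) o

  𝔽-𝕌 : C ≈ 𝔽 𝕌
  𝔽-𝕌 = record { vi = into ; comm = λ { (inj₁ r) → input r _ refl ; (inj₂ o) → output o _ refl } }

open Realize using (𝕌; 𝔽-𝕌; vtx)

-- Indecomposable graphs and atomic blocks

does-true : {A : Set} (d : Dec A) → Dec.does d ≡ true → A
does-true (yes a) _ = a

does-false : {A : Set} (d : Dec A) → Dec.does d ≡ false → ¬ A
does-false (no ¬a) _ = ¬a

Fin-empty : ∀ {n} → (Fin n → ⊥) → n ≡ 0
Fin-empty {zero} _ = refl
Fin-empty {suc n} f = ⊥-elim (f fzero)

-- The middle interface is renumbered by a `Fin n`, since indecomposability speaks of numbered
-- graphs only.
record Splitting {k l} (C : CG (Finᶠ k) (Finᶠ l)) (D : ⟦ V (vs C) ⟧ → Bool) : Set₁ where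
  field
    {n} : ℕ
    C₁ : CG (Finᶠ k) (Finᶠ n)
    C₂ : CG (Finᶠ n) (Finᶠ l)
    σ  : C₂ ⊚ C₁ ≈ C
    σ₁ : ∀ v → D (to (fV (vi σ)) (inj₁ v)) ≡ true
    σ₂ : ∀ v → D (to (fV (vi σ)) (inj₂ v)) ≡ false

splitting : ∀ {k l} (C : CG (Finᶠ k) (Finᶠ l)) D → Closed C D → Splitting C D
splitting C D closed = record
  { C₁ = wiring μ ⊚ first ; C₂ = second ⊚ wiring (symᵇ μ)
  ; σ = ≈-trans (⊚-assoc second (wiring (symᵇ μ)) (wiring μ ⊚ first)) (≈-trans (⊚-cong {D = second} ≈-refl (𝒢.J-cancelˡ μ first)) split)
  ; σ₁ = λ { (inj₁ v) → T-true (proj₂ v) ; (inj₂ ()) }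
  ; σ₂ = λ { (inj₁ ()) ; (inj₂ v) → T-false (proj₂ v) } }
  where
  open Split C D closed
  μ : Bij M (Finᶠ (card M))
  μ = prim (enum M)

module _ {k l : ℕ} (G : PGraph k l) where
  private module G = PGraph G

  decompose : ∀ {n} (C₂ : CG (Finᶠ n) (Finᶠ l)) (C₁ : CG (Finᶠ k) (Finᶠ n)) → C₂ ⊚ C₁ ≈ 𝔽 G → PIso G (𝕌 C₂ ⊚P 𝕌 C₁)
  decompose C₂ C₁ σ = 𝔽-full (≈-trans (≈-sym σ) (≈-trans (⊚-cong (𝔽-𝕌 C₂) (𝔽-𝕌 C₁)) (𝔽-⊚ (𝕌 C₂) (𝕌 C₁))))

  -- Both factors are realised as planar graphs, and the hypothesis excludes genuine vertices from
  -- one of them. As `G` has no loops, all vertices of the factors are genuine, so that factor is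
  -- empty.
  one-sided : (∀ {n} (G₁ : Graph n l) (G₂ : Graph k n) → GIso G.graph (G₁ ⊚G G₂) → Empty (El (Graph.V G₁)) ⊎ Empty (El (Graph.V G₂))) →
              Empty (El G.L) → ∀ D → Splitting (𝔽 G) D → (∀ v → D v ≡ false) ⊎ (∀ v → D v ≡ true)
  one-sided indec noL D 𝒮 = conclude (indec _ _ (PIso.giso (decompose C₂ C₁ σ)))
    where
    open Splitting 𝒮
    σ⁻ = from (fV (vi σ))
    real : ∀ v → flagᴾ G v ≡ false
    real (inj₁ v) = refl
    real (inj₂ x) = ⊥-elim (noL x)
    real′ : ∀ v → loop (vs C₁ ⊕ vs C₂) (σ⁻ v) ≡ false
    real′ v = trans (loop-comm (symᵛ (vi σ)) v) (real v)
    conclude : Empty (El (PGraph.V (𝕌 C₂))) ⊎ Empty (El (PGraph.V (𝕌 C₁))) → (∀ v → D v ≡ false) ⊎ (∀ v → D v ≡ true)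
    conclude (inj₁ none) = inj₂ λ v → trans (cong D (sym (to-from (fV (vi σ)) v))) (go (σ⁻ v) (real′ v))
      where
      go : ∀ w → loop (vs C₁ ⊕ vs C₂) w ≡ false → D (to (fV (vi σ)) w) ≡ true
      go (inj₁ w) _ = σ₁ w
      go (inj₂ w) q = ⊥-elim (none (vtx C₂ w q))
    conclude (inj₂ none) = inj₁ λ v → trans (cong D (sym (to-from (fV (vi σ)) v))) (go (σ⁻ v) (real′ v))
      where
      go : ∀ w → loop (vs C₁ ⊕ vs C₂) w ≡ false → D (to (fV (vi σ)) w) ≡ false
      go (inj₁ w) q = ⊥-elim (none (vtx C₁ w q))
      go (inj₂ w) _ = σ₂ w

  Indecomposable⇒Atomic : Indecomposable G.graph → Atomic (𝔽 G)
  Indecomposable⇒Atomic (inhabited , no-io , loops , ∘-indec , _) = record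
    { io-free = λ r j eq → no-io r j (𝔽-io⁻ G eq) ; vertex = vertex′ inhabited ; whole = whole′ inhabited loops }
    where
    vertex′ : ¬ Empty (El G.V) ⊎ SingleLoop G.graph → El G.V ⊎ El G.L
    vertex′ (inj₂ (_ , _ , _ , _ , x , _)) = inj₂ x
    vertex′ (inj₁ ne) with any? (Elᶠ G.V) (λ _ → yes tt)
    ... | yes (v , _) = inj₁ v
    ... | no none = ⊥-elim (ne (λ v → none (v , tt)))

    single : SingleLoop G.graph → ∀ (D : El G.V ⊎ El G.L → Bool) → (∀ v → D v ≡ false) ⊎ (∀ v → D v ≡ true)
    single (noV , _ , _ , _ , x , only) D with dec-Bool (D (inj₂ x))
    ... | inj₁ q = inj₂ λ { (inj₁ v) → ⊥-elim (noV v) ; (inj₂ y) → trans (cong (λ z → D (inj₂ z)) (only y)) q }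
    ... | inj₂ q = inj₁ λ { (inj₁ v) → ⊥-elim (noV v) ; (inj₂ y) → trans (cong (λ z → D (inj₂ z)) (only y)) q }

    whole′ : ¬ Empty (El G.V) ⊎ SingleLoop G.graph → Empty (El G.L) ⊎ SingleLoop G.graph →
             ∀ D → Closed (𝔽 G) D → (∀ v → D v ≡ false) ⊎ (∀ v → D v ≡ true)
    whole′ (inj₂ sl) _ D _ = single sl D
    whole′ (inj₁ _) (inj₂ sl) D _ = single sl D
    whole′ (inj₁ _) (inj₁ noL) D closed = one-sided ∘-indec noL D (splitting (𝔽 G) D closed)

  Closed-edges : ∀ (D : El G.V ⊎ El G.L → Bool) → (∀ e → T (D (inj₁ (G.t e))) → T (D (inj₁ (G.s e)))) → Closed (𝔽 G) D
  Closed-edges D p (inj₁ e , _) i refl t = p e t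
  Closed-edges D p (inj₂ j , _) i () t

  module _ (a : Atomic (𝔽 G)) where
    -- The side `true` is closed under predecessors, so atomicity applies to it. In a vertical as in
    -- a horizontal composite, `isInj₁` is a colouring of this kind.
    partition : ∀ {K : Graph k l} → GIso G.graph K → (χ : El (Graph.V K) → Bool) →
                (∀ e → T (χ (Graph.t K e)) → T (χ (Graph.s K e))) → (∀ w → χ w ≡ false) ⊎ (∀ w → χ w ≡ true)
    partition {K} i χ p with whole a D (Closed-edges D λ e t → subst (λ w → T (χ w)) (sym (GIso.s-comm i e)) (p _ (subst (λ w → T (χ w)) (GIso.t-comm i e) t)))
      where
      D : El G.V ⊎ El G.L → Bool
      D (inj₁ v) = χ (to (GIso.fV i) v)
      D (inj₂ _) = false
    ... | inj₁ q = inj₁ λ w → trans (cong χ (sym (to-from (GIso.fV i) w))) (q (inj₁ (from (GIso.fV i) w)))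
    ... | inj₂ q = inj₂ λ w → trans (cong χ (sym (to-from (GIso.fV i) w))) (q (inj₁ (from (GIso.fV i) w)))

    sides : ∀ {X Y : Set} → (∀ (w : X ⊎ Y) → isInj₁ w ≡ false) ⊎ (∀ (w : X ⊎ Y) → isInj₁ w ≡ true) → Empty X ⊎ Empty Y
    sides (inj₁ q) = inj₁ λ x → true≢false (q (inj₁ x))
    sides (inj₂ q) = inj₂ λ y → true≢false (sym (q (inj₂ y)))

    swap-sides : {X Y : Set} → Empty X ⊎ Empty Y → Empty Y ⊎ Empty X
    swap-sides (inj₁ x) = inj₂ x
    swap-sides (inj₂ x) = inj₁ x

    ∘-indecomposable : ∀ {n} (G₁ : Graph n l) (G₂ : Graph k n) → GIso G.graph (G₁ ⊚G G₂) → Empty (El (Graph.V G₁)) ⊎ Empty (El (Graph.V G₂))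
    ∘-indecomposable G₁ G₂ i = swap-sides (sides (partition {G₁ ⊚G G₂} i isInj₁ λ
      { (inj₁ (inj₁ e)) _ → tt ; (inj₁ (inj₂ e)) () ; (inj₂ _) () }))

    -- Edges end at vertices, so the set of all loops is closed: there are none, or there are no
    -- vertices. In the second case there is nothing for inputs, outputs or edges to be attached to,
    -- and each single loop is closed, hence everything.
    no-loops-or-single : Empty (El G.L) ⊎ SingleLoop G.graph
    no-loops-or-single with whole a (flagᴾ G) (Closed-edges (flagᴾ G) (λ _ ()))
    ... | inj₁ q = inj₁ λ x → true≢false (q (inj₂ x))
    ... | inj₂ q = inj₂ (noV , (λ e → noV (G.s e)) , Fin-empty noK , Fin-empty noL , only (vertex a))
      where
      noV : Empty (El G.V)
      noV v = true≢false (sym (q (inj₁ v)))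
      noK : Fin k → ⊥
      noK r with G.inT r in eq
      ... | inj₁ v = noV v
      ... | inj₂ j = io-free a r j (𝔽-io G eq)
      noL : Fin l → ⊥
      noL j with G.outS j in eq
      ... | inj₁ v = noV v
      ... | inj₂ r = noK r
      only : El G.V ⊎ El G.L → Σ (El G.L) λ x → ∀ y → y ≡ x
      only (inj₁ v) = ⊥-elim (noV v)
      only (inj₂ x) = x , λ y → decide y (whole a D (Closed-edges D λ e → ⊥-elim (noV (G.s e))))
        where
        _≟_ = _≟ᶠ_ {Elᶠ G.L}
        D : El G.V ⊎ El G.L → Bool
        D (inj₁ v) = false
        D (inj₂ y) = Dec.does (y ≟ x)
        decide : ∀ y → (∀ v → D v ≡ false) ⊎ (∀ v → D v ≡ true) → y ≡ x
        decide y (inj₁ n) = ⊥-elim (does-false (x ≟ x) (n (inj₂ x)) refl)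
        decide y (inj₂ t) = does-true (y ≟ x) (t (inj₂ y))

-- The arities of `G` are variables here, so that the two equations can be matched and the transport
-- disappears.
*-indecomposable : ∀ {k₁ k₂ l₁ l₂ k l} (G : PGraph k l) → Atomic (𝔽 G) → (G₁ : Graph k₁ l₁) (G₂ : Graph k₂ l₂) → ∀ σ τ
                   (ek : k₁ + k₂ ≡ k) (el : l₁ + l₂ ≡ l) → GIso (PGraph.graph G) (subst₂ Graph ek el ((σ ▷G (G₁ *G G₂)) ◁G τ)) →
                   Empty (El (Graph.V G₁)) ⊎ Empty (El (Graph.V G₂))
*-indecomposable G a G₁ G₂ σ τ refl refl i = sides G a (partition G a {(σ ▷G (G₁ *G G₂)) ◁G τ} i isInj₁ λ { (inj₁ e) _ → tt ; (inj₂ e) () })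

Atomic⇒Indecomposable : ∀ {k l} (G : PGraph k l) → Atomic (𝔽 G) → Indecomposable (PGraph.graph G)
Atomic⇒Indecomposable G a = inhabited (no-loops-or-single G a) , (λ r j eq → io-free a r j (𝔽-io G eq)) , no-loops-or-single G a ,
                            ∘-indecomposable G a , *-indecomposable G a
  where
  inhabited : Empty (El (PGraph.L G)) ⊎ SingleLoop (PGraph.graph G) → ¬ Empty (El (PGraph.V G)) ⊎ SingleLoop (PGraph.graph G)
  inhabited (inj₂ sl) = inj₂ sl
  inhabited (inj₁ noL) with vertex a
  ... | inj₁ v = inj₁ λ none → none v
  ... | inj₂ x = ⊥-elim (noL x)

-- Numbered interfaces

open Realize using (𝕌; 𝔽-𝕌)

IO-free-resp : ∀ {A B A′ B′} {f : Bij A A′} {g : Bij B B′} {C : CG A B} {C′ : CG A′ B′} → HIso f g C C′ → IO-free C → IO-free C′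
IO-free-resp {g = g} {C} {C′} θ io a b eq = io _ (from ⟪ g ⟫ b) (trans (comm (symʰ θ) (inj₁ a)) (cong (⊎map _ _) eq))

Atomic-HIso : ∀ {S T S′ T′} {s : Bij S S′} {t : Bij T T′} {X : CG S T} {X′ : CG S′ T′} → HIso s t X X′ → Atomic X → Atomic X′
Atomic-HIso θ a = Atomic-resp (symʰ θ) (IO-free-resp θ (io-free a)) a

enumᵇ : ∀ A → Bij A (Finᶠ (card A))
enumᵇ A = prim (enum A)

opaque
  -- Opaque because only `numbered-HIso` is used of it; the construction of `𝕌` is thus kept out of
  -- all later types.
  numbered : ∀ {A B} → CG A B → PGraph (card A) (card B)
  numbered {A} {B} C = 𝕌 (wiring (enumᵇ B) ⊚ C ⊚ wiring (symᵇ (enumᵇ A)))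

  numbered-HIso : ∀ {A B} (C : CG A B) → HIso (enumᵇ A) (enumᵇ B) C (𝔽 (numbered C))
  numbered-HIso {A} {B} C = reframe (λ _ → refl) (λ _ → refl)
    (transʰ (symʰ (relabelʳ C (symᵇ (enumᵇ A)))) (transʰ (relabelˡ _ (enumᵇ B)) (𝔽-𝕌 (wiring (enumᵇ B) ⊚ C ⊚ wiring (symᵇ (enumᵇ A))))))

Iᴾ : ∀ n → PGraph n n
Iᴾ zero = I₀P
Iᴾ (suc n) = I₁P *P Iᴾ n

𝔽-Iᴾ : ∀ n → 𝔽 (Iᴾ n) ≈ wiring idᵇ
𝔽-Iᴾ zero = 𝔽-I₀
𝔽-Iᴾ (suc n) = ≈-trans (≈-sym (𝒢.J-cancelʳ j (𝔽 (Iᴾ (suc n))))) (≈-trans (⊚-cong (≈-sym (square (𝔽-* I₁P (Iᴾ n)))) ≈-refl)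
  (≈-trans (⊚-cong (⊚-cong {D = wiring j} ≈-refl (≈-trans (⊛-cong 𝔽-I₁ (𝔽-Iᴾ n)) (wiring-⊛ idᵇ idᵇ))) ≈-refl)
  (≈-trans (⊚-cong (wiring-∘ j (idᵇ ⊎ᵇ idᵇ)) ≈-refl) (≈-trans (wiring-∘ _ (symᵇ j)) (SMC.J-cong CG-SMC {g = idᵇ} same)))))
  where
  j : Bij (Finᶠ 1 ⊎ᶠ Finᶠ n) (Finᶠ (suc n))
  j = prim (↔-sym +↔⊎)
  same : (symᵇ j ⨾ (idᵇ ⊎ᵇ idᵇ) ⨾ j) ≐ idᵇ
  same x = trans (cong (app j) (⊎-id (from ⟪ j ⟫ x))) (to-from ⟪ j ⟫ x)
    where
    ⊎-id : ∀ z → app (idᵇ {Finᶠ 1} ⊎ᵇ idᵇ {Finᶠ n}) z ≡ z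
    ⊎-id (inj₁ _) = refl
    ⊎-id (inj₂ _) = refl

wiring-HIso : ∀ {A B A′ B′} (f : Bij A B) (a : Bij A A′) (b : Bij B B′) (f′ : Bij A′ B′) → (∀ x → app f′ (app a x) ≡ app b (app f x)) →
              HIso a b (wiring f) (wiring f′)
wiring-HIso f a b f′ s = record { vi = idᵛ ; comm = λ { (inj₁ x) → cong inj₁ (s x) ; (inj₂ ()) } }

-- Expresses a layer through operations on planar graphs, in a form to which a ProP morphism can be
-- applied.
layer-HIso : ∀ {A S T} (X : CG S T) (R : FSet) (f : Bij A (S ⊎ᶠ R)) →
             HIso (enumᵇ A) (enumᵇ (T ⊎ᶠ R)) (layerᴳ X R f)
                  (𝔽 (numbered X *P Iᴾ (card R)) ⊚ wiring (prim (↔-sym (enum A) ⨟ ⟪ f ⟫ ⨟ enum (S ⊎ᶠ R))))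
layer-HIso {A} {S} {T} X R f = ⊚-congʰ {m = enumᵇ (S ⊎ᶠ R)}
  (wiring-HIso f (enumᵇ A) (enumᵇ (S ⊎ᶠ R)) (prim (↔-sym (enum A) ⨟ ⟪ f ⟫ ⨟ enum (S ⊎ᶠ R)))
    (λ x → cong (λ z → to (enum (S ⊎ᶠ R)) (app f z)) (from-to (enum A) x)))
  (reframe (λ _ → refl) (λ _ → refl) (transʰ
    (⊛-congʰ (numbered-HIso X) (transʰ (wiring-HIso (idᵇ {R}) (enumᵇ R) (enumᵇ R) idᵇ (λ _ → refl)) (≈-sym (𝔽-Iᴾ (card R)))))
    (𝔽-* (numbered X) (Iᴾ (card R)))))

-- The extension of an equivariant map to all planar graphs

module Extension {c ℓ m ℓm} {K : CommutativeRing c ℓ} (P : ProP K m ℓm)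
  (χ : ∀ {k l} (X : PGraph k l) → Indecomposable (PGraph.graph X) → ProP.Car P k l)
  (χ-iso : ∀ {k l} {X Y : PGraph k l} i j → PIso X Y → ProP._≋_ P (χ X i) (χ Y j))
  (χ-▷ : ∀ {k l} (σ : Permutation′ l) (X : PGraph k l) i j → ProP._≋_ P (χ (σ ▷P X) j) (ProP._▷_ P σ (χ X i)))
  (χ-◁ : ∀ {k l} (τ : Permutation′ k) (X : PGraph k l) i j → ProP._≋_ P (χ (X ◁P τ) j) (ProP._◁_ P (χ X i) τ))
  where
  open ProP P hiding (_∘_; _*_)
  open ProP P using () renaming (_∘_ to infixr 10 _∙_; _*_ to infixl 15 _⋆_)
  open Underlying P

  private
    -- Once the arities are identified, `X′` is isomorphic to `X` acted on by `g` and by the inverse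
    -- of `f`, so invariance and equivariance of `χ` combine. The intermediate graphs are shown
    -- indecomposable because `χ` asks for a proof.
    χ-HIso : ∀ {a b a′ b′} {f : Fin a ↔ Fin a′} {g : Fin b ↔ Fin b′} {X : PGraph a b} {X′ : PGraph a′ b′} i i′ →
             HIso (prim f) (prim g) (𝔽 X) (𝔽 X′) → JN g ∙ χ X i ≋ χ X′ i′ ∙ JN f
    χ-HIso {f = f} {g} i i′ θ = aux (↔⇒≡ f) (↔⇒≡ g) i i′ θ
      where
      aux : ∀ {a b a′ b′} → a ≡ a′ → b ≡ b′ → {f : Fin a ↔ Fin a′} {g : Fin b ↔ Fin b′} {X : PGraph a b} {X′ : PGraph a′ b′} →
            ∀ i i′ → HIso (prim f) (prim g) (𝔽 X) (𝔽 X′) → JN g ∙ χ X i ≋ χ X′ i′ ∙ JN f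
      aux refl refl {f} {g} {X} {X′} i i′ θ = ▷-JN g (χ X i) ▸ ≋-sym (◁-id _) ▸ ◁-cong (λ x → sym (from-to f x)) ≋-refl ▸ ≋-sym (◁-∘ (↔-sym f) f _) ▸
        ◁-cong {τ = f} (λ _ → refl) (≋-sym (χ-iso i′ j₂ iso ▸ χ-◁ (↔-sym f) (g ▷P X) j₁ j₂ ▸ ◁-cong (λ _ → refl) (χ-▷ g X i j₁))) ▸ ≋-sym (◁-JN f (χ X′ i′))
        where
        Y = (g ▷P X) ◁P ↔-sym f
        θ₁ = PH⇒HIso (▷-PH g X)
        θ₂ = PH⇒HIso (◁-PH (↔-sym f) (g ▷P X))
        a₁ = Atomic-HIso θ₁ (Indecomposable⇒Atomic X i)
        j₁ = Atomic⇒Indecomposable (g ▷P X) a₁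
        j₂ = Atomic⇒Indecomposable Y (Atomic-HIso θ₂ a₁)
        iso : PIso X′ Y
        iso = 𝔽-full (reframe (λ x → to-from f x) (λ x → to-from g x) (transʰ (symʰ θ) (transʰ θ₁ θ₂)))

    numbered-indec : ∀ {S T} (X : CG S T) → Atomic X → Indecomposable (PGraph.graph (numbered X))
    numbered-indec X a = Atomic⇒Indecomposable (numbered X) (Atomic-HIso (numbered-HIso X) a)

    φ : ∀ {S T} (X : CG S T) → Atomic X → Homᴾ S T
    φ X a = χ (numbered X) (numbered-indec X a)

    φ-nat : ∀ {S T S′ T′} {s : Bij S S′} {t : Bij T T′} {X : CG S T} {X′ : CG S′ T′} (a : Atomic X) (a′ : Atomic X′) →
            HIso s t X X′ → JN (num t) ∙ φ X a ≋ φ X′ a′ ∙ JN (num s)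
    φ-nat {X = X} {X′} a a′ θ = χ-HIso _ _ (reframe (λ _ → refl) (λ _ → refl) (transʰ (symʰ (numbered-HIso X)) (transʰ θ (numbered-HIso X′))))

  open Evaluation ProP-SMC φ φ-nat

  Φ : ∀ {k l} → PGraph k l → Car k l
  Φ G = proj₁ (Seq-total (𝔽 G))

  private
    Φ-seq : ∀ {k l} (G : PGraph k l) → Seq (𝔽 G , Φ G)
    Φ-seq G = proj₂ (Seq-total (𝔽 G))

    -- Any sequence for a graph isomorphic to `G` over relabelled interfaces computes `Φ G`.
    -- Compatibility with the actions and with `*` results by choosing the sequence.
    Φ-HIso : ∀ {A B k l} {f : Bij A (Finᶠ k)} {g : Bij B (Finᶠ l)} {C : CG A B} {p} (G : PGraph k l) → HIso f g C (𝔽 G) → Seq (C , p) →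
             JN (num g) ∙ p ≋ Φ G ∙ JN (num f)
    Φ-HIso {f = f} {g} G θ d = Seq-unique (Seq-∘ (Seq-J g) d) (Seq-∘J (Φ-seq G) f) (square θ)

    dropˡ : ∀ {k l} {f : Permutation′ l} (p : Car k l) → (∀ i → to f i ≡ i) → JN f ∙ p ≋ p
    dropˡ p s = ∘-cong (JN-id s) ≋-refl ▸ ∘-identityˡ p
    dropʳ : ∀ {k l} {f : Permutation′ k} (p : Car k l) → (∀ i → to f i ≡ i) → p ∙ JN f ≋ p
    dropʳ p s = ∘-cong ≋-refl (JN-id s) ▸ ∘-identityʳ p

  Φ-iso : ∀ {k l} {G H : PGraph k l} → PIso G H → Φ G ≋ Φ H
  Φ-iso {G = G} {H} i = Seq-unique (Φ-seq G) (Φ-seq H) (𝔽-iso i)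

  Φ-▷ : ∀ {k l} (σ : Permutation′ l) (G : PGraph k l) → Φ (σ ▷P G) ≋ σ ▷ Φ G
  Φ-▷ σ G = ≋-sym (≋-sym (▷-JN σ _) ▸ ∘-cong (JN-cong (λ _ → refl)) ≋-refl ▸ Φ-HIso (σ ▷P G) (PH⇒HIso (▷-PH σ G)) (Φ-seq G) ▸ dropʳ _ (λ _ → refl))

  Φ-◁ : ∀ {k l} (τ : Permutation′ k) (G : PGraph k l) → Φ (G ◁P τ) ≋ Φ G ◁ τ
  Φ-◁ τ G = ≋-sym (◁-id _) ▸ ◁-cong (λ x → sym (from-to τ x)) ≋-refl ▸ ≋-sym (◁-∘ (↔-sym τ) τ _) ▸ ◁-cong (λ _ → refl)
    (≋-sym (◁-JN (↔-sym τ) _) ▸ ∘-cong ≋-refl (JN-cong (λ _ → refl)) ▸ ≋-sym (Φ-HIso (G ◁P τ) (PH⇒HIso (◁-PH τ G)) (Φ-seq G)) ▸ dropˡ _ (λ _ → refl))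

  Φ-* : ∀ {k l k′ l′} (G : PGraph k l) (G′ : PGraph k′ l′) → Φ (G *P G′) ≋ Φ G ⋆ Φ G′
  Φ-* {k} {l} {k′} {l′} G G′ = ≋-sym (≋-sym (dropˡ _ (trivial l l′)) ▸ Φ-HIso (G *P G′) (𝔽-* G G′) (Seq-⊗ (Φ-seq G) (Φ-seq G′)) ▸ dropʳ _ (trivial k k′))
    where
    trivial : ∀ a b i → to (num {Finᶠ a ⊎ᶠ Finᶠ b} {Finᶠ (a + b)} (prim (↔-sym +↔⊎))) i ≡ i
    trivial a b i = trans (cong (join a b) (same (splitAt a i))) (to-from (↔-sym (+↔⊎ {a} {b})) i)
      where
      same : ∀ z → from (enum (Finᶠ a) ⊎-↔ enum (Finᶠ b)) z ≡ z
      same (inj₁ _) = refl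
      same (inj₂ _) = refl

  Φ-⊚ : ∀ {k l n} (G′ : PGraph l n) (G : PGraph k l) → Φ (G′ ⊚P G) ≋ Φ G′ ∙ Φ G
  Φ-⊚ G′ G = Seq-unique (Φ-seq (G′ ⊚P G)) (Seq-∘ (Φ-seq G′) (Φ-seq G)) (≈-sym (𝔽-⊚ G′ G))

  Φ-I₀ : Φ I₀P ≋ I₀
  Φ-I₀ = Seq-unique (Φ-seq I₀P) (Seq-J idᵇ) 𝔽-I₀ ▸ JN-id (λ _ → refl)

  Φ-I₁ : Φ I₁P ≋ I₁
  -- `Iₙ 1` is `I₁` times `I₀`, which the unit law reduces to `I₁`.
  Φ-I₁ = Seq-unique (Φ-seq I₁P) (Seq-J idᵇ) 𝔽-I₁ ▸ JN-id (λ _ → refl) ▸ *-identityʳ I₁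

  Φ-indecomposable : ∀ {k l} (X : PGraph k l) i → Φ X ≋ χ X i
  Φ-indecomposable X i = Seq-unique (Φ-seq X) (Seq-atom (𝔽 X , a)) ≈-refl ▸ χ-iso _ i (𝔽-full (reframe (λ _ → refl) (λ _ → refl) (symʰ (numbered-HIso (𝔽 X)))))
    where a = Indecomposable⇒Atomic X i

  -- `Ψ` is defined on `𝒫` only. The hypotheses state that factors of graphs in `𝒫` lie in `𝒫`, so
  -- `Ψ` can be evaluated on each layer of a sequence for such a graph.
  module Uniqueness (𝒫 : PGPred)
    (𝒫-iso : ∀ {k l} {G H : PGraph k l} → PIso G H → 𝒫 k l G → 𝒫 k l H)
    (𝒫-⊚ : ∀ {k l n} (G′ : PGraph l n) (G : PGraph k l) → 𝒫 k n (G′ ⊚P G) → 𝒫 l n G′ × 𝒫 k l G)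
    (𝒫-* : ∀ {k l k′ l′} (G : PGraph k l) (G′ : PGraph k′ l′) → 𝒫 (k + k′) (l + l′) (G *P G′) → 𝒫 k l G × 𝒫 k′ l′ G′)
    (𝒫-▷ : ∀ {k l} (σ : Permutation′ l) (G : PGraph k l) → 𝒫 k l (σ ▷P G) → 𝒫 k l G)
    (𝒫-◁ : ∀ {k l} (τ : Permutation′ k) (G : PGraph k l) → 𝒫 k l (G ◁P τ) → 𝒫 k l G)
    (Ψ : ∀ {k l} (G : PGraph k l) → 𝒫 k l G → Car k l)
    (Ψ-iso : ∀ {k l} {G H : PGraph k l} p q → PIso G H → Ψ G p ≋ Ψ H q)
    (Ψ-⊚ : ∀ {k l n} (G′ : PGraph l n) (G : PGraph k l) p q r → Ψ (G′ ⊚P G) r ≋ Ψ G′ p ∙ Ψ G q)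
    (Ψ-* : ∀ {k l k′ l′} (G : PGraph k l) (G′ : PGraph k′ l′) p q r → Ψ (G *P G′) r ≋ Ψ G p ⋆ Ψ G′ q)
    (Ψ-▷ : ∀ {k l} (σ : Permutation′ l) (G : PGraph k l) p q → Ψ (σ ▷P G) q ≋ σ ▷ Ψ G p)
    (Ψ-◁ : ∀ {k l} (τ : Permutation′ k) (G : PGraph k l) p q → Ψ (G ◁P τ) q ≋ Ψ G p ◁ τ)
    (Ψ-I₀ : ∀ p → Ψ I₀P p ≋ I₀) (Ψ-I₁ : ∀ p → Ψ I₁P p ≋ I₁)
    (Ψ-χ : ∀ {k l} (X : PGraph k l) i p → Ψ X p ≋ χ X i)
    where

    private
      Ψ-Iᴾ : ∀ n p → Ψ (Iᴾ n) p ≋ Iₙ n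
      Ψ-Iᴾ zero p = Ψ-I₀ p
      Ψ-Iᴾ (suc n) p with 𝒫-* I₁P (Iᴾ n) p
      ... | p₁ , p₂ = Ψ-* I₁P (Iᴾ n) p₁ p₂ p ▸ *-cong (Ψ-I₁ p₁) (Ψ-Iᴾ n p₂)

      Ψ-wires : ∀ {k l} (f : Fin k ↔ Fin l) (G : PGraph k l) p → wiring (prim f) ≈ 𝔽 G → Ψ G p ≋ JN f
      Ψ-wires f G p θ = aux (↔⇒≡ f) f G p θ
        where
        aux : ∀ {k l} → k ≡ l → (f : Fin k ↔ Fin l) (G : PGraph k l) → ∀ p → wiring (prim f) ≈ 𝔽 G → Ψ G p ≋ JN f
        aux {k} refl f G p θ = Ψ-iso p p′ iso ▸ Ψ-▷ f (Iᴾ k) p″ p′ ▸ ▷-cong (λ _ → refl) (Ψ-Iᴾ k p″) ▸ ≋-sym (JN-perm f)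
          where
          iso : PIso G (f ▷P Iᴾ k)
          iso = 𝔽-full (reframe (λ _ → refl) (λ x → to-from f x) (transʰ (≈-sym θ) (transʰ
            (wiring-HIso (prim f) idᵇ (prim (↔-sym f)) idᵇ (λ x → sym (from-to f x))) (transʰ (≈-sym (𝔽-Iᴾ k)) (PH⇒HIso (▷-PH f (Iᴾ k)))))))
          p′ = 𝒫-iso iso p
          p″ = 𝒫-▷ f (Iᴾ k) p′

      Ψ-step : ∀ {n o s t r} (f : Fin n ↔ Fin (s + r)) (G : PGraph n o) (H : PGraph (t + r) o) (X : PGraph s t) p →
               𝔽 G ≈ 𝔽 H ⊚ (𝔽 (X *P Iᴾ r) ⊚ wiring (prim f)) →
               Σ (𝒫 _ _ H) λ pH → Σ (𝒫 _ _ X) λ pX → Ψ G p ≋ Ψ H pH ∙ ((Ψ X pX ⋆ Iₙ r) ∙ JN f)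
      Ψ-step f G H X p θ = aux (↔⇒≡ f) f G H X p θ
        where
        aux : ∀ {n o s t r} → n ≡ s + r → (f : Fin n ↔ Fin (s + r)) (G : PGraph n o) (H : PGraph (t + r) o) (X : PGraph s t) → ∀ p →
              𝔽 G ≈ 𝔽 H ⊚ (𝔽 (X *P Iᴾ r) ⊚ wiring (prim f)) →
              Σ (𝒫 _ _ H) λ pH → Σ (𝒫 _ _ X) λ pX → Ψ G p ≋ Ψ H pH ∙ ((Ψ X pX ⋆ Iₙ r) ∙ JN f)
        aux {r = r} refl f G H X p θ = proj₁ p₁ , proj₁ p₃ ,
          (Ψ-iso p p′ iso ▸ Ψ-⊚ H ((X *P Iᴾ r) ◁P f) (proj₁ p₁) (proj₂ p₁) p′ ▸ ∘-cong ≋-refl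
            (Ψ-◁ f (X *P Iᴾ r) p₂ (proj₂ p₁) ▸ ◁-cong (λ _ → refl) (Ψ-* X (Iᴾ r) (proj₁ p₃) (proj₂ p₃) p₂ ▸ *-cong ≋-refl (Ψ-Iᴾ r (proj₂ p₃))) ▸ ≋-sym (◁-JN f _)))
          where
          iso : PIso G (H ⊚P ((X *P Iᴾ r) ◁P f))
          iso = 𝔽-full (≈-trans θ (≈-trans (⊚-cong {D = 𝔽 H} ≈-refl (reframe (λ x → from-to f x) (λ _ → refl)
            (transʰ (relabelʳ (𝔽 (X *P Iᴾ r)) (prim f)) (PH⇒HIso (◁-PH f (X *P Iᴾ r)))))) (𝔽-⊚ H ((X *P Iᴾ r) ◁P f))))
          p′ = 𝒫-iso iso p
          p₁ = 𝒫-⊚ H ((X *P Iᴾ r) ◁P f) p′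
          p₂ = 𝒫-◁ f (X *P Iᴾ r) (proj₂ p₁)
          p₃ = 𝒫-* X (Iᴾ r) p₂

      wires-HIso : ∀ {A B} {C : CG A B} (f : Bij A B) (G : PGraph (card A) (card B)) → HIso (enumᵇ A) (enumᵇ B) C (𝔽 G) → C ≈ wiring f →
                   wiring (prim (num f)) ≈ 𝔽 G
      wires-HIso {A} {B} {C} f G θ eq = reframe (λ x → to-from (enum A) x) (λ x → to-from (enum B) x)
        (transʰ {D = wiring f} {E = 𝔽 G} (wiring-HIso (prim (num f)) (symᵇ (enumᵇ A)) (symᵇ (enumᵇ B)) f (λ _ → sym (from-to (enum B) _)))
          (transʰ {D = C} {E = 𝔽 G} (≈-sym eq) θ))

      step-HIso : ∀ {A B S T R} {C : CG A B} (X : CG S T) (f : Bij A (S ⊎ᶠ R)) (h : CG (T ⊎ᶠ R) B) (G : PGraph (card A) (card B)) →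
                  HIso (enumᵇ A) (enumᵇ B) C (𝔽 G) → C ≈ h ⊚ layerᴳ X R f →
                  𝔽 G ≈ 𝔽 (numbered h) ⊚ (𝔽 (numbered X *P Iᴾ (card R)) ⊚ wiring (prim (num f)))
      step-HIso {A} {B} {S} {T} {R} {C} X f h G θ eq = reframe (λ x → to-from (enum A) x) (λ x → to-from (enum B) x)
        (transʰ {C = 𝔽 G} {D = C} {E = N} (symʰ {C = C} {D = 𝔽 G} θ) (transʰ {C = C} {D = h ⊚ layerᴳ X R f} {E = N} eq
          (⊚-congʰ {C = layerᴳ X R f} {D = h} {C′ = 𝔽 (numbered X *P Iᴾ (card R)) ⊚ wiring (prim (num f))} {D′ = 𝔽 (numbered h)} (layer-HIso X R f) (numbered-HIso h))))
        where N = 𝔽 (numbered h) ⊚ (𝔽 (numbered X *P Iᴾ (card R)) ⊚ wiring (prim (num f)))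

      -- Induction on the sequence: each layer is an expression in operations preserved by `Ψ`, and
      -- the remainder, once numbered, is again a graph in `𝒫`.
      Ψ-seq : ∀ {A B} {C : CG A B} {q} → Seq (C , q) → (G : PGraph (card A) (card B)) → ∀ p → HIso (enumᵇ A) (enumᵇ B) C (𝔽 G) → Ψ G p ≋ q
      Ψ-seq (wires f (eqC , eqq)) G p θ = Ψ-wires (num f) G p (wires-HIso f G θ eqC) ▸ ≋-sym eqq
      Ψ-seq {A} {B} (step {S} {T} (X , a) R f (h , q) d (eqC , eqq)) G p θ = proj₂ (proj₂ peeled) ▸
        ∘-cong (Ψ-seq d (numbered h) (proj₁ peeled) (numbered-HIso h))
          (∘-cong (*-cong (Ψ-χ (numbered X) (numbered-indec X a) (proj₁ (proj₂ peeled))) (≋-sym (JN-id (to-from (enum R))))) ≋-refl) ▸ ≋-sym eqq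
        where
        peeled : Σ (𝒫 (card T + card R) (card B) (numbered h)) λ pH → Σ (𝒫 (card S) (card T) (numbered X)) λ pX →
                 Ψ G p ≋ Ψ (numbered h) pH ∙ ((Ψ (numbered X) pX ⋆ Iₙ (card R)) ∙ JN (num f))
        peeled = Ψ-step (num f) G (numbered h) (numbered X) p (step-HIso X f h G θ eqC)

    Ψ≋Φ : ∀ {k l} (G : PGraph k l) p → Ψ G p ≋ Φ G
    Ψ≋Φ G p = Ψ-seq (Φ-seq G) G p (reframe (λ _ → refl) (λ _ → refl) ≈-refl)

-- Sorting

private
  boolℕ-mono : ∀ p q → (T p → T q) → boolℕ p ≤ boolℕ q
  boolℕ-mono false q _ = z≤n
  boolℕ-mono true true _ = ≤-refl
  boolℕ-mono true false i = ⊥-elim (i tt)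

  boolℕ-strict : ∀ p q → ¬ T p → T q → boolℕ p < boolℕ q
  boolℕ-strict false true _ _ = s≤s z≤n
  boolℕ-strict true q n _ = ⊥-elim (n tt)

  count : ∀ n → (Fin n → Bool) → ℕ
  count zero p = 0
  count (suc n) p = boolℕ (p fzero) + count n (λ i → p (fsuc i))

  count-mono : ∀ n {p q} → (∀ i → T (p i) → T (q i)) → count n p ≤ count n q
  count-mono zero _ = z≤n
  count-mono (suc n) i = +-mono-≤ (boolℕ-mono _ _ (i fzero)) (count-mono n (λ x → i (fsuc x)))

  count-strict : ∀ n {p q} → (∀ i → T (p i) → T (q i)) → ∀ x → ¬ T (p x) → T (q x) → count n p < count n q
  count-strict (suc n) i fzero np q = +-mono-≤ (boolℕ-strict _ _ np q) (count-mono n (λ x → i (fsuc x)))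
  count-strict (suc n) {p} {q} i (fsuc x) np qx = ≤-<-trans (+-mono-≤ (boolℕ-mono _ _ (i fzero)) ≤-refl)
    (+-monoʳ-< (boolℕ (q fzero)) (count-strict n (λ y → i (fsuc y)) x np qx))

  count-all : ∀ n → count n (λ _ → true) ≡ n
  count-all zero = refl
  count-all (suc n) = cong suc (count-all n)

-- If a value were missed, punching it out of the codomain would inject a finite set into a smaller
-- one.
injective⇒↔ : ∀ {n} (f : Fin n → Fin n) → (∀ {x y} → f x ≡ f y → x ≡ y) → Permutation′ n
injective⇒↔ {n} f inj = match f id inj id (λ x → f x , refl) hit
  where
  hit : ∀ y → Σ (Fin n) λ x → f x ≡ y
  hit y with anyᶠⁱⁿ? (λ x → f x ≟ᶠⁱⁿ y)
  ... | yes p = p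
  hit y | no ¬p = ⊥-elim (miss n f inj y (λ x q → ¬p (x , q)))
    where
    miss : ∀ n (f : Fin n → Fin n) → (∀ {x y} → f x ≡ f y → x ≡ y) → ∀ y → (∀ x → ¬ (f x ≡ y)) → ⊥
    miss (suc n) f inj y ne = <-irrefl refl (injective⇒≤ {f = λ x → punchOut (λ q → ne x (sym q))}
      (λ {a} {b} q → inj (punchOut-injective (λ q → ne a (sym q)) (λ q → ne b (sym q)) q)))

T-does : {A : Set} (d : Dec A) → A → T (Dec.does d)
T-does (yes _) _ = tt
T-does (no ¬a) a = ⊥-elim (¬a a)

-- The position of an element is the number of elements of smaller `ρ`.
sort : ∀ {n} (ρ : Fin n → ℕ) → (∀ {x y} → ρ x ≡ ρ y → x ≡ y) →
       Σ (Permutation′ n) λ τ → ∀ x y → ρ x < ρ y → toℕ (to τ x) < toℕ (to τ y)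
sort {n} ρ inj = injective⇒↔ position position-inj , position-mono
  where
  below : Fin n → Fin n → Bool
  below x y = Dec.does (ρ y <? ρ x)
  below-T : ∀ {x y} → T (below x y) → ρ y < ρ x
  below-T {x} {y} t = does-true (ρ y <? ρ x) (T-true t)
  T-below : ∀ {x y} → ρ y < ρ x → T (below x y)
  T-below {x} {y} lt = T-does (ρ y <? ρ x) lt
  bound : ∀ x → count n (below x) < n
  bound x = subst (count n (below x) <_) (count-all n) (count-strict n (λ _ _ → tt) x (λ t → <-irrefl refl (below-T {x} {x} t)) tt)
  position : Fin n → Fin n
  position x = fromℕ< (bound x)
  position-mono : ∀ x y → ρ x < ρ y → toℕ (position x) < toℕ (position y)
  position-mono x y lt = subst₂ _<_ (sym (toℕ-fromℕ< (bound x))) (sym (toℕ-fromℕ< (bound y)))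
    (count-strict n (λ z t → T-below {y} {z} (<-trans (below-T {x} {z} t) lt)) x (λ t → <-irrefl refl (below-T {x} {x} t)) (T-below {y} {x} lt))
  position-inj : ∀ {x y} → position x ≡ position y → x ≡ y
  position-inj {x} {y} q with <-cmp (ρ x) (ρ y)
  ... | tri< lt _ _ = ⊥-elim (<-irrefl (cong toℕ q) (position-mono x y lt))
  ... | tri≈ _ eq _ = inj eq
  ... | tri> _ _ gt = ⊥-elim (<-irrefl (cong toℕ (sym q)) (position-mono y x gt))

monotone⇒inflationary : ∀ {n} (f : Fin n → Fin n) → (∀ x y → toℕ x < toℕ y → toℕ (f x) < toℕ (f y)) → ∀ x → toℕ x ≤ toℕ (f x)
monotone⇒inflationary {n} f mono x = go (toℕ x) x refl
  where
  go : ∀ m x → toℕ x ≡ m → m ≤ toℕ (f x)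
  go zero x _ = z≤n
  go (suc m) x eq = ≤-trans (s≤s (go m x′ eq′)) (mono x′ x (subst₂ _<_ (sym eq′) (sym eq) ≤-refl))
    where
    m<n : m < n
    m<n = <-trans (subst (m <_) (sym eq) ≤-refl) (toℕ<n x)
    x′ = fromℕ< m<n
    eq′ = toℕ-fromℕ< m<n

-- The composite of `τ′` with the inverse of `τ` is increasing, and so is its inverse. Both are
-- inflationary, which leaves only the identity.
same-order⇒≈ : ∀ {n} (τ τ′ : Permutation′ n) → (∀ x y → toℕ (to τ x) < toℕ (to τ y) → toℕ (to τ′ x) < toℕ (to τ′ y)) → τ ≈ₚ τ′
same-order⇒≈ τ τ′ s x = toℕ-injective (≤-antisym
  (subst (λ z → toℕ (to τ x) ≤ toℕ (to τ′ z)) (from-to τ x) (monotone⇒inflationary (λ y → to τ′ (from τ y)) forward (to τ x)))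
  (subst (λ z → toℕ (to τ′ x) ≤ toℕ (to τ z)) (from-to τ′ x) (monotone⇒inflationary (λ y → to τ (from τ′ y)) backward (to τ′ x))))
  where
  forward : ∀ a b → toℕ a < toℕ b → toℕ (to τ′ (from τ a)) < toℕ (to τ′ (from τ b))
  forward a b lt = s _ _ (subst₂ (λ u v → toℕ u < toℕ v) (sym (to-from τ a)) (sym (to-from τ b)) lt)
  backward : ∀ a b → toℕ a < toℕ b → toℕ (to τ (from τ′ a)) < toℕ (to τ (from τ′ b))
  backward a b lt with <-cmp (toℕ (to τ (from τ′ a))) (toℕ (to τ (from τ′ b)))
  ... | tri< r _ _ = r
  ... | tri≈ _ e _ = ⊥-elim (<-irrefl (cong toℕ (to-injective (↔-sym τ′) (to-injective τ (toℕ-injective e)))) lt)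
  ... | tri> _ _ g = ⊥-elim (<-asym lt (subst₂ (λ u v → toℕ u < toℕ v) (to-from τ′ b) (to-from τ′ a) (s _ _ g)))

-- Corollas

corolla : ∀ {k l} → Permutation′ l → Permutation′ k → PGraph k l
corolla {k} {l} σ τ = (σ ▷P PG k l) ◁P τ

corolla-in-mono : ∀ {k l} (σ : Permutation′ l) (τ : Permutation′ k) {r r′} → toℕ (to τ r) < toℕ (to τ r′) →
                  enc (corolla σ τ) inn (inj₂ r) < enc (corolla σ τ) inn (inj₂ r′)
corolla-in-mono {k} {l} σ τ {r} {r′} lt = enc-mono (corolla σ τ) inn {inj₂ r} {inj₂ r′} (enc-mono (σ ▷P PG k l) inn {inj₂ (to τ r)} {inj₂ (to τ r′)} lt)

corolla-out-mono : ∀ {k l} (σ : Permutation′ l) (τ : Permutation′ k) {j j′} → toℕ (from σ j) < toℕ (from σ j′) →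
                   enc (corolla σ τ) out (inj₂ j) < enc (corolla σ τ) out (inj₂ j′)
corolla-out-mono {k} {l} σ τ {j} {j′} lt = enc-mono (corolla σ τ) out {inj₂ j} {inj₂ j′} (enc-mono (PG k l) out {inj₂ (from σ j)} {inj₂ (from σ j′)} lt)

-- Describes corollas without mentioning permutations, which makes them decidable and recognisable
-- in the acyclic case.
record SingleVertex {k l} (G : PGraph k l) : Set where
  field
    centre  : El (PGraph.V G)
    only    : ∀ v → v ≡ centre
    no-edge : Empty (El (PGraph.E G))
    no-loop : Empty (El (PGraph.L G))
    no-io   : NoIO (PGraph.graph G)

module _ {k l : ℕ} (G : PGraph k l) where
  private module G = PGraph G

  SingleVertex⇒Corolla : SingleVertex G → CorollaPG k l G
  SingleVertex⇒Corolla sv = σ , τ , PH⇒PIso (record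
    { gV = mk↔ₛ′ (λ _ → fzero) (λ _ → centre) (λ { fzero → refl ; (fsuc ()) }) (λ v → sym (only v))
    ; gE = mk↔ₛ′ (λ e → ⊥-elim (no-edge e)) (λ ()) (λ ()) (λ e → ⊥-elim (no-edge e))
    ; gL = mk↔ₛ′ (λ e → ⊥-elim (no-loop e)) (λ ()) (λ ()) (λ e → ⊥-elim (no-loop e))
    ; end-comm = λ { d (inj₁ e) → ⊥-elim (no-edge e) ; inn (inj₂ r) → cin (G.inT r) refl ; out (inj₂ j) → cout (G.outS j) refl }
    ; monotone = λ { d (inj₁ e) → ⊥-elim (no-edge e) ; d (inj₂ _) (inj₁ e) → ⊥-elim (no-edge e)
                   ; inn (inj₂ r) (inj₂ r′) v _ _ lt → corolla-in-mono σ τ (proj₂ sortIn r r′ lt)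
                   ; out (inj₂ j) (inj₂ j′) v _ _ lt → corolla-out-mono σ τ (proj₂ sortOut j j′ lt) } })
    where
    open SingleVertex sv
    sortIn = sort (λ r → enc G inn (inj₂ r)) (λ q → inj₂-injective (enc-injective G inn q))
    sortOut = sort (λ r → enc G out (inj₂ r)) (λ q → inj₂-injective (enc-injective G out q))
    -- Input `r` of `PG · τ` stands at place `τ r` of the order at the vertex, so `τ` is the sorting
    -- permutation itself. Output `j` of `σ · PG` stands at the place given by the inverse of `σ`,
    -- hence the inverse below.
    τ = proj₁ sortIn
    σ = ↔-sym (proj₁ sortOut)
    cin : ∀ {r} x → G.inT r ≡ x → inj₁ fzero ≡ ⊎map (λ _ → fzero) id x
    cin (inj₁ v) _ = refl
    cin (inj₂ j) eq = ⊥-elim (no-io _ j eq)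
    cout : ∀ {j} x → G.outS j ≡ x → inj₁ fzero ≡ ⊎map (λ _ → fzero) id x
    cout (inj₁ v) _ = refl
    cout (inj₂ r) eq = ⊥-elim (no-io r _ (G.io← r _ eq))

  Corolla⇒SingleVertex : CorollaPG k l G → SingleVertex G
  Corolla⇒SingleVertex (σ , τ , i) = record
    { centre = from (GIso.fV giso) fzero ; only = λ v → to-injective (GIso.fV giso) (fin1 _ _)
    ; no-edge = λ e → fin0 (to (GIso.fE giso) e) ; no-loop = λ e → fin0 (to (GIso.fL giso) e)
    ; no-io = λ r j eq → inj₁≢inj₂ (trans (GIso.inT-comm giso r) (cong (⊎map₁ _) eq)) }
    where
    open PIso i using (giso)
    fin0 : Fin 0 → ⊥
    fin0 ()
    fin1 : (x y : Fin 1) → x ≡ y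
    fin1 fzero fzero = refl

  Corolla? : Dec (CorollaPG k l G)
  Corolla? with any? (Elᶠ G.V) (λ v → all? (Elᶠ G.V) (λ w → _≟ᶠ_ {Elᶠ G.V} w v)) | any? (Elᶠ G.E) (λ _ → yes tt) | any? (Elᶠ G.L) (λ _ → yes tt)
            | any? (Finᶠ k) (λ r → any? (Finᶠ l) (λ j → io? (G.inT r) j))
    where
    io? : ∀ (x : El G.V ⊎ Fin l) j → Dec (x ≡ inj₂ j)
    io? (inj₁ _) j = no λ ()
    io? (inj₂ i) j with i ≟ᶠⁱⁿ j
    ... | yes refl = yes refl
    ... | no ne = no λ { refl → ne refl }
  ... | yes (v , o) | no ne | no nl | no ni = yes (SingleVertex⇒Corolla (record { centre = v ; only = o ; no-edge = λ e → ne (e , tt) ; no-loop = λ e → nl (e , tt) ; no-io = λ r j eq → ni (r , j , eq) }))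
  ... | no nv | _ | _ | _ = no λ c → let open SingleVertex (Corolla⇒SingleVertex c) in nv (centre , only)
  ... | yes _ | yes (e , _) | _ | _ = no λ c → let open SingleVertex (Corolla⇒SingleVertex c) in no-edge e
  ... | yes _ | no _ | yes (e , _) | _ = no λ c → let open SingleVertex (Corolla⇒SingleVertex c) in no-loop e
  ... | yes _ | no _ | no _ | yes (r , j , eq) = no λ c → let open SingleVertex (Corolla⇒SingleVertex c) in no-io r j eq

-- The presentation by `σ` and `τ` as an isomorphism over relabelled indices; further actions then
-- merely compose bijections. Inputs are relabelled by the inverse of `τ`, as in the definition of
-- the right action.
CorollaHIso : ∀ {k l} (σ : Permutation′ l) (τ : Permutation′ k) (G : PGraph k l) → Set
CorollaHIso {k} {l} σ τ G = HIso (prim (↔-sym τ)) (prim σ) (𝔽 (PG k l)) (𝔽 G)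

corolla-HIso : ∀ {k l} (σ : Permutation′ l) (τ : Permutation′ k) → CorollaHIso σ τ (corolla σ τ)
corolla-HIso {k} {l} σ τ = reframe (λ _ → refl) (λ _ → refl) (transʰ (PH⇒HIso (▷-PH σ (PG k l))) (PH⇒HIso (◁-PH τ (σ ▷P PG k l))))

PIso⇒CorollaHIso : ∀ {k l} {σ : Permutation′ l} {τ : Permutation′ k} {G : PGraph k l} → PIso G (corolla σ τ) → CorollaHIso σ τ G
PIso⇒CorollaHIso {σ = σ} {τ} {G} i = reframe (λ _ → refl) (λ _ → refl) (transʰ (corolla-HIso σ τ) (≈-sym (𝔽-iso i)))

CorollaHIso⇒PIso : ∀ {k l} {σ : Permutation′ l} {τ : Permutation′ k} {G : PGraph k l} → CorollaHIso σ τ G → PIso G (corolla σ τ)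
CorollaHIso⇒PIso {σ = σ} {τ} {G} θ = 𝔽-full (reframe (λ x → from-to τ x) (λ x → to-from σ x) (transʰ (symʰ θ) (corolla-HIso σ τ)))

-- The reason for freeness: an isomorphism fixes the indices and preserves the two orders at the
-- vertex, and these orders determine `τ` and `σ`.
corolla-unique : ∀ {k l} {σ σ′ : Permutation′ l} {τ τ′ : Permutation′ k} → PIso (corolla σ τ) (corolla σ′ τ′) → σ ≈ₚ σ′ × τ ≈ₚ τ′
corolla-unique {σ = σ} {σ′} {τ} {τ′} i = invert-≈ (same-order⇒≈ (↔-sym σ) (↔-sym σ′) outs) , same-order⇒≈ τ τ′ ins
  where
  open PH (PIso⇒PH i)
  invert-≈ : (∀ x → from σ x ≡ from σ′ x) → σ ≈ₚ σ′
  invert-≈ s x = trans (sym (to-from σ′ (to σ x))) (cong (to σ′) (trans (sym (s (to σ x))) (from-to σ x)))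
  ins : ∀ x y → toℕ (to τ x) < toℕ (to τ y) → toℕ (to τ′ x) < toℕ (to τ′ y)
  ins x y lt with <-cmp (toℕ (to τ′ x)) (toℕ (to τ′ y))
  ... | tri< r _ _ = r
  ... | tri≈ _ e _ = ⊥-elim (<-irrefl (cong (λ z → toℕ (to τ z)) (to-injective τ′ (toℕ-injective e))) lt)
  ... | tri> _ _ g = ⊥-elim (<-asym (corolla-in-mono σ′ τ′ g) (monotone inn (inj₂ x) (inj₂ y) fzero refl refl (corolla-in-mono σ τ lt)))
  outs : ∀ x y → toℕ (from σ x) < toℕ (from σ y) → toℕ (from σ′ x) < toℕ (from σ′ y)
  outs x y lt with <-cmp (toℕ (from σ′ x)) (toℕ (from σ′ y))
  ... | tri< r _ _ = r
  ... | tri≈ _ e _ = ⊥-elim (<-irrefl (cong (λ z → toℕ (from σ z)) (to-injective (↔-sym σ′) (toℕ-injective e))) lt)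
  ... | tri> _ _ g = ⊥-elim (<-asym (corolla-out-mono σ′ τ′ g) (monotone out (inj₂ x) (inj₂ y) fzero refl refl (corolla-out-mono σ τ lt)))

Corolla-iso : ∀ {k l} {G H : PGraph k l} → PIso G H → CorollaPG k l G → CorollaPG k l H
Corolla-iso i (σ , τ , j) = σ , τ , CorollaHIso⇒PIso (reframe (λ _ → refl) (λ _ → refl) (transʰ (PIso⇒CorollaHIso {σ = σ} {τ} j) (𝔽-iso i)))

▷-CorollaHIso : ∀ {k l} (ς : Permutation′ l) {σ : Permutation′ l} {τ : Permutation′ k} {G : PGraph k l} → CorollaHIso σ τ G → CorollaHIso (σ ∘ₚ ς) τ (ς ▷P G)
▷-CorollaHIso ς {G = G} θ = reframe (λ _ → refl) (λ _ → refl) (transʰ θ (PH⇒HIso (▷-PH ς G)))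

◁-CorollaHIso : ∀ {k l} (ς : Permutation′ k) {σ : Permutation′ l} {τ : Permutation′ k} {G : PGraph k l} → CorollaHIso σ τ G → CorollaHIso σ (ς ∘ₚ τ) (G ◁P ς)
◁-CorollaHIso ς {G = G} θ = reframe (λ _ → refl) (λ _ → refl) (transʰ θ (PH⇒HIso (◁-PH ς G)))

▷-Corolla : ∀ {k l} (ς : Permutation′ l) {G : PGraph k l} → CorollaPG k l G → CorollaPG k l (ς ▷P G)
▷-Corolla ς (σ , τ , i) = σ ∘ₚ ς , τ , CorollaHIso⇒PIso (▷-CorollaHIso ς {σ} {τ} (PIso⇒CorollaHIso i))

◁-Corolla : ∀ {k l} (ς : Permutation′ k) {G : PGraph k l} → CorollaPG k l G → CorollaPG k l (G ◁P ς)
◁-Corolla ς (σ , τ , i) = σ , ς ∘ₚ τ , CorollaHIso⇒PIso (◁-CorollaHIso ς {σ} {τ} (PIso⇒CorollaHIso i))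

▷-inverse : ∀ {k l} (ς : Permutation′ l) (G : PGraph k l) → PIso (↔-sym ς ▷P (ς ▷P G)) G
▷-inverse ς G = 𝔽-full (≈-sym (reframe (λ _ → refl) (λ x → from-to ς x) (transʰ (PH⇒HIso (▷-PH ς G)) (PH⇒HIso (▷-PH (↔-sym ς) (ς ▷P G))))))

◁-inverse : ∀ {k l} (ς : Permutation′ k) (G : PGraph k l) → PIso ((G ◁P ς) ◁P ↔-sym ς) G
◁-inverse ς G = 𝔽-full (≈-sym (reframe (λ x → to-from ς x) (λ _ → refl) (transʰ (PH⇒HIso (◁-PH ς G)) (PH⇒HIso (◁-PH (↔-sym ς) (G ◁P ς))))))

Corolla⇒Indecomposable : ∀ {k l} {G : PGraph k l} → CorollaPG k l G → IndPG k l G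
Corolla⇒Indecomposable {k} {l} {G} (σ , τ , i) = Atomic⇒Indecomposable G (Atomic-HIso (PIso⇒CorollaHIso {σ = σ} {τ} i) record
  { io-free = λ r j eq → inj₁≢inj₂ (𝔽-io⁻ (PG k l) {r} eq) ; vertex = inj₁ fzero ; whole = λ D _ → cases D (dec-Bool (D (inj₁ fzero))) })
  where
  cases : (D : Fin 1 ⊎ Fin 0 → Bool) → (D (inj₁ fzero) ≡ true) ⊎ (D (inj₁ fzero) ≡ false) → (∀ v → D v ≡ false) ⊎ (∀ v → D v ≡ true)
  cases D (inj₁ q) = inj₂ λ { (inj₁ fzero) → q ; (inj₁ (fsuc ())) ; (inj₂ ()) }
  cases D (inj₂ q) = inj₁ λ { (inj₁ fzero) → q ; (inj₁ (fsuc ())) ; (inj₂ ()) }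

-- Cycles

map-Walk : ∀ {k l k′ l′} {G : Graph k l} {H : Graph k′ l′} (f : El (Graph.V G) → El (Graph.V H)) (g : El (Graph.E G) → El (Graph.E H)) →
           (∀ e → Graph.s H (g e) ≡ f (Graph.s G e)) → (∀ e → Graph.t H (g e) ≡ f (Graph.t G e)) → ∀ {u w} → Walk G u w → Walk H (f u) (f w)
map-Walk f g s t (one e p q) = one (g e) (trans (s e) (cong f p)) (trans (t e) (cong f q))
map-Walk {H = H} f g s t (cons e {w = w} p r) = cons (g e) (trans (s e) (cong f p)) (subst (λ z → Walk H z (f w)) (sym (t e)) (map-Walk f g s t r))

Acyclic-iso : ∀ {k l} {G H : PGraph k l} → PIso G H → AcyclicPG k l G → AcyclicPG k l H
Acyclic-iso {G = G} {H} i (nc , nl) = (λ { (v , w) → nc (_ , map-Walk (from (GIso.fV giso)) (from fE)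
    (λ e → to⇒from (GIso.fV giso) (trans (s-comm _) (cong (PGraph.s H) (to-from fE e))))
    (λ e → to⇒from (GIso.fV giso) (trans (GIso.t-comm giso _) (cong (PGraph.t H) (to-from fE e)))) w) }) , (λ x → nl (from fL x))
  where open PIso i
        open GIso giso hiding (fV; t-comm)

Acyclic-⊚ : ∀ {k l n} (G′ : PGraph l n) (G : PGraph k l) → AcyclicPG k n (G′ ⊚P G) → AcyclicPG l n G′ × AcyclicPG k l G
Acyclic-⊚ G′ G (nc , nl) =
  ((λ { (v , w) → nc (_ , map-Walk inj₂ (λ e → inj₁ (inj₂ e)) (λ _ → refl) (λ _ → refl) w) }) , λ x → nl (inj₂ x)) ,
  ((λ { (v , w) → nc (_ , map-Walk inj₁ (λ e → inj₁ (inj₁ e)) (λ _ → refl) (λ _ → refl) w) }) , λ x → nl (inj₁ x))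

Acyclic-* : ∀ {k l k′ l′} (G : PGraph k l) (G′ : PGraph k′ l′) → AcyclicPG (k + k′) (l + l′) (G *P G′) → AcyclicPG k l G × AcyclicPG k′ l′ G′
Acyclic-* G G′ (nc , nl) =
  ((λ { (v , w) → nc (_ , map-Walk inj₁ inj₁ (λ _ → refl) (λ _ → refl) w) }) , λ x → nl (inj₁ x)) ,
  ((λ { (v , w) → nc (_ , map-Walk inj₂ inj₂ (λ _ → refl) (λ _ → refl) w) }) , λ x → nl (inj₂ x))

Acyclic-▷ : ∀ {k l} (σ : Permutation′ l) (G : PGraph k l) → AcyclicPG k l (σ ▷P G) → AcyclicPG k l G
Acyclic-▷ σ G (nc , nl) = (λ { (v , w) → nc (v , map-Walk id id (λ _ → refl) (λ _ → refl) w) }) , nl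

Acyclic-◁ : ∀ {k l} (τ : Permutation′ k) (G : PGraph k l) → AcyclicPG k l (G ◁P τ) → AcyclicPG k l G
Acyclic-◁ τ G (nc , nl) = (λ { (v , w) → nc (v , map-Walk id id (λ _ → refl) (λ _ → refl) w) }) , nl

-- If every vertex has a predecessor, walking backwards eventually closes a cycle.
module Backwards {k l} (G : PGraph k l) (start : El (PGraph.V G))
                 (pred : ∀ v → Σ (El (PGraph.E G)) λ e → PGraph.t G e ≡ v) where
  private
    module G = PGraph G
    walk : ℕ → El G.V
    walk zero = start
    walk (suc n) = G.s (proj₁ (pred (walk n)))

    -- Indices count steps backwards, so the walk leads from the larger index to the smaller.
    path : ∀ i d → Walk G.graph (walk (suc d + i)) (walk i)
    path i zero = one (proj₁ (pred (walk i))) refl (proj₂ (pred (walk i)))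
    path i (suc d) = cons (proj₁ (pred (walk (suc d + i)))) refl
      (subst (λ v → Walk G.graph v (walk i)) (sym (proj₂ (pred (walk (suc d + i))))) (path i d))

  cycle : HasCycle G.graph
  -- One position more than there are vertices forces a repetition.
  cycle with pigeonhole (≤-refl {suc (card (Elᶠ G.V))}) (λ i → to (enum (Elᶠ G.V)) (walk (toℕ i)))
  ... | i , j , i<j , eq = walk (toℕ i) , subst (λ v → Walk G.graph v (walk (toℕ i))) closes (path (toℕ i) (toℕ j ∸ suc (toℕ i)))
    where
    closes : walk (suc (toℕ j ∸ suc (toℕ i)) + toℕ i) ≡ walk (toℕ i)
    closes = trans (cong walk (trans (cong suc (+-comm (toℕ j ∸ suc (toℕ i)) (toℕ i))) (m+[n∸m]≡n i<j))) (sym (to-injective (enum (Elᶠ G.V)) eq))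

Acyclic-Indecomposable⇒Corolla : ∀ {k l} (G : PGraph k l) → AcyclicPG k l G → IndPG k l G → CorollaPG k l G
Acyclic-Indecomposable⇒Corolla G (nc , nl) ind = SingleVertex⇒Corolla G record
  { centre = centre ; only = λ v → lone (no-edge v) v centre ; no-edge = no-edge centre ; no-loop = nl ; no-io = proj₁ (proj₂ ind) }
  where
  module G = PGraph G
  a = Indecomposable⇒Atomic G ind
  _≟_ = _≟ᶠ_ {Elᶠ G.V}
  centre : El G.V
  centre with vertex a
  ... | inj₁ v = v
  ... | inj₂ x = ⊥-elim (nl x)
  is : El G.V → El G.V ⊎ El G.L → Bool
  is v (inj₁ w) = Dec.does (w ≟ v)
  is v (inj₂ _) = false
  -- A vertex without incoming edge forms a closed set by itself, which atomicity makes the set of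
  -- all vertices.
  no-source⇒lone : ∀ v → (∀ e → ¬ (G.t e ≡ v)) → ∀ w → w ≡ v
  no-source⇒lone v ne w with whole a (is v) (Closed-edges G (is v) λ e t → ⊥-elim (ne e (does-true (G.t e ≟ v) (T-true t))))
  ... | inj₁ n = ⊥-elim (does-false (v ≟ v) (n (inj₁ v)) refl)
  ... | inj₂ t = does-true (w ≟ v) (t (inj₁ w))
  no-edge : El G.V → Empty (El G.E)
  no-edge start e₀ = nc (Backwards.cycle G start pred)
    where
    pred : ∀ v → Σ (El G.E) λ e → G.t e ≡ v
    pred v with any? (Elᶠ G.E) (λ e → G.t e ≟ v)
    ... | yes p = p
    -- If `v` had no incoming edge it would be the only vertex, so `e₀` would end at `v` after all.
    ... | no ¬p = e₀ , no-source⇒lone v (λ e q → ¬p (e , q)) (G.t e₀)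
  lone : Empty (El G.E) → ∀ v w → v ≡ w
  lone ne v w = no-source⇒lone w (λ e → ⊥-elim (ne e)) v

-- Linear extension

module Linear {c ℓ m ℓm} {R : CommutativeRing c ℓ} (N : Module R m ℓm) where
  open Module N
  open CommutativeRing R using () renaming (Carrier to K; 0# to 0K)

  lin : {X : Set} → (X → Carrierᴹ) → Term R X → Carrierᴹ
  lin f (gen x) = f x
  lin f zeroT   = 0ᴹ
  lin f (x ⊞ y) = lin f x +ᴹ lin f y
  lin f (a ⊡ x) = a *ₗ lin f x

  lin-cong : {X : Set} {_~_ : X → X → Set} {f : X → Carrierᴹ} → (∀ {x y} → x ~ y → f x ≈ᴹ f y) →
             ∀ {u v} → TEq R _~_ u v → lin f u ≈ᴹ lin f v
  lin-cong s t-refl = ≈ᴹ-refl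
  lin-cong s (t-sym p) = ≈ᴹ-sym (lin-cong s p)
  lin-cong s (t-trans p q) = ≈ᴹ-trans (lin-cong s p) (lin-cong s q)
  lin-cong s (t-gen p) = s p
  lin-cong s (t-⊞-cong p q) = +ᴹ-cong (lin-cong s p) (lin-cong s q)
  lin-cong s (t-⊡-cong p q) = *ₗ-cong p (lin-cong s q)
  lin-cong s t-assoc = +ᴹ-assoc _ _ _
  lin-cong s t-comm = +ᴹ-comm _ _
  lin-cong s t-idˡ = +ᴹ-identityˡ _
  lin-cong s t-distˡ = *ₗ-distribˡ _ _ _
  lin-cong s t-distʳ = *ₗ-distribʳ _ _ _
  lin-cong s t-⊡-assoc = *ₗ-assoc _ _ _
  lin-cong s t-⊡-one = *ₗ-identityˡ _
  lin-cong s t-⊡-zero = *ₗ-zeroˡ _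

  lin-ext : {X : Set} {f g : X → Carrierᴹ} → (∀ x → f x ≈ᴹ g x) → ∀ u → lin f u ≈ᴹ lin g u
  lin-ext s (gen x) = s x
  lin-ext s zeroT   = ≈ᴹ-refl
  lin-ext s (u ⊞ v) = +ᴹ-cong (lin-ext s u) (lin-ext s v)
  lin-ext s (a ⊡ u) = *ₗ-cong (CommutativeRing.refl R) (lin-ext s u)

  lin-mapT : {X Y : Set} (f : Y → Carrierᴹ) (g : X → Term R Y) → ∀ u → lin f (mapT R g u) ≈ᴹ lin (λ x → lin f (g x)) u
  lin-mapT f g (gen x) = ≈ᴹ-refl
  lin-mapT f g zeroT   = ≈ᴹ-refl
  lin-mapT f g (u ⊞ v) = +ᴹ-cong (lin-mapT f g u) (lin-mapT f g v)
  lin-mapT f g (a ⊡ u) = *ₗ-cong (CommutativeRing.refl R) (lin-mapT f g u)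

  module _ {X : Set} (L : Term R X → Carrierᴹ) (L-zero : L zeroT ≈ᴹ 0ᴹ)
           (L-+ : ∀ u v → L (u ⊞ v) ≈ᴹ L u +ᴹ L v) (L-· : ∀ a u → L (a ⊡ u) ≈ᴹ a *ₗ L u) where
    lin-unique : ∀ u → L u ≈ᴹ lin (λ x → L (gen x)) u
    lin-unique (gen x) = ≈ᴹ-refl
    lin-unique zeroT   = L-zero
    lin-unique (u ⊞ v) = ≈ᴹ-trans (L-+ u v) (+ᴹ-cong (lin-unique u) (lin-unique v))
    lin-unique (a ⊡ u) = ≈ᴹ-trans (L-· a u) (*ₗ-cong (CommutativeRing.refl R) (lin-unique u))

module Push {c ℓ m ℓm m′ ℓm′} {R : CommutativeRing c ℓ} (N : Module R m ℓm) (N′ : Module R m′ ℓm′) where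
  private
    module N = Module N
    module N′ = Module N′
  open Linear

  module _ (L : N.Carrierᴹ → N′.Carrierᴹ) (L-cong : ∀ {p q} → p N.≈ᴹ q → L p N′.≈ᴹ L q)
           (L-+ : ∀ p q → L (p N.+ᴹ q) N′.≈ᴹ L p N′.+ᴹ L q) (L-· : ∀ a p → L (a N.*ₗ p) N′.≈ᴹ a N′.*ₗ L p) where
    push-zero : L N.0ᴹ N′.≈ᴹ N′.0ᴹ
    push-zero = N′.≈ᴹ-trans (L-cong (N.≈ᴹ-sym (N.*ₗ-zeroˡ N.0ᴹ))) (N′.≈ᴹ-trans (L-· _ _) (N′.*ₗ-zeroˡ _))

    lin-push : {X : Set} (f : X → N.Carrierᴹ) → ∀ u → L (lin N f u) N′.≈ᴹ lin N′ (λ x → L (f x)) u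
    lin-push f (gen x) = N′.≈ᴹ-refl
    lin-push f zeroT   = push-zero
    lin-push f (u ⊞ v) = N′.≈ᴹ-trans (L-+ _ _) (N′.+ᴹ-cong (lin-push f u) (lin-push f v))
    lin-push f (a ⊡ u) = N′.≈ᴹ-trans (L-· _ _) (N′.*ₗ-cong (CommutativeRing.refl R) (lin-push f u))

module Morphisms {c ℓ m ℓm} {R : CommutativeRing c ℓ} (N : SSModule R m ℓm) where
  open SSModule N

  infixr 3 _▹_
  _▹_ : ∀ {k l} {p q r : Car k l} → p ≋ q → q ≋ r → p ≋ r
  _▹_ {k} {l} = Module.≈ᴹ-trans (M k l)

  ≋-refl : ∀ {k l} {p : Car k l} → p ≋ p
  ≋-refl {k} {l} = Module.≈ᴹ-refl (M k l)

  ≋-sym : ∀ {k l} {p q : Car k l} → p ≋ q → q ≋ p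
  ≋-sym {k} {l} = Module.≈ᴹ-sym (M k l)

  0ᴺ : ∀ {k l} → Car k l
  0ᴺ {k} {l} = Module.0ᴹ (M k l)

  linᴺ : ∀ {k l} {X : Set} → (X → Car k l) → Term R X → Car k l
  linᴺ {k} {l} = Linear.lin (M k l)

  ▷-zero : ∀ {k l} (σ : Permutation′ l) → σ ▷ 0ᴺ {k} {l} ≋ 0ᴺ
  ▷-zero {k} {l} σ = Push.push-zero (M k l) (M k l) (σ ▷_) (▷-cong (λ _ → refl)) (▷-+ σ) (▷-· σ)

  ◁-zero : ∀ {k l} (τ : Permutation′ k) → 0ᴺ {k} {l} ◁ τ ≋ 0ᴺ
  ◁-zero {k} {l} τ = Push.push-zero (M k l) (M k l) (_◁ τ) (◁-cong (λ _ → refl)) (◁-+ τ) (◁-· τ)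

  module _ {𝒫 : PGPred} {f : ∀ {k l} → Span R 𝒫 k l → Car k l} (h : IsSSMorphism R 𝒫 N f) where
    open IsSSMorphism h

    morphism-gen : ∀ {k l} (u : Span R 𝒫 k l) → f u ≋ linᴺ (λ x → f (gen x)) u
    morphism-gen {k} {l} = Linear.lin-unique (M k l) f
      -- Preservation of zero is not a field of a morphism: `wd` replaces `zeroT` by a multiple with
      -- coefficient 0, which linearity evaluates.
      (wd zeroT (CommutativeRing.0# R ⊡ zeroT) (t-sym t-⊡-zero) ▹ ·-hom _ _ ▹ Module.*ₗ-zeroˡ (M k l) _) +-hom ·-hom

  module FromGraphs (f : ∀ {k l} → PGraph k l → Car k l) (f-iso : ∀ {k l} {G H : PGraph k l} → PIso G H → f G ≋ f H) where

    -- Elements of a span are compared in `PGr`, and a derivation of equality may pass through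
    -- graphs outside the family. Maps on spans are therefore restrictions of maps defined on all of
    -- `PGr`.
    extend : ∀ {k l} → PGr R k l → Car k l
    extend = linᴺ f

    extend-cong : ∀ {k l} {u v : PGr R k l} → TEq R PIso u v → extend u ≋ extend v
    extend-cong {k} {l} = Linear.lin-cong (M k l) f-iso

    extend-incl : ∀ {𝒫 : PGPred} {k l} (u : Span R 𝒫 k l) → extend (incl R 𝒫 u) ≋ linᴺ (λ x → f (proj₁ x)) u
    extend-incl {k = k} {l} u = Linear.lin-mapT (M k l) f (λ x → gen (proj₁ x)) u

    extend-ssMorphism : (∀ {k l} (σ : Permutation′ l) (G : PGraph k l) → f (σ ▷P G) ≋ σ ▷ f G) →
                        (∀ {k l} (τ : Permutation′ k) (G : PGraph k l) → f (G ◁P τ) ≋ f G ◁ τ) →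
                        (𝒫 : PGPred) → IsSSMorphism R 𝒫 N (λ u → extend (incl R 𝒫 u))
    extend-ssMorphism f-▷ f-◁ 𝒫 = record
      { wd = λ u v p → extend-cong p ; +-hom = λ u v → ≋-refl ; ·-hom = λ a u → ≋-refl
      ; ▷-hom = λ {k} {l} σ u v p → extend-cong p ▹ Linear.lin-mapT (M k l) f (λ G → gen (σ ▷P G)) (incl R 𝒫 u) ▹
          Linear.lin-ext (M k l) (f-▷ σ) (incl R 𝒫 u) ▹ ≋-sym (Push.lin-push (M k l) (M k l) (σ ▷_) (▷-cong (λ _ → refl)) (▷-+ σ) (▷-· σ) f (incl R 𝒫 u))
      ; ◁-hom = λ {k} {l} τ u v p → extend-cong p ▹ Linear.lin-mapT (M k l) f (λ G → gen (G ◁P τ)) (incl R 𝒫 u) ▹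
          Linear.lin-ext (M k l) (f-◁ τ) (incl R 𝒫 u) ▹ ≋-sym (Push.lin-push (M k l) (M k l) (_◁ τ) (◁-cong (λ _ → refl)) (◁-+ τ) (◁-· τ) f (incl R 𝒫 u)) }

-- Free ProPs on classes of indecomposable graphs

module FreeProP {c ℓ} (R : CommutativeRing c ℓ) (𝒫 𝒬 : PGPred)
  (𝒬-dec : ∀ {k l} (X : PGraph k l) → Indecomposable (PGraph.graph X) → Dec (𝒬 k l X))
  (𝒬-ind : ∀ {k l} (X : PGraph k l) → 𝒬 k l X → Indecomposable (PGraph.graph X))
  (𝒬-iso : ∀ {k l} {X Y : PGraph k l} → PIso X Y → 𝒬 k l X → 𝒬 k l Y)
  (𝒬-▷ : ∀ {k l} (σ : Permutation′ l) (X : PGraph k l) → Indecomposable (PGraph.graph X) → 𝒬 k l X → 𝒬 k l (σ ▷P X))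
  (𝒬-◁ : ∀ {k l} (τ : Permutation′ k) (X : PGraph k l) → Indecomposable (PGraph.graph X) → 𝒬 k l X → 𝒬 k l (X ◁P τ))
  (𝒫∩ind⊆𝒬 : ∀ {k l} (X : PGraph k l) → 𝒫 k l X → Indecomposable (PGraph.graph X) → 𝒬 k l X)
  (𝒫-iso : ∀ {k l} {G H : PGraph k l} → PIso G H → 𝒫 k l G → 𝒫 k l H)
  (𝒫-⊚ : ∀ {k l n} (G′ : PGraph l n) (G : PGraph k l) → 𝒫 k n (G′ ⊚P G) → 𝒫 l n G′ × 𝒫 k l G)
  (𝒫-* : ∀ {k l k′ l′} (G : PGraph k l) (G′ : PGraph k′ l′) → 𝒫 (k + k′) (l + l′) (G *P G′) → 𝒫 k l G × 𝒫 k′ l′ G′)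
  (𝒫-▷ : ∀ {k l} (σ : Permutation′ l) (G : PGraph k l) → 𝒫 k l (σ ▷P G) → 𝒫 k l G)
  (𝒫-◁ : ∀ {k l} (τ : Permutation′ k) (G : PGraph k l) → 𝒫 k l (G ◁P τ) → 𝒫 k l G)
  {m ℓm} (P : ProP R m ℓm) (φ : ∀ {k l} → Span R 𝒬 k l → ProP.Car P k l) (φ-hom : IsSSMorphism R 𝒬 (ProP.ssModule P) φ)
  where
  open ProP P hiding (_∘_; _*_)
  open ProP P using () renaming (_∘_ to infixr 10 _∙_; _*_ to infixl 15 _⋆_)
  open Morphisms ssModule
  private module φ = IsSSMorphism φ-hom

  -- Extending φ by 0 outside 𝒬 reduces the free ProP on corollas to the one on all indecomposable graphs.
  χ : ∀ {k l} (X : PGraph k l) → Indecomposable (PGraph.graph X) → Car k l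
  χ X i with 𝒬-dec X i
  ... | yes q = φ (gen (X , q))
  ... | no _  = 0ᴺ

  χ-𝒬 : ∀ {k l} (X : PGraph k l) i q → χ X i ≋ φ (gen (X , q))
  χ-𝒬 X i q with 𝒬-dec X i
  ... | yes q′ = φ.wd _ _ t-refl
  ... | no ¬q  = ⊥-elim (¬q q)

  χ-¬𝒬 : ∀ {k l} (X : PGraph k l) i → ¬ 𝒬 k l X → χ X i ≋ 0ᴺ
  χ-¬𝒬 X i ¬q with 𝒬-dec X i
  ... | yes q = ⊥-elim (¬q q)
  ... | no _  = ≋-refl

  private
    χ-iso : ∀ {k l} {X Y : PGraph k l} i j → PIso X Y → χ X i ≋ χ Y j
    χ-iso {X = X} {Y} i j e = by (𝒬-dec X i)
      where
      by : Dec (𝒬 _ _ X) → χ X i ≋ χ Y j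
      by (yes q) = χ-𝒬 X i q ▹ φ.wd (gen (X , q)) (gen (Y , 𝒬-iso e q)) (t-gen e) ▹ ≋-sym (χ-𝒬 Y j (𝒬-iso e q))
      by (no ¬q) = χ-¬𝒬 X i ¬q ▹ ≋-sym (χ-¬𝒬 Y j (λ q → ¬q (𝒬-iso e⁻ q)))
        where e⁻ = 𝔽-full (≈-sym (𝔽-iso e))

    χ-▷ : ∀ {k l} (σ : Permutation′ l) (X : PGraph k l) i j → χ (σ ▷P X) j ≋ σ ▷ χ X i
    χ-▷ σ X i j = by (𝒬-dec X i)
      where
      by : Dec (𝒬 _ _ X) → χ (σ ▷P X) j ≋ σ ▷ χ X i
      by (yes q) = χ-𝒬 (σ ▷P X) j (𝒬-▷ σ X i q) ▹ φ.▷-hom σ (gen (X , q)) (gen (σ ▷P X , 𝒬-▷ σ X i q)) t-refl ▹ ▷-cong (λ _ → refl) (≋-sym (χ-𝒬 X i q))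
      -- `σ ▷P X` is outside `𝒬` too, since acting with the inverse of `σ` would otherwise bring `X`
      -- into it.
      by (no ¬q) = χ-¬𝒬 (σ ▷P X) j (λ q → ¬q (𝒬-iso (▷-inverse σ X) (𝒬-▷ (↔-sym σ) (σ ▷P X) j q))) ▹
        ≋-sym (▷-cong (λ _ → refl) (χ-¬𝒬 X i ¬q) ▹ ▷-zero σ)

    χ-◁ : ∀ {k l} (τ : Permutation′ k) (X : PGraph k l) i j → χ (X ◁P τ) j ≋ χ X i ◁ τ
    χ-◁ τ X i j = by (𝒬-dec X i)
      where
      by : Dec (𝒬 _ _ X) → χ (X ◁P τ) j ≋ χ X i ◁ τ
      by (yes q) = χ-𝒬 (X ◁P τ) j (𝒬-◁ τ X i q) ▹ φ.◁-hom τ (gen (X , q)) (gen (X ◁P τ , 𝒬-◁ τ X i q)) t-refl ▹ ◁-cong (λ _ → refl) (≋-sym (χ-𝒬 X i q))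
      by (no ¬q) = χ-¬𝒬 (X ◁P τ) j (λ q → ¬q (𝒬-iso (◁-inverse τ X) (𝒬-◁ (↔-sym τ) (X ◁P τ) j q))) ▹
        ≋-sym (◁-cong (λ _ → refl) (χ-¬𝒬 X i ¬q) ▹ ◁-zero τ)

  module E = Extension P χ χ-iso χ-▷ χ-◁
  open FromGraphs E.Φ E.Φ-iso

  Φ : ∀ {k l} → Span R 𝒫 k l → Car k l
  Φ u = extend (incl R 𝒫 u)

  private
    bilinear-* : ∀ {k l k′ l′} (u : PGr R k l) (v : PGr R k′ l′) →
                 extend (mapT R (λ G → mapT R (λ H → gen (G *P H)) v) u) ≋ extend u ⋆ extend v
    bilinear-* {k} {l} {k′} {l′} u v =
      Linear.lin-mapT N″ E.Φ (λ G → mapT R (λ H → gen (G *P H)) v) u ▹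
      Linear.lin-ext N″ (λ G → Linear.lin-mapT N″ E.Φ (λ H → gen (G *P H)) v ▹ Linear.lin-ext N″ (E.Φ-* G) v ▹
        ≋-sym (Push.lin-push (M k′ l′) N″ (E.Φ G ⋆_) (*-cong ≋-refl) (*-+ʳ (E.Φ G)) (λ a p → *-·ʳ a (E.Φ G) p) E.Φ v)) u ▹
      ≋-sym (Push.lin-push (M k l) N″ (_⋆ extend v) (λ p → *-cong p ≋-refl) (λ p q → *-+ˡ p q _) (λ a p → *-·ˡ a p _) E.Φ u)
      where N″ = M (k + k′) (l + l′)

    bilinear-∘ : ∀ {k l n} (u : PGr R l n) (v : PGr R k l) →
                 extend (mapT R (λ G → mapT R (λ H → gen (G ⊚P H)) v) u) ≋ extend u ∙ extend v
    bilinear-∘ {k} {l} {n} u v =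
      Linear.lin-mapT N″ E.Φ (λ G → mapT R (λ H → gen (G ⊚P H)) v) u ▹
      Linear.lin-ext N″ (λ G → Linear.lin-mapT N″ E.Φ (λ H → gen (G ⊚P H)) v ▹ Linear.lin-ext N″ (E.Φ-⊚ G) v ▹
        ≋-sym (Push.lin-push (M k l) N″ (E.Φ G ∙_) (∘-cong ≋-refl) (∘-+ʳ (E.Φ G)) (λ a p → ∘-·ʳ a (E.Φ G) p) E.Φ v)) u ▹
      ≋-sym (Push.lin-push (M l n) N″ (_∙ extend v) (λ p → ∘-cong p ≋-refl) (λ p q → ∘-+ˡ p q _) (λ a p → ∘-·ˡ a p _) E.Φ u)
      where N″ = M k n

  Φ-hom : IsProPMorphism R 𝒫 P Φ
  Φ-hom = record
    { isSSMorphism = extend-ssMorphism E.Φ-▷ E.Φ-◁ 𝒫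
    ; *-hom = λ u v w p → extend-cong p ▹ bilinear-* (incl R 𝒫 u) (incl R 𝒫 v)
    ; ∘-hom = λ u v w p → extend-cong p ▹ bilinear-∘ (incl R 𝒫 u) (incl R 𝒫 v)
    ; I₀-hom = λ w p → extend-cong p ▹ E.Φ-I₀ ; I₁-hom = λ w p → extend-cong p ▹ E.Φ-I₁ }

  Φ-restricts : Restricts R {𝒫 = 𝒫} {𝒬} ssModule Φ φ
  Φ-restricts {k} {l} t u p = extend-cong p ▹ extend-incl {𝒬} u ▹
    Linear.lin-ext (M k l) (λ { (X , q) → E.Φ-indecomposable X (𝒬-ind X q) ▹ χ-𝒬 X (𝒬-ind X q) q }) u ▹ ≋-sym (morphism-gen φ-hom u)

  Φ-unique : (Ψ : ∀ {k l} → Span R 𝒫 k l → Car k l) → IsProPMorphism R 𝒫 P Ψ → Restricts R {𝒫 = 𝒫} {𝒬} ssModule Ψ φ →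
             ∀ {k l} (t : Span R 𝒫 k l) → Ψ t ≋ Φ t
  Φ-unique Ψ Ψ-hom Ψ-restricts {k} {l} t = morphism-gen Ψ.isSSMorphism t ▹
    Linear.lin-ext (M k l) (λ { (G , p) → E.Uniqueness.Ψ≋Φ 𝒫 𝒫-iso 𝒫-⊚ 𝒫-* 𝒫-▷ 𝒫-◁ (λ G p → Ψ (gen (G , p)))
      (λ p q i → Ψ.wd _ _ (t-gen i)) (λ G′ G p q r → Ψ.∘-hom _ _ _ t-refl) (λ G G′ p q r → Ψ.*-hom _ _ _ t-refl)
      (λ σ G p q → Ψ.▷-hom σ _ _ t-refl) (λ τ G p q → Ψ.◁-hom τ _ _ t-refl) (λ p → Ψ.I₀-hom _ t-refl) (λ p → Ψ.I₁-hom _ t-refl)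
      (λ X i p → Ψ-restricts _ (gen (X , 𝒫∩ind⊆𝒬 X p i)) t-refl ▹ ≋-sym (χ-𝒬 X i (𝒫∩ind⊆𝒬 X p i))) G p }) t ▹ ≋-sym (extend-incl {𝒫} t)
    where module Ψ where
            open IsProPMorphism Ψ-hom public
            open IsSSMorphism isSSMorphism public

  free : Σ (∀ {k l} → Span R 𝒫 k l → Car k l) λ Φ → IsProPMorphism R 𝒫 P Φ × Restricts R {𝒫 = 𝒫} {𝒬} ssModule Φ φ ×
         (∀ (Ψ : ∀ {k l} → Span R 𝒫 k l → Car k l) → IsProPMorphism R 𝒫 P Ψ → Restricts R {𝒫 = 𝒫} {𝒬} ssModule Ψ φ →
          ∀ {k l} (t : Span R 𝒫 k l) → Ψ t ≋ Φ t)
  free = Φ , Φ-hom , Φ-restricts , Φ-unique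

-- Freeness of the module of corollas

module FreeSSModule {c ℓ} (R : CommutativeRing c ℓ) {m ℓm} (N : SSModule R m ℓm) (n : (k l : ℕ) → SSModule.Car N k l) where
  open SSModule N
  open Morphisms N

  private
    value : ∀ {k l} → Permutation′ l → Permutation′ k → Car k l
    value {k} {l} σ τ = (σ ▷ n k l) ◁ τ

  ψ₀ : ∀ {k l} → PGraph k l → Car k l
  ψ₀ G with Corolla? G
  ... | yes (σ , τ , _) = value σ τ
  -- The value 0 extends the map from corollas to all planar graphs, as `extend` requires.
  ... | no _ = 0ᴺ

  -- `Corolla?` returns some presentation of `G`; by `corolla-unique` it has the same permutations
  -- as the given one.
  ψ₀-corolla : ∀ {k l} (G : PGraph k l) σ τ → CorollaHIso σ τ G → ψ₀ G ≋ value σ τ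
  ψ₀-corolla G σ τ θ with Corolla? G
  ... | no ¬c = ⊥-elim (¬c (σ , τ , CorollaHIso⇒PIso {σ = σ} {τ} θ))
  ... | yes (σ′ , τ′ , i) with corolla-unique {σ = σ′} {σ} {τ′} {τ} (𝔽-full (≈-trans (≈-sym (𝔽-iso i)) (𝔽-iso (CorollaHIso⇒PIso {σ = σ} {τ} θ))))
  ... | s , t = ◁-cong t (▷-cong s ≋-refl)

  ψ₀-other : ∀ {k l} (G : PGraph k l) → ¬ CorollaPG k l G → ψ₀ G ≋ 0ᴺ
  ψ₀-other G ¬c with Corolla? G
  ... | yes c = ⊥-elim (¬c c)
  ... | no _  = ≋-refl

  ψ₀-iso : ∀ {k l} {G H : PGraph k l} → PIso G H → ψ₀ G ≋ ψ₀ H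
  ψ₀-iso {k} {l} {G} {H} e = by (Corolla? G)
    where
    by : Dec (CorollaPG k l G) → ψ₀ G ≋ ψ₀ H
    by (yes (σ , τ , i)) = ψ₀-corolla G σ τ (PIso⇒CorollaHIso {σ = σ} {τ} i) ▹
      ≋-sym (ψ₀-corolla H σ τ (PIso⇒CorollaHIso {σ = σ} {τ} (𝔽-full (≈-trans (≈-sym (𝔽-iso e)) (𝔽-iso i)))))
    by (no ¬c) = ψ₀-other G ¬c ▹ ≋-sym (ψ₀-other H (λ c → ¬c (Corolla-iso (𝔽-full (≈-sym (𝔽-iso e))) c)))

  ψ₀-▷ : ∀ {k l} (ς : Permutation′ l) (G : PGraph k l) → ψ₀ (ς ▷P G) ≋ ς ▷ ψ₀ G
  ψ₀-▷ {k} {l} ς G = by (Corolla? G)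
    where
    by : Dec (CorollaPG k l G) → ψ₀ (ς ▷P G) ≋ ς ▷ ψ₀ G
    by (yes (σ , τ , i)) = ψ₀-corolla (ς ▷P G) (σ ∘ₚ ς) τ (▷-CorollaHIso ς {σ} {τ} θ) ▹ ◁-cong (λ _ → refl) (≋-sym (▷-∘ ς σ _)) ▹
        ▷◁ ς τ _ ▹ ▷-cong (λ _ → refl) (≋-sym (ψ₀-corolla G σ τ θ))
      where θ = PIso⇒CorollaHIso {σ = σ} {τ} i
    by (no ¬c) = ψ₀-other (ς ▷P G) (λ c → ¬c (Corolla-iso (▷-inverse ς G) (▷-Corolla (↔-sym ς) c))) ▹
      ≋-sym (▷-cong (λ _ → refl) (ψ₀-other G ¬c) ▹ ▷-zero ς)

  ψ₀-◁ : ∀ {k l} (ς : Permutation′ k) (G : PGraph k l) → ψ₀ (G ◁P ς) ≋ ψ₀ G ◁ ς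
  ψ₀-◁ {k} {l} ς G = by (Corolla? G)
    where
    by : Dec (CorollaPG k l G) → ψ₀ (G ◁P ς) ≋ ψ₀ G ◁ ς
    by (yes (σ , τ , i)) = ψ₀-corolla (G ◁P ς) σ (ς ∘ₚ τ) (◁-CorollaHIso ς {σ} {τ} θ) ▹ ≋-sym (◁-∘ τ ς _) ▹
        ◁-cong (λ _ → refl) (≋-sym (ψ₀-corolla G σ τ θ))
      where θ = PIso⇒CorollaHIso {σ = σ} {τ} i
    by (no ¬c) = ψ₀-other (G ◁P ς) (λ c → ¬c (Corolla-iso (◁-inverse ς G) (◁-Corolla (↔-sym ς) c))) ▹
      ≋-sym (◁-cong (λ _ → refl) (ψ₀-other G ¬c) ▹ ◁-zero ς)

  open FromGraphs ψ₀ ψ₀-iso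

  private
    PG-HIso : ∀ k l → CorollaHIso idₚ idₚ (PG k l)
    PG-HIso k l = reframe (λ _ → refl) (λ _ → refl) ≈-refl

    PG-corolla : ∀ k l → CorollaPG k l (PG k l)
    PG-corolla k l = idₚ , idₚ , CorollaHIso⇒PIso {σ = idₚ} {idₚ} (PG-HIso k l)

  free : Σ (∀ {k l} → Span R CorollaPG k l → Car k l) λ ψ → IsSSMorphism R CorollaPG N ψ ×
         (∀ {k l} (u : Span R CorollaPG k l) → TEq R PIso (incl R CorollaPG u) (gen (PG k l)) → ψ u ≋ n k l) ×
         (∀ (χ : ∀ {k l} → Span R CorollaPG k l → Car k l) → IsSSMorphism R CorollaPG N χ →
          (∀ {k l} (u : Span R CorollaPG k l) → TEq R PIso (incl R CorollaPG u) (gen (PG k l)) → χ u ≋ n k l) →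
          ∀ {k l} (u : Span R CorollaPG k l) → χ u ≋ ψ u)
  free = (λ u → extend (incl R CorollaPG u)) , extend-ssMorphism ψ₀-▷ ψ₀-◁ CorollaPG ,
    (λ {k} {l} u p → extend-cong p ▹ ψ₀-corolla (PG k l) idₚ idₚ (PG-HIso k l) ▹ ◁-id _ ▹ ▷-id _) , unique
    where
    unique : (χ : ∀ {k l} → Span R CorollaPG k l → Car k l) → IsSSMorphism R CorollaPG N χ →
             (∀ {k l} (u : Span R CorollaPG k l) → TEq R PIso (incl R CorollaPG u) (gen (PG k l)) → χ u ≋ n k l) →
             ∀ {k l} (u : Span R CorollaPG k l) → χ u ≋ extend (incl R CorollaPG u)
    unique χ χ-hom χ-PG {k} {l} u = morphism-gen χ-hom u ▹ Linear.lin-ext (M k l) on-corollas u ▹ ≋-sym (extend-incl {CorollaPG} u)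
      where
      module χ = IsSSMorphism χ-hom
      on-corollas : ∀ (x : Σ (PGraph k l) (CorollaPG k l)) → χ (gen x) ≋ ψ₀ (proj₁ x)
      -- `PG k l` and `σ ▷P PG k l` are corollas themselves, so both equivariance steps stay inside
      -- the span.
      on-corollas (G , c@(σ , τ , i)) = χ.◁-hom τ (gen (σ ▷P PG k l , ▷-Corolla σ (PG-corolla k l))) (gen (G , c)) (t-gen i) ▹
        ◁-cong (λ _ → refl) (χ.▷-hom σ (gen (PG k l , PG-corolla k l)) _ t-refl ▹ ▷-cong (λ _ → refl) (χ-PG _ t-refl)) ▹
        ≋-sym (ψ₀-corolla G σ τ (PIso⇒CorollaHIso {σ = σ} {τ} i))

indecomposable-resp : ∀ {k l k′ l′} {f : Fin k ↔ Fin k′} {g : Fin l ↔ Fin l′} {X : PGraph k l} {Y : PGraph k′ l′} → PH f g X Y →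
                      Indecomposable (PGraph.graph X) → Indecomposable (PGraph.graph Y)
indecomposable-resp {X = X} {Y} i ind = Atomic⇒Indecomposable Y (Atomic-HIso (PH⇒HIso i) (Indecomposable⇒Atomic X ind))

theorem3p20 : ∀ {c ℓ : Level} (F : Field c ℓ) {m ℓm : Level} →
    FreeProPOn (Field.commutativeRing F) AllPG IndPG m ℓm
    × FreeSSModuleOn (Field.commutativeRing F) CorollaPG (λ k l → gen (PG k l)) m ℓm
    × FreeProPOn (Field.commutativeRing F) AcyclicPG CorollaPG m ℓm
theorem3p20 F =
    FreeProP.free R AllPG IndPG (λ _ i → yes i) (λ _ i → i) (λ e → indecomposable-resp (PIso⇒PH e))
      (λ σ X _ → indecomposable-resp (▷-PH σ X)) (λ τ X _ → indecomposable-resp (◁-PH τ X)) (λ _ _ i → i)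
      (λ _ _ → tt) (λ _ _ _ → tt , tt) (λ _ _ _ → tt , tt) (λ _ _ _ → tt) (λ _ _ _ → tt)
  , FreeSSModule.free R
  , FreeProP.free R AcyclicPG CorollaPG (λ X _ → Corolla? X) (λ _ → Corolla⇒Indecomposable) Corolla-iso
      (λ σ _ _ → ▷-Corolla σ) (λ τ _ _ → ◁-Corolla τ) Acyclic-Indecomposable⇒Corolla
      Acyclic-iso Acyclic-⊚ Acyclic-* Acyclic-▷ Acyclic-◁
  where R = Field.commutativeRing F
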